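{- Fix an integer $m\ge1$ and a set $I$ with $\{(i,j,0): i+j=m\}\cup\{(0,0,m)\}\subset I\subset\mathcal M_{3,m}$. For $f(x,y)\in\mathbb{Z}[x,y]$ of degree $m$ let $F(x,y,z)=z^mf(x/z,y/z)$, let $I_f$ be the set of exponent vectors of monomials of $F$ having nonzero coefficient, and let $C_f$ be the projective curve $F=0$. Then for a positive proportion of $f(x,y)\in\mathbb{Z}[x,y]$ of degree $m$ with $I_f=I$ (ordered by the maximum absolute value of their coefficients, i.e. with positive lower density as this bound tends to infinity) we have $G(C_f)=m=G(H)$, where $H=\{(0,0,m),(0,m,0),(m,0,0)\}$ is the Newton polytope of every such $f$.
   Context: $\mathcal M_{3,m}=\{(i,j,k)\in\mathbb{Z}^3_{\ge0}: i+j+k=m\}$. $G(H)$ is the gcd of all coordinates of all elements of $H$. For a number field $L$, a point of $C_f$ over $L$ is new if it is non-singular and not defined over a proper subfield of $L$; $D(C_f)$ is the set of degrees $[L:\mathbb{Q}]$ of number fields $L$ over which $C_f$ has a new point, and $G(C_f)=\gcd D(C_f)$ is the index. -}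

module Defs where

open import Algebra.Bundles using (CommutativeRing)
open import Algebra.Morphism.Structures using (IsRingHomomorphism)
import Algebra.Properties.CommutativeMonoid.Sum as Sum
import Algebra.Properties.Semiring.Exp as Exp
open import Data.Bool.Base using (if_then_else_)
open import Data.Fin.Base using (Fin; toℕ)
open import Data.Integer.Base as ℤ using (ℤ; 0ℤ; ∣_∣)
open import Data.List.Base using (List; []; _∷_; foldr; length)
open import Data.List.Membership.Propositional using (_∈_)
import Data.List.Membership.Setoid as SetoidMembership
open import Data.List.Relation.Unary.All using (All)
import Data.List.Relation.Unary.Unique.Setoid as SetoidUnique
open import Data.Nat.Base as ℕ using (ℕ; suc; pred; _∸_; _≡ᵇ_; NonZero)
open import Data.Nat.Divisibility using (_∣_)
open import Data.Nat.GCD using (gcd)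
open import Data.Product using (Σ; _×_; _,_; ∃; ∃-syntax)
open import Data.Rational.Base as ℚ using (ℚ; 0ℚ; 1ℚ)
import Data.Rational.Properties as ℚ
open import Function.Bundles using (_⇔_)
open import Level using (Level; 0ℓ; _⊔_) renaming (suc to lsuc)
open import Relation.Binary.Bundles using (Setoid)
open import Relation.Binary.PropositionalEquality as ≡ using (_≡_; _≢_)
open import Relation.Nullary using (¬_)
open import Relation.Unary using (Pred; _∩_)

private
  variable
    p q : Level

------------------------------------------------------------------------
-- Exponent vectors

Exponent : Set
Exponent = ℕ × ℕ × ℕ

𝓜₃ : ℕ → Pred Exponent 0ℓ
𝓜₃ m (i , j , k) = i ℕ.+ j ℕ.+ k ≡ m

G : List Exponent → ℕ
G = foldr (λ { (i , j , k) g → gcd i (gcd j (gcd k g)) }) 0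

H : ℕ → List Exponent
H m = (0 , 0 , m) ∷ (0 , m , 0) ∷ (m , 0 , 0) ∷ []

------------------------------------------------------------------------
-- ℤ[x,y]

-- coeff i j is the coefficient of xⁱyʲ.  The bound only witnesses that
-- almost all coefficients vanish; it is irrelevant for equality.
record ℤ[x,y] : Set where
  field
    coeff      : ℕ → ℕ → ℤ
    bound      : ℕ
    vanishing  : ∀ i j → bound ℕ.< i ℕ.+ j → coeff i j ≡ 0ℤ

open ℤ[x,y] public

ℤ[x,y]-setoid : Setoid 0ℓ 0ℓ
ℤ[x,y]-setoid = record
  { Carrier       = ℤ[x,y]
  ; _≈_           = λ f g → ∀ i j → coeff f i j ≡ coeff g i j
  ; isEquivalence = record
    { refl  = λ i j → ≡.refl
    ; sym   = λ e i j → ≡.sym (e i j)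
    ; trans = λ d e i j → ≡.trans (d i j) (e i j)
    }
  }

HasDegree : ℤ[x,y] → ℕ → Set
HasDegree f m =
  (∀ i j → m ℕ.< i ℕ.+ j → coeff f i j ≡ 0ℤ) ×
  (∃[ i ] ∃[ j ] i ℕ.+ j ≡ m × coeff f i j ≢ 0ℤ)

-- The maximum absolute value of the coefficients is at most B.
Height≤ : ℕ → Pred ℤ[x,y] 0ℓ
Height≤ B f = ∀ i j → ∣ coeff f i j ∣ ℕ.≤ B

------------------------------------------------------------------------
-- Ternary forms, given by their coefficients

Form : Set
Form = Exponent → ℤ

-- zᵐ f(x/z, y/z), for f of degree m.
homogenize : ℕ → ℤ[x,y] → Form
homogenize m f (i , j , k) =
  if i ℕ.+ j ℕ.+ k ≡ᵇ m then coeff f i j else 0ℤ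

Support : Form → Pred Exponent 0ℓ
Support F e = F e ≢ 0ℤ

∂x ∂y ∂z : Form → Form
∂x F (i , j , k) = ℤ.+ suc i ℤ.* F (suc i , j , k)
∂y F (i , j , k) = ℤ.+ suc j ℤ.* F (i , suc j , k)
∂z F (i , j , k) = ℤ.+ suc k ℤ.* F (i , j , suc k)

-- Polynomials of degree m with I_f = I.
Family : ℕ → Pred Exponent 0ℓ → Pred ℤ[x,y] 0ℓ
Family m I f =
  HasDegree f m × (∀ e → Support (homogenize m f) e ⇔ I e)

------------------------------------------------------------------------
-- Newton polytope

ℚ³ : Set
ℚ³ = ℚ × ℚ × ℚ

toℚ : ℕ → ℚ
toℚ n = ℤ.+ n ℚ./ 1

toℚ³ : Exponent → ℚ³
toℚ³ (i , j , k) = toℚ i , toℚ j , toℚ k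

infixl 6 _+³_
infixl 7 _·³_

_+³_ : ℚ³ → ℚ³ → ℚ³
(a , b , c) +³ (a′ , b′ , c′) = a ℚ.+ a′ , b ℚ.+ b′ , c ℚ.+ c′

_·³_ : ℚ → ℚ³ → ℚ³
t ·³ (a , b , c) = t ℚ.* a , t ℚ.* b , t ℚ.* c

open Sum ℚ.+-0-commutativeMonoid using () renaming (sum to sumℚ)

sumℚ³ : ∀ {n} → (Fin n → ℚ³) → ℚ³
sumℚ³ v =
  sumℚ (λ i → let (a , _ , _) = v i in a) ,
  sumℚ (λ i → let (_ , b , _) = v i in b) ,
  sumℚ (λ i → let (_ , _ , c) = v i in c)

-- The polytopes here have integral vertices, so working over ℚ rather
-- than ℝ does not change their vertices.
ConvexHull : Pred Exponent 0ℓ → Pred ℚ³ 0ℓ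
ConvexHull S v =
  ∃[ n ] Σ (Fin n → ℚ) λ w → Σ (Fin n → Exponent) λ s →
    (∀ i → 0ℚ ℚ.≤ w i) ×
    (∀ i → S (s i)) ×
    sumℚ w ≡ 1ℚ ×
    v ≡ sumℚ³ (λ i → w i ·³ toℚ³ (s i))

IsExtremePoint : Pred ℚ³ 0ℓ → Pred ℚ³ 0ℓ
IsExtremePoint C v =
  C v ×
  (∀ a b t → C a → C b → 0ℚ ℚ.< t → t ℚ.< 1ℚ →
     v ≡ (t ·³ a) +³ ((1ℚ ℚ.- t) ·³ b) → a ≡ b)

-- A Newton polytope is recorded by its set of vertices.
IsNewtonPolytope : Form → List Exponent → Set
IsNewtonPolytope F V =
  ∀ v → IsExtremePoint (ConvexHull (Support F)) v ⇔
        (∃[ e ] e ∈ V × v ≡ toℚ³ e)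

------------------------------------------------------------------------
-- Number fields

record NumberField : Set₁ where
  field
    commutativeRing : CommutativeRing 0ℓ 0ℓ
  open CommutativeRing commutativeRing public
  open Sum +-commutativeMonoid public using (sum)
  open Exp semiring public using (_^_)
  field
    0≉1     : ¬ 0# ≈ 1#
    inverse : ∀ x → ¬ x ≈ 0# → ∃[ y ] x * y ≈ 1#
    ι       : ℚ → Carrier
    ι-isRingHomomorphism : IsRingHomomorphism ℚ.+-*-rawRing rawRing ι
    -- [ L : ℚ ] = degree, witnessed by a basis of L over ℚ
    degree  : ℕ
    basis   : Fin degree → Carrier
    spanning : ∀ x → Σ (Fin degree → ℚ) λ c →
      x ≈ sum (λ i → ι (c i) * basis i)
    independent : ∀ (c : Fin degree → ℚ) →
      sum (λ i → ι (c i) * basis i) ≈ 0# → ∀ i → c i ≡ 0ℚ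

  ιℤ : ℤ → Carrier
  ιℤ a = ι (a ℚ./ 1)

record Subfield (L : NumberField) : Set₁ where
  open NumberField L
  field
    member     : Pred Carrier 0ℓ
    resp-≈     : ∀ {x y} → x ≈ y → member x → member y
    0-closed   : member 0#
    1-closed   : member 1#
    +-closed   : ∀ {x y} → member x → member y → member (x + y)
    neg-closed : ∀ {x} → member x → member (- x)
    *-closed   : ∀ {x y} → member x → member y → member (x * y)
    inv-closed : ∀ {x y} → member x → x * y ≈ 1# → member y

  IsProper : Set
  IsProper = ∃[ x ] ¬ member x

------------------------------------------------------------------------
-- Points of the projective plane and of plane curves

module _ (L : NumberField) where
  open NumberField L

  record ProjectivePoint : Set where
    field
      X Y Z   : Carrier
      nonzero : ¬ (X ≈ 0# × Y ≈ 0# × Z ≈ 0#)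

  open ProjectivePoint

  -- The value of a form of degree d, i.e. the sum over i + j + k = d.
  evaluate : ℕ → Form → ProjectivePoint → Carrier
  evaluate d F P =
    sum {suc d} λ i → sum {suc (d ∸ toℕ i)} λ j →
      let k = d ∸ toℕ i ∸ toℕ j in
      ιℤ (F (toℕ i , toℕ j , k)) * (X P ^ toℕ i * (Y P ^ toℕ j * Z P ^ k))

  -- In the next two definitions F has degree m.
  OnCurve : ℕ → Form → ProjectivePoint → Set
  OnCurve m F P = evaluate m F P ≈ 0#

  IsSingular : ℕ → Form → ProjectivePoint → Set
  IsSingular m F P =
    evaluate (pred m) (∂x F) P ≈ 0# ×
    evaluate (pred m) (∂y F) P ≈ 0# ×
    evaluate (pred m) (∂z F) P ≈ 0#

  DefinedOver : Subfield L → ProjectivePoint → Set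
  DefinedOver K P =
    ∃[ c ] ¬ c ≈ 0# × member (c * X P) × member (c * Y P) × member (c * Z P)
    where open Subfield K

  IsNew : ℕ → Form → ProjectivePoint → Set₁
  IsNew m F P =
    ¬ IsSingular m F P ×
    ¬ (Σ (Subfield L) λ K → Subfield.IsProper K × DefinedOver K P)

------------------------------------------------------------------------
-- The index of C_f, for f of degree m

D : ℕ → ℤ[x,y] → Pred ℕ (lsuc 0ℓ)
D m f d =
  Σ NumberField λ L → NumberField.degree L ≡ d ×
    Σ (ProjectivePoint L) λ P →
      OnCurve L m (homogenize m f) P × IsNew L m (homogenize m f) P

IsGCDOf : Pred ℕ p → ℕ → Set p
IsGCDOf S g =
  (∀ d → S d → g ∣ d) × (∀ c → (∀ d → S d → c ∣ d) → c ∣ g)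

IsIndex : ℕ → ℤ[x,y] → Pred ℕ (lsuc 0ℓ)
IsIndex m f = IsGCDOf (D m f)

------------------------------------------------------------------------
-- Density

open SetoidMembership ℤ[x,y]-setoid using () renaming (_∈_ to _∈ᴾ_)
open SetoidUnique ℤ[x,y]-setoid using (Unique)

HasCardinality : Pred ℤ[x,y] p → ℕ → Set p
HasCardinality S n = Σ (List ℤ[x,y]) λ fs →
  Unique fs × All S fs × (∀ f → S f → f ∈ᴾ fs) × length fs ≡ n

HasAtLeast : Pred ℤ[x,y] p → ℕ → Set p
HasAtLeast S k = Σ (List ℤ[x,y]) λ fs →
  Unique fs × All S fs × length fs ≡ k

-- Among the members of A of height ≤ B, the proportion satisfying S is,
-- for all large B, at least some fixed δ > 0.  As S need not be
-- decidable, its members are only counted from below.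
PositiveProportion : Pred ℤ[x,y] p → Pred ℤ[x,y] q → Set (p ⊔ q)
PositiveProportion A S =
  ∃[ δ ] 0ℚ ℚ.< δ × ∃[ B₀ ] (∀ B → B₀ ℕ.≤ B →
    ∃[ n ] ∃[ k ] Σ (NonZero n) λ n≢0 →
      HasCardinality (A ∩ Height≤ B) n ×
      HasAtLeast (A ∩ Height≤ B ∩ S) k ×
      δ ℚ.≤ (ℤ.+ k ℚ./ n) {{n≢0}})

{-# OPTIONS --safe #-}
-- The good polynomials are those congruent to xᵐ + 3yᵐ + 9 modulo 27, which form a positive
-- proportion of the family.  On the line at infinity such an f is Eisenstein at 3, which gives a
-- new point of degree m.  Conversely, let L be a number field with a point (X : Y : Z) of the curve.
-- At a place of L above 3 with ramification index e and residue degree d, the least valuation among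
-- those of Xᵐ, 3Yᵐ and 9Zᵐ is attained twice.  This forces m ∣ e, unless only Xᵐ and 9Zᵐ
-- attain it; then m ∣ 2e, and if m is even then -1 is a square in the residue field, so that d is
-- even.  In all cases m ∣ ed, and [L : ℚ] is the sum of the numbers ed.
--
-- Valuations are avoided by counting dim N/3N for suitable subgroups N of L.  For θ ≠ 0 one has
-- dim N = dim N[θ] + dim N[1/θ] - dim N[θ,1/θ], where dim A stands for dim A/3A.  So it suffices to
-- treat those N which, for each of the finitely many θ that are compared in the argument above,
-- are stable under θ or under 1/θ.
module Submission where

open import Defs
open import Algebra.Bundles using (CommutativeRing; Ring)
open import Algebra.Morphism.Structures using (IsRingHomomorphism)
import Algebra.Properties.AbelianGroup as AbelianGroupProperties
import Algebra.Properties.CommutativeMonoid.Sum as CommutativeMonoidSum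
import Algebra.Properties.CommutativeSemiring.Exp as CommutativeExp
import Algebra.Properties.Ring as RingProperties
import Algebra.Properties.Semiring.Exp as Exp
import Algebra.Properties.Semiring.Sum as SemiringSum
import Algebra.Solver.Ring
open import Algebra.Solver.Ring.AlmostCommutativeRing using (fromCommutativeRing; _-Raw-AlmostCommutative⟶_)
open import Data.Bool.Base using (true; false; if_then_else_; T)
open import Data.Empty using (⊥-elim; ⊥)
open import Data.Fin.Base as Fin using (Fin; zero; suc; toℕ; fromℕ; fromℕ<; inject₁; punchIn; combine; remQuot)
open import Data.Fin.Induction using (<-weakInduction)
import Data.Fin.Properties as Fin
open import Data.Integer.Base as ℤ using (ℤ; 0ℤ; 1ℤ; +_; -[1+_]; ∣_∣)
open import Data.Integer.DivMod using (a≡a%ℕn+[a/ℕn]*n; n%ℕd<d) renaming (_%ℕ_ to _ℤ%ℕ_; _/ℕ_ to _ℤ/ℕ_)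
open import Data.Integer.Divisibility.Signed as ℤ∣ using (divides)
import Data.Integer.Properties as ℤ
open import Data.Integer.Solver renaming (module +-*-Solver to ℤSolver)
open import Data.List.Base as List using (List; []; _∷_; _++_; length; upTo; cartesianProductWith)
open import Data.List.Membership.Propositional using () renaming (_∈_ to _∈ᴸ_)
open import Data.List.Membership.Propositional.Properties using (∈-cartesianProductWith⁺; ∈-cartesianProductWith⁻; ∈-++⁺ˡ; ∈-++⁺ʳ; ∈-++⁻; ∈-map⁺; ∈-map⁻; ∈-upTo⁺; ∈-upTo⁻)
import Data.List.Membership.Setoid as SetoidMembership
import Data.List.Properties as List
open import Data.List.Relation.Unary.All as All using (All; []; _∷_)
import Data.List.Relation.Unary.All.Properties as All
open import Data.List.Relation.Unary.AllPairs using ([]; _∷_)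
open import Data.List.Relation.Unary.Any as Any using (here; there)
import Data.List.Relation.Unary.Any.Properties as Any
open import Data.List.Relation.Unary.Unique.Propositional using (Unique)
import Data.List.Relation.Unary.Unique.Propositional.Properties as Unique
open import Data.List.Relation.Unary.Unique.Setoid ℤ[x,y]-setoid using () renaming (Unique to Uniqueᴾ)
import Data.List.Relation.Unary.Unique.Setoid.Properties as SetoidUnique
open import Data.Maybe.Base using (Maybe; just; nothing)
open import Data.Nat.Base as ℕ using (ℕ; zero; suc; s≤s; z≤n; _∸_; _≡ᵇ_; NonZero)
import Data.Nat.Divisibility as ℕ∣
open import Data.Nat.DivMod using (m≡m%n+[m/n]*n; m%n<n; m/n*n≤m; /-monoˡ-≤)
open import Data.Nat.GCD using (gcd; gcd-identityˡ; gcd-identityʳ; gcd[m,n]∣m; gcd-greatest)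
open import Data.Nat.Induction using (<-wellFounded)
import Data.Nat.Properties as ℕ
open import Data.Nat.Solver renaming (module +-*-Solver to ℕSolver)
open import Data.Product using (Σ; _×_; _,_; ∃-syntax; proj₁; proj₂; uncurry)
open import Data.Rational.Base as ℚ using (ℚ; 0ℚ; 1ℚ; ½; mkℚ; toℚᵘ; ↥_; ↧_)
import Data.Rational.Properties as ℚ
open import Data.Rational.Solver renaming (module +-*-Solver to ℚSolver)
import Data.Rational.Unnormalised.Base as ℚᵘ
import Data.Rational.Unnormalised.Properties as ℚᵘ
open import Data.Sum using (_⊎_; inj₁; inj₂)
open import Data.Unit using (⊤; tt)
open import Data.Vec.Base as Vec using (Vec; []; _∷_; lookup; tabulate)
open import Data.Vec.Functional as Vector using ()
open import Data.Vec.Functional.Properties using (insertAt-lookup; insertAt-punchIn)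
import Data.Vec.Properties as Vec
open import Function.Base using (_∘_; id)
open import Function.Bundles using (mk⇔; Equivalence)
open import Induction.WellFounded using (Acc; acc)
open import Level using (0ℓ)
import Relation.Binary.Reasoning.Setoid
open import Relation.Binary.PropositionalEquality as ≡ using (_≡_; _≢_; _≗_)
open import Relation.Nullary using (¬_; Dec; yes; no)
open import Relation.Nullary.Decidable using (decidable-stable; ¬?; _×-dec_)
open import Relation.Unary using (Pred; Decidable)

-- The obstacle is an even `m`. A tie between two terms whose coefficients have 3-adic valuations
-- differing by a number prime to `m` forces ramification divisible by `m`; but of any three
-- integers two have the same parity, so for even `m` the three differences cannot all be prime to
-- `m`. With the valuations 0, 1, 2 just a factor 2 is lost, for a single pair, and it has to come
-- from the residue degree. This dictates the prime: modulo 3, unlike modulo 2, `-1` is not a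
-- square. The modulus is 27 = 3 · 9 because the least term `g` divides 9 times every monomial of
-- degree `m` in `X`, `Y`, `Z`; altering the coefficients by multiples of 27 changes the sum by a
-- multiple of `3g`. The condition v(a) ≤ v(b) becomes: `b` is a multiple of `a` by an element
-- stabilising `N`. These multiplier rings only grow in the course of the argument, so comparisons
-- persist, and the claim about `N` is handed on as a continuation. It is finally applied to a
-- lattice of dimension [L : ℚ], so that no sum over places is ever formed. Bases of quotients of
-- arbitrary subgroups exist only classically; this is harmless since `m ∣ d` is decidable.

private
  module ℚΣ = SemiringSum (CommutativeRing.semiring ℚ.+-*-commutativeRing)
  module ℤΣ = SemiringSum (CommutativeRing.semiring ℤ.+-*-commutativeRing)

open SetoidMembership ℤ[x,y]-setoid using () renaming (_∈_ to _∈ᴾ_)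


-- Double negation

DN : ∀ {a} → Set a → Set a
DN A = ¬ ¬ A

return : ∀ {a} {A : Set a} → A → DN A
return x k = k x

infixl 1 _>>=_
_>>=_ : ∀ {a b} {A : Set a} {B : Set b} → DN A → (A → DN B) → DN B
(m >>= f) k = m λ x → f x k

excluded-middle : ∀ {a} (A : Set a) → DN (Dec A)
excluded-middle A k = k (no λ x → k (yes x))

-- Residues modulo 3

private
  square₁ : ∀ q → (1ℤ ℤ.+ q ℤ.* + 3) ℤ.* (1ℤ ℤ.+ q ℤ.* + 3) ≡ 1ℤ ℤ.+ (q ℤ.* + 2 ℤ.+ q ℤ.* q ℤ.* + 3) ℤ.* + 3
  square₁ = solve 1 (λ q → (con (+ 1) :+ q :* con (+ 3)) :* (con (+ 1) :+ q :* con (+ 3))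
    := con (+ 1) :+ (q :* con (+ 2) :+ q :* q :* con (+ 3)) :* con (+ 3)) ≡.refl
    where open ℤSolver

  square₂ : ∀ q → (+ 2 ℤ.+ q ℤ.* + 3) ℤ.* (+ 2 ℤ.+ q ℤ.* + 3) ≡ 1ℤ ℤ.+ (1ℤ ℤ.+ q ℤ.* + 4 ℤ.+ q ℤ.* q ℤ.* + 3) ℤ.* + 3
  square₂ = solve 1 (λ q → (con (+ 2) :+ q :* con (+ 3)) :* (con (+ 2) :+ q :* con (+ 3))
    := con (+ 1) :+ (con (+ 1) :+ q :* con (+ 4) :+ q :* q :* con (+ 3)) :* con (+ 3)) ≡.refl
    where open ℤSolver

-- The units of ℤ/3 are 1 and -1, so an integer prime to 3 inverts itself modulo 3. In this form no
-- inverse ever has to be computed or carried along.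
3∤⇒square : ∀ k → (∃[ t ] k ≡ t ℤ.* + 3) ⊎ (∃[ t ] k ℤ.* k ≡ 1ℤ ℤ.+ t ℤ.* + 3)
3∤⇒square k with k ℤ%ℕ 3 | k ℤ/ℕ 3 | a≡a%ℕn+[a/ℕn]*n k 3 | n%ℕd<d k 3
... | 0 | q | k≡ | _ = inj₁ (q , ≡.trans k≡ (ℤ.+-identityˡ (q ℤ.* + 3)))
... | 1 | q | k≡ | _ = inj₂ (q ℤ.* + 2 ℤ.+ q ℤ.* q ℤ.* + 3 , ≡.trans (≡.cong₂ ℤ._*_ k≡ k≡) (square₁ q))
... | 2 | q | k≡ | _ = inj₂ (1ℤ ℤ.+ q ℤ.* + 4 ℤ.+ q ℤ.* q ℤ.* + 3 , ≡.trans (≡.cong₂ ℤ._*_ k≡ k≡) (square₂ q))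
... | suc (suc (suc _)) | _ | _ | s≤s (s≤s (s≤s ()))

-- Integers as rationals

fromℤ : ℤ → ℚ
fromℤ k = k ℚ./ 1

private
  toℚᵘ-fromℤ : ∀ k → toℚᵘ (fromℤ k) ℚᵘ.≃ ℚᵘ.mkℚᵘ k 0
  toℚᵘ-fromℤ k = ℚ.toℚᵘ-fromℚᵘ (ℚᵘ.mkℚᵘ k 0)

fromℤ-homo-+ : ∀ j k → fromℤ (j ℤ.+ k) ≡ fromℤ j ℚ.+ fromℤ k
fromℤ-homo-+ j k = ℚ.toℚᵘ-injective (begin
  toℚᵘ (fromℤ (j ℤ.+ k))               ≈⟨ toℚᵘ-fromℤ (j ℤ.+ k) ⟩
  ℚᵘ.mkℚᵘ (j ℤ.+ k) 0                  ≈⟨ ℚᵘ.*≡* (solve 2 (λ x y → (x :+ y) :* con (+ 1) := (x :* con (+ 1) :+ y :* con (+ 1)) :* con (+ 1)) ≡.refl j k) ⟩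
  ℚᵘ.mkℚᵘ j 0 ℚᵘ.+ ℚᵘ.mkℚᵘ k 0         ≈⟨ ℚᵘ.+-cong (ℚᵘ.≃-sym (toℚᵘ-fromℤ j)) (ℚᵘ.≃-sym (toℚᵘ-fromℤ k)) ⟩
  toℚᵘ (fromℤ j) ℚᵘ.+ toℚᵘ (fromℤ k)   ≈⟨ ℚᵘ.≃-sym (ℚ.toℚᵘ-homo-+ (fromℤ j) (fromℤ k)) ⟩
  toℚᵘ (fromℤ j ℚ.+ fromℤ k)           ∎)
  where
  open ℚᵘ.≃-Reasoning
  open ℤSolver

fromℤ-homo-* : ∀ j k → fromℤ (j ℤ.* k) ≡ fromℤ j ℚ.* fromℤ k
fromℤ-homo-* j k = ℚ.toℚᵘ-injective (begin
  toℚᵘ (fromℤ (j ℤ.* k))               ≈⟨ toℚᵘ-fromℤ (j ℤ.* k) ⟩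
  ℚᵘ.mkℚᵘ j 0 ℚᵘ.* ℚᵘ.mkℚᵘ k 0         ≈⟨ ℚᵘ.*-cong (ℚᵘ.≃-sym (toℚᵘ-fromℤ j)) (ℚᵘ.≃-sym (toℚᵘ-fromℤ k)) ⟩
  toℚᵘ (fromℤ j) ℚᵘ.* toℚᵘ (fromℤ k)   ≈⟨ ℚᵘ.≃-sym (ℚ.toℚᵘ-homo-* (fromℤ j) (fromℤ k)) ⟩
  toℚᵘ (fromℤ j ℚ.* fromℤ k)           ∎)
  where open ℚᵘ.≃-Reasoning

fromℤ-homo-neg : ∀ k → fromℤ (ℤ.- k) ≡ ℚ.- fromℤ k
fromℤ-homo-neg k = ℚ.toℚᵘ-injective (begin
  toℚᵘ (fromℤ (ℤ.- k))   ≈⟨ toℚᵘ-fromℤ (ℤ.- k) ⟩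
  ℚᵘ.- ℚᵘ.mkℚᵘ k 0       ≈⟨ ℚᵘ.-‿cong (ℚᵘ.≃-sym (toℚᵘ-fromℤ k)) ⟩
  ℚᵘ.- toℚᵘ (fromℤ k)    ≈⟨ ℚᵘ.≃-sym (ℚ.toℚᵘ-homo‿- (fromℤ k)) ⟩
  toℚᵘ (ℚ.- fromℤ k)     ∎)
  where open ℚᵘ.≃-Reasoning

fromℤ-injective : ∀ {j k} → fromℤ j ≡ fromℤ k → j ≡ k
fromℤ-injective {j} {k} eq with ℚ./-injective-≃ (ℚᵘ.mkℚᵘ j 0) (ℚᵘ.mkℚᵘ k 0) eq
... | ℚᵘ.*≡* e = ≡.trans (≡.sym (ℤ.*-identityʳ j)) (≡.trans e (ℤ.*-identityʳ k))

↧*p≡↥p : ∀ p → fromℤ (↧ p) ℚ.* p ≡ fromℤ (↥ p)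
↧*p≡↥p p@(mkℚ n d-1 _) = ℚ.toℚᵘ-injective (begin
  toℚᵘ (fromℤ (↧ p) ℚ.* p)           ≈⟨ ℚ.toℚᵘ-homo-* (fromℤ (↧ p)) p ⟩
  toℚᵘ (fromℤ (↧ p)) ℚᵘ.* toℚᵘ p     ≈⟨ ℚᵘ.*-cong (toℚᵘ-fromℤ (↧ p)) ℚᵘ.≃-refl ⟩
  ℚᵘ.mkℚᵘ (↧ p) 0 ℚᵘ.* toℚᵘ p        ≈⟨ ℚᵘ.*≡* (≡.trans (ℤ.*-identityʳ _) (≡.trans (ℤ.*-comm (+ suc d-1) n) (≡.cong (λ k → n ℤ.* + suc k) (≡.sym (ℕ.+-identityʳ d-1))))) ⟩
  ℚᵘ.mkℚᵘ (↥ p) 0                    ≈⟨ ℚᵘ.≃-sym (toℚᵘ-fromℤ (↥ p)) ⟩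
  toℚᵘ (fromℤ (↥ p))                 ∎)
  where open ℚᵘ.≃-Reasoning

↧≢0 : ∀ p → ↧ p ≢ 0ℤ
↧≢0 (mkℚ _ _ _) ()

p*q≡0⇒q≡0 : ∀ {p q} → p ≢ 0ℚ → p ℚ.* q ≡ 0ℚ → q ≡ 0ℚ
p*q≡0⇒q≡0 {p} {q} p≢0 pq≡0 = begin
  q                          ≡⟨ ≡.sym (ℚ.*-identityˡ q) ⟩
  1ℚ ℚ.* q                   ≡⟨ ≡.cong (ℚ._* q) (≡.sym (ℚ.*-inverseˡ p)) ⟩
  (ℚ.1/ p) ℚ.* p ℚ.* q       ≡⟨ ℚ.*-assoc (ℚ.1/ p) p q ⟩
  (ℚ.1/ p) ℚ.* (p ℚ.* q)     ≡⟨ ≡.cong ((ℚ.1/ p) ℚ.*_) pq≡0 ⟩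
  (ℚ.1/ p) ℚ.* 0ℚ            ≡⟨ ℚ.*-zeroʳ (ℚ.1/ p) ⟩
  0ℚ                         ∎
  where
  open ≡.≡-Reasoning
  instance _ = ℚ.≢-nonZero p≢0

-- Kernels of matrices with more rows than columns

open CommutativeMonoidSum ℚ.+-0-commutativeMonoid public using () renaming (sum to sumℚ)

private
  eliminate : ∀ y d e s f → y ℚ.* d ≡ y ℚ.* e ℚ.* (s ℚ.* f) ℚ.+ y ℚ.* (d ℚ.- e ℚ.* s ℚ.* f)
  eliminate = solve 5 (λ y d e s f → y :* d := y :* e :* (s :* f) :+ y :* (d :- e :* s :* f)) ≡.refl
    where open ℚSolver

  cancel-pivot : ∀ s t f → (ℚ.- (s ℚ.* t)) ℚ.* f ℚ.+ (s ℚ.* (t ℚ.* f) ℚ.+ 0ℚ) ≡ 0ℚ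
  cancel-pivot = solve 3 (λ s t f → (:- (s :* t)) :* f :+ (s :* (t :* f) :+ con 0ℚ) := con 0ℚ) ≡.refl
    where open ℚSolver

-- Gaussian elimination on column zero, by induction on the number of columns.
rational-kernel : ∀ n (c : Fin (suc n) → Fin n → ℚ) →
  Σ (Fin (suc n) → ℚ) λ x → (∃[ i ] x i ≢ 0ℚ) × (∀ j → sumℚ (λ i → x i ℚ.* c i j) ≡ 0ℚ)
rational-kernel zero    c = (λ _ → 1ℚ) , (zero , λ ()) , λ ()
rational-kernel (suc n) c with Fin.any? (λ i → ¬? (c i zero ℚ.≟ 0ℚ))
... | no ∄pivot = 0ℚ Vector.∷ x′ , (suc (proj₁ x′≢0) , proj₂ x′≢0) , kernel
  where
  -- Without a pivot the column imposes no condition, and row zero is discarded together with it.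
  column≡0 : ∀ i → c i zero ≡ 0ℚ
  column≡0 i = decidable-stable (c i zero ℚ.≟ 0ℚ) λ p → ∄pivot (i , p)
  ih = rational-kernel n (λ i j → c (suc i) (suc j))
  x′ = proj₁ ih
  x′≢0 = proj₁ (proj₂ ih)
  kernel : ∀ j → sumℚ (λ i → (0ℚ Vector.∷ x′) i ℚ.* c i j) ≡ 0ℚ
  kernel zero = ≡.trans (ℚΣ.sum-cong-≗ λ i → ≡.trans (≡.cong ((0ℚ Vector.∷ x′) i ℚ.*_) (column≡0 i)) (ℚ.*-zeroʳ ((0ℚ Vector.∷ x′) i)))
                        (ℚΣ.sum-replicate-zero (suc (suc n)))
  kernel (suc j) = ≡.trans (≡.cong₂ ℚ._+_ (ℚ.*-zeroˡ (c zero (suc j))) (proj₂ (proj₂ ih) j)) (ℚ.+-identityˡ 0ℚ)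
... | yes (p , pivot) = x , (punchIn p (proj₁ x′≢0) , λ e → proj₂ x′≢0 (≡.trans (≡.sym (insertAt-punchIn x′ p v _)) e)) , kernel
  where
  instance _ = ℚ.≢-nonZero pivot
  r = ℚ.1/ (c p zero)
  c′ : Fin (suc n) → Fin (suc n) → ℚ
  c′ i j = c (punchIn p i) j ℚ.- c (punchIn p i) zero ℚ.* r ℚ.* c p j
  ih = rational-kernel n (λ i j → c′ i (suc j))
  x′ = proj₁ ih
  x′≢0 = proj₁ (proj₂ ih)
  S = sumℚ (λ i → x′ i ℚ.* c (punchIn p i) zero)
  -- Column zero forces this coefficient of the pivot row. In the remaining columns the relation
  -- then reduces to the one for `c′`, the matrix with column zero cleared.
  v = ℚ.- (S ℚ.* r)
  x = Vector.insertAt x′ p v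
  cancel : r ℚ.* c p zero ≡ 1ℚ
  cancel = ℚ.*-inverseˡ (c p zero)
  eliminated : ∀ j → sumℚ (λ i → x′ i ℚ.* c′ i j) ≡ 0ℚ
  eliminated zero = ≡.trans (ℚΣ.sum-cong-≗ λ i → let w = c (punchIn p i) zero in
      ≡.trans (≡.cong (x′ i ℚ.*_) (≡.trans (≡.cong (λ t → w ℚ.- t) (≡.trans (ℚ.*-assoc w r _) (≡.trans (≡.cong (w ℚ.*_) cancel) (ℚ.*-identityʳ w)))) (ℚ.+-inverseʳ w))) (ℚ.*-zeroʳ (x′ i)))
    (ℚΣ.sum-replicate-zero (suc n))
  eliminated (suc j) = proj₂ (proj₂ ih) j
  split : ∀ j → sumℚ (λ i → x′ i ℚ.* c (punchIn p i) j) ≡ S ℚ.* (r ℚ.* c p j) ℚ.+ sumℚ (λ i → x′ i ℚ.* c′ i j)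
  split j = begin
    sumℚ (λ i → x′ i ℚ.* c (punchIn p i) j)
      ≡⟨ ℚΣ.sum-cong-≗ (λ i → eliminate (x′ i) (c (punchIn p i) j) (c (punchIn p i) zero) r (c p j)) ⟩
    sumℚ (λ i → x′ i ℚ.* c (punchIn p i) zero ℚ.* (r ℚ.* c p j) ℚ.+ x′ i ℚ.* c′ i j)
      ≡⟨ ℚΣ.∑-distrib-+ (λ i → x′ i ℚ.* c (punchIn p i) zero ℚ.* (r ℚ.* c p j)) (λ i → x′ i ℚ.* c′ i j) ⟩
    sumℚ (λ i → x′ i ℚ.* c (punchIn p i) zero ℚ.* (r ℚ.* c p j)) ℚ.+ sumℚ (λ i → x′ i ℚ.* c′ i j)
      ≡⟨ ≡.cong (ℚ._+ sumℚ (λ i → x′ i ℚ.* c′ i j)) (≡.sym (ℚΣ.*-distribʳ-sum (r ℚ.* c p j) (λ i → x′ i ℚ.* c (punchIn p i) zero))) ⟩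
    S ℚ.* (r ℚ.* c p j) ℚ.+ sumℚ (λ i → x′ i ℚ.* c′ i j) ∎
    where open ≡.≡-Reasoning
  kernel : ∀ j → sumℚ (λ i → x i ℚ.* c i j) ≡ 0ℚ
  kernel j = begin
    sumℚ (λ i → x i ℚ.* c i j)
      ≡⟨ ℚΣ.sum-remove {i = p} (λ i → x i ℚ.* c i j) ⟩
    x p ℚ.* c p j ℚ.+ sumℚ (λ i → x (punchIn p i) ℚ.* c (punchIn p i) j)
      ≡⟨ ≡.cong₂ ℚ._+_ (≡.cong (ℚ._* c p j) (insertAt-lookup x′ p v)) (ℚΣ.sum-cong-≗ λ i → ≡.cong (ℚ._* c (punchIn p i) j) (insertAt-punchIn x′ p v i)) ⟩
    v ℚ.* c p j ℚ.+ sumℚ (λ i → x′ i ℚ.* c (punchIn p i) j)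
      ≡⟨ ≡.cong (v ℚ.* c p j ℚ.+_) (≡.trans (split j) (≡.cong (S ℚ.* (r ℚ.* c p j) ℚ.+_) (eliminated j))) ⟩
    v ℚ.* c p j ℚ.+ (S ℚ.* (r ℚ.* c p j) ℚ.+ 0ℚ)
      ≡⟨ cancel-pivot S r (c p j) ⟩
    0ℚ ∎
    where open ≡.≡-Reasoning

-- Clearing denominators

common-denominator : ∀ {n} (x : Fin n → ℚ) →
  ∃[ D ] D ≢ 0ℤ × Σ (Fin n → ℤ) λ z → ∀ i → fromℤ D ℚ.* x i ≡ fromℤ (z i)
common-denominator {zero}  x = 1ℤ , (λ ()) , (λ ()) , λ ()
common-denominator {suc n} x with common-denominator (x ∘ suc)
... | D , D≢0 , z , Dx≡z = ↧ x zero ℤ.* D , nonzero , (D ℤ.* ↥ x zero Vector.∷ λ i → ↧ x zero ℤ.* z i) , scaled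
  where
  nonzero : ↧ x zero ℤ.* D ≢ 0ℤ
  nonzero e with ℤ.i*j≡0⇒i≡0∨j≡0 (↧ x zero) e
  ... | inj₁ p = ↧≢0 (x zero) p
  ... | inj₂ p = D≢0 p
  scaled : ∀ i → fromℤ (↧ x zero ℤ.* D) ℚ.* x i ≡ fromℤ ((D ℤ.* ↥ x zero Vector.∷ λ i → ↧ x zero ℤ.* z i) i)
  scaled zero = begin
    fromℤ (↧ x zero ℤ.* D) ℚ.* x zero             ≡⟨ ≡.cong (ℚ._* x zero) (≡.trans (≡.cong fromℤ (ℤ.*-comm (↧ x zero) D)) (fromℤ-homo-* D (↧ x zero))) ⟩
    fromℤ D ℚ.* fromℤ (↧ x zero) ℚ.* x zero       ≡⟨ ℚ.*-assoc (fromℤ D) _ _ ⟩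
    fromℤ D ℚ.* (fromℤ (↧ x zero) ℚ.* x zero)     ≡⟨ ≡.cong (fromℤ D ℚ.*_) (↧*p≡↥p (x zero)) ⟩
    fromℤ D ℚ.* fromℤ (↥ x zero)                  ≡⟨ ≡.sym (fromℤ-homo-* D (↥ x zero)) ⟩
    fromℤ (D ℤ.* ↥ x zero)                        ∎
    where open ≡.≡-Reasoning
  scaled (suc i) = begin
    fromℤ (↧ x zero ℤ.* D) ℚ.* x (suc i)          ≡⟨ ≡.cong (ℚ._* x (suc i)) (fromℤ-homo-* (↧ x zero) D) ⟩
    fromℤ (↧ x zero) ℚ.* fromℤ D ℚ.* x (suc i)    ≡⟨ ℚ.*-assoc (fromℤ (↧ x zero)) _ _ ⟩
    fromℤ (↧ x zero) ℚ.* (fromℤ D ℚ.* x (suc i))  ≡⟨ ≡.cong (fromℤ (↧ x zero) ℚ.*_) (Dx≡z i) ⟩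
    fromℤ (↧ x zero) ℚ.* fromℤ (z i)              ≡⟨ ≡.sym (fromℤ-homo-* (↧ x zero) (z i)) ⟩
    fromℤ (↧ x zero ℤ.* z i)                      ∎
    where open ≡.≡-Reasoning

-- The division by 3 terminates because the fixed nonzero entry `z i` shrinks in absolute value each
-- time.
strip-3 : ∀ {n} (z : Fin n → ℤ) i → z i ≢ 0ℤ →
  Σ (Fin n → ℤ) λ y → (∃[ e ] ∀ j → z j ≡ (+ 3) ℤ.^ e ℤ.* y j) × (∃[ j ] ¬ (+ 3) ℤ∣.∣ y j)
strip-3 z i zi≢0 = go z zi≢0 (<-wellFounded ∣ z i ∣)
  where
  go : ∀ z → z i ≢ 0ℤ → Acc ℕ._<_ ∣ z i ∣ →
    Σ _ λ y → (∃[ e ] ∀ j → z j ≡ (+ 3) ℤ.^ e ℤ.* y j) × (∃[ j ] ¬ (+ 3) ℤ∣.∣ y j)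
  go z zi≢0 (acc rec) with Fin.all? (λ j → (+ 3) ℤ∣.∣? z j)
  ... | no ¬all = z , (0 , λ j → ≡.sym (ℤ.*-identityˡ (z j))) ,
      decidable-stable (Fin.any? (λ j → ¬? ((+ 3) ℤ∣.∣? z j)))
        (λ ∄ → ¬all λ j → decidable-stable ((+ 3) ℤ∣.∣? z j) λ p → ∄ (j , p))
  ... | yes all = let y , (e , z′≡) , prim = go z′ z′i≢0 (rec smaller) in
      y , (suc e , λ j → ≡.trans (z≡ j) (≡.trans (ℤ.*-comm (z′ j) (+ 3)) (≡.trans (≡.cong ((+ 3) ℤ.*_) (z′≡ j)) (≡.sym (ℤ.*-assoc (+ 3) ((+ 3) ℤ.^ e) (y j)))))) , prim
    where
    z′ : _ → ℤ
    z′ j = ℤ∣._∣_.quotient (all j)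
    z≡ : ∀ j → z j ≡ z′ j ℤ.* + 3
    z≡ j = ℤ∣._∣_.equality (all j)
    z′i≢0 : z′ i ≢ 0ℤ
    z′i≢0 p = zi≢0 (≡.trans (z≡ i) (≡.cong (ℤ._* + 3) p))
    smaller : ∣ z′ i ∣ ℕ.< ∣ z i ∣
    smaller = ≡.subst (∣ z′ i ∣ ℕ.<_) (≡.sym (≡.trans (≡.cong ∣_∣ (z≡ i)) (ℤ.abs-* (z′ i) (+ 3))))
      (ℕ.m<m*n ∣ z′ i ∣ 3 {{ℕ.≢-nonZero λ p → z′i≢0 (ℤ.∣i∣≡0⇒i≡0 p)}} (s≤s (s≤s z≤n)))

-- Arithmetic and integral relations in a number field

module Field (L : NumberField) where
  open NumberField L hiding (zero; sum) public
  open NumberField L using (sum)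
  open RingProperties ring using (-0#≈0#; -‿distribˡ-*; -‿distribʳ-*) public
  open import Algebra.Properties.AbelianGroup +-abelianGroup using () renaming (⁻¹-∙-comm to -‿+-comm) public
  private module I = IsRingHomomorphism ι-isRingHomomorphism
  open Exp semiring using (^-congˡ; ^-homo-*; ^-assocʳ) public
  open CommutativeExp commutativeSemiring using (^-distrib-*) public
  module Σ′ = SemiringSum semiring
  module ≈R = Relation.Binary.Reasoning.Setoid setoid

  ι-cong : ∀ {p q} → p ≡ q → ι p ≈ ι q
  ι-cong ≡.refl = refl

  ι-+ : ∀ p q → ι (p ℚ.+ q) ≈ ι p + ι q
  ι-+ = I.+-homo

  ι-* : ∀ p q → ι (p ℚ.* q) ≈ ι p * ι q
  ι-* = I.*-homo

  ι-0 : ι 0ℚ ≈ 0#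
  ι-0 = I.0#-homo

  ι-1 : ι 1ℚ ≈ 1#
  ι-1 = I.1#-homo

  ι-sum : ∀ {n} (p : Fin n → ℚ) → ι (sumℚ p) ≈ sum (ι ∘ p)
  ι-sum {zero}  p = ι-0
  ι-sum {suc n} p = trans (ι-+ (p zero) (sumℚ (p ∘ suc))) (+-congˡ (ι-sum (p ∘ suc)))

  ιℤ-cong : ∀ {j k} → j ≡ k → ιℤ j ≈ ιℤ k
  ιℤ-cong ≡.refl = refl

  ιℤ-homomorphism : ℤ.+-*-rawRing -Raw-AlmostCommutative⟶ fromCommutativeRing commutativeRing
  ιℤ-homomorphism = record
    { ⟦_⟧    = ιℤ
    ; +-homo = λ j k → trans (ι-cong (fromℤ-homo-+ j k)) (ι-+ _ _)
    ; *-homo = λ j k → trans (ι-cong (fromℤ-homo-* j k)) (ι-* _ _)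
    ; -‿homo = λ k → trans (ι-cong (fromℤ-homo-neg k)) (I.-‿homo _)
    ; 0-homo = ι-0
    ; 1-homo = ι-1
    }

  open _-Raw-AlmostCommutative⟶_ ιℤ-homomorphism public using ()
    renaming (+-homo to ιℤ-+; *-homo to ιℤ-*; -‿homo to ιℤ-neg)

  private
    ιℤ≟ : ∀ j k → Maybe (ιℤ j ≈ ιℤ k)
    ιℤ≟ j k with j ℤ.≟ k
    ... | yes j≡k = just (ιℤ-cong j≡k)
    ... | no  _   = nothing

  module Solver = Algebra.Solver.Ring ℤ.+-*-rawRing (fromCommutativeRing commutativeRing) ιℤ-homomorphism ιℤ≟
  open Solver public using (solve; _:+_; _:*_; _:-_; :-_; con; _:=_)

  three : Carrier
  three = ιℤ (+ 3)

  ι≉0 : ∀ {q} → q ≢ 0ℚ → ¬ ι q ≈ 0#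
  ι≉0 {q} q≢0 ιq≈0 = 0≉1 (begin
    0#                   ≈⟨ sym (zeroʳ (ι (ℚ.1/ q))) ⟩
    ι (ℚ.1/ q) * 0#      ≈⟨ *-congˡ (sym ιq≈0) ⟩
    ι (ℚ.1/ q) * ι q     ≈⟨ sym (ι-* _ _) ⟩
    ι ((ℚ.1/ q) ℚ.* q)   ≈⟨ ι-cong (ℚ.*-inverseˡ q) ⟩
    ι 1ℚ                 ≈⟨ ι-1 ⟩
    1#                   ∎)
    where
    open ≈R
    instance _ = ℚ.≢-nonZero q≢0

  ιℤ≉0 : ∀ {k} → k ≢ 0ℤ → ¬ ιℤ k ≈ 0#
  ιℤ≉0 k≢0 = ι≉0 (k≢0 ∘ fromℤ-injective)

  cancelˡ : ∀ {x y z} → ¬ x ≈ 0# → x * y ≈ x * z → y ≈ z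
  cancelˡ {x} {y} {z} x≉0 xy≈xz = let x⁻¹ , xx⁻¹≈1 = inverse x x≉0 in begin
    y                 ≈⟨ sym (*-identityˡ y) ⟩
    1# * y            ≈⟨ *-congʳ (sym xx⁻¹≈1) ⟩
    x * x⁻¹ * y       ≈⟨ solve 3 (λ x i y → x :* i :* y := i :* (x :* y)) refl x x⁻¹ y ⟩
    x⁻¹ * (x * y)     ≈⟨ *-congˡ xy≈xz ⟩
    x⁻¹ * (x * z)     ≈⟨ solve 3 (λ x i y → i :* (x :* y) := x :* i :* y) refl x x⁻¹ z ⟩
    x * x⁻¹ * z       ≈⟨ *-congʳ xx⁻¹≈1 ⟩
    1# * z            ≈⟨ *-identityˡ z ⟩
    z                 ∎
    where open ≈R

  xy≈0⇒y≈0 : ∀ {x y} → ¬ x ≈ 0# → x * y ≈ 0# → y ≈ 0#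
  xy≈0⇒y≈0 {x} x≉0 xy≈0 = cancelˡ x≉0 (trans xy≈0 (sym (zeroʳ x)))

  three≉0 : ¬ three ≈ 0#
  three≉0 = ιℤ≉0 {+ 3} λ ()

  -- The equality of `L` is an arbitrary equivalence; the coordinates with respect to the basis
  -- decide it.
  ≈0? : ∀ x → Dec (x ≈ 0#)
  ≈0? x with spanning x
  ... | c , x≈ with Fin.all? (λ i → c i ℚ.≟ 0ℚ)
  ... | yes c≡0 = yes (trans x≈ (trans (Σ′.sum-cong-≋ (λ i → trans (*-congʳ (trans (ι-cong (c≡0 i)) ι-0)) (zeroˡ (basis i)))) (Σ′.sum-replicate-zero degree)))
  ... | no  c≢0 = no λ x≈0 → c≢0 (independent c (trans (sym x≈) x≈0))

  sum-cong : ∀ {n} {f g : Fin n → Carrier} → (∀ i → f i ≈ g i) → sum f ≈ sum g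
  sum-cong = Σ′.sum-cong-≋

  sum-0 : ∀ {n} {f : Fin n → Carrier} → (∀ i → f i ≈ 0#) → sum f ≈ 0#
  sum-0 {n} f≈0 = trans (sum-cong f≈0) (Σ′.sum-replicate-zero n)

  *-sum : ∀ {n} x (f : Fin n → Carrier) → x * sum f ≈ sum (λ i → x * f i)
  *-sum = Σ′.*-distribˡ-sum

  rational-relation : ∀ {n} (c : Fin n → Fin degree → ℚ) (x : Fin n → ℚ) →
    (∀ j → sumℚ (λ i → x i ℚ.* c i j) ≡ 0ℚ) →
    (a : Fin n → Carrier) → (∀ i → a i ≈ sum (λ j → ι (c i j) * basis j)) →
    sum (λ i → ι (x i) * a i) ≈ 0#
  rational-relation c x kernel a a≈ = begin
    sum (λ i → ι (x i) * a i)
      ≈⟨ sum-cong (λ i → trans (*-congˡ (a≈ i)) (*-sum (ι (x i)) (λ j → ι (c i j) * basis j))) ⟩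
    sum (λ i → sum (λ j → ι (x i) * (ι (c i j) * basis j)))
      ≈⟨ Σ′.∑-comm (λ i j → ι (x i) * (ι (c i j) * basis j)) ⟩
    sum (λ j → sum (λ i → ι (x i) * (ι (c i j) * basis j)))
      ≈⟨ sum-cong (λ j → trans (sum-cong (λ i → trans (sym (*-assoc (ι (x i)) (ι (c i j)) (basis j))) (*-congʳ (sym (ι-* (x i) (c i j))))))
                            (sym (Σ′.*-distribʳ-sum (basis j) (λ i → ι (x i ℚ.* c i j))))) ⟩
    sum (λ j → sum (λ i → ι (x i ℚ.* c i j)) * basis j)
      ≈⟨ sum-0 (λ j → trans (*-congʳ (trans (sym (ι-sum (λ i → x i ℚ.* c i j))) (trans (ι-cong (kernel j)) ι-0))) (zeroˡ (basis j))) ⟩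
    0# ∎
    where open ≈R

  scaled-relation : ∀ {n} (x : Fin n → ℚ) (y : Fin n → ℤ) D E → E ≢ 0ℤ →
    (∀ i → fromℤ D ℚ.* x i ≡ fromℤ (E ℤ.* y i)) → (a : Fin n → Carrier) →
    sum (λ i → ι (x i) * a i) ≈ 0# → sum (λ i → ιℤ (y i) * a i) ≈ 0#
  scaled-relation x y D E E≢0 Dx≡Ey a relation = xy≈0⇒y≈0 (ιℤ≉0 E≢0) (begin
    ιℤ E * sum (λ i → ιℤ (y i) * a i)
      ≈⟨ *-sum (ιℤ E) (λ i → ιℤ (y i) * a i) ⟩
    sum (λ i → ιℤ E * (ιℤ (y i) * a i))
      ≈⟨ sum-cong (λ i → trans (sym (*-assoc (ιℤ E) (ιℤ (y i)) (a i))) (trans (*-congʳ (sym (scaled i))) (*-assoc (ιℤ D) (ι (x i)) (a i)))) ⟩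
    sum (λ i → ιℤ D * (ι (x i) * a i))
      ≈⟨ sym (*-sum (ιℤ D) (λ i → ι (x i) * a i)) ⟩
    ιℤ D * sum (λ i → ι (x i) * a i)
      ≈⟨ *-congˡ relation ⟩
    ιℤ D * 0#
      ≈⟨ zeroʳ (ιℤ D) ⟩
    0# ∎)
    where
    open ≈R
    scaled : ∀ i → ιℤ D * ι (x i) ≈ ιℤ E * ιℤ (y i)
    scaled i = trans (sym (ι-* (fromℤ D) (x i))) (trans (ι-cong (Dx≡Ey i)) (ιℤ-* E (y i)))

  -- A relation whose coefficients are not all divisible by 3 remains nontrivial modulo 3. This is
  -- what bounds dimensions over 𝔽₃ in terms of `degree`.
  primitive-relation : (a : Fin (suc degree) → Carrier) →
    Σ (Fin (suc degree) → ℤ) λ y → (∃[ i ] ¬ (+ 3) ℤ∣.∣ y i) × sum (λ i → ιℤ (y i) * a i) ≈ 0#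
  primitive-relation a
    with rational-kernel degree (λ i → proj₁ (spanning (a i)))
  ... | x , (i , xi≢0) , kernel with common-denominator x
  ... | D , D≢0 , z , Dx≡z with strip-3 z i (λ p → xi≢0 (p*q≡0⇒q≡0 (D≢0 ∘ fromℤ-injective) (≡.trans (Dx≡z i) (≡.cong fromℤ p))))
  ... | y , (e , z≡) , prim = y , prim ,
    scaled-relation x y D ((+ 3) ℤ.^ e) (λ p → xi≢0 (p*q≡0⇒q≡0 (D≢0 ∘ fromℤ-injective) (≡.trans (Dx≡z i) (≡.cong fromℤ (≡.trans (z≡ i) (≡.cong (ℤ._* y i) p))))))
      (λ j → ≡.trans (Dx≡z j) (≡.cong fromℤ (z≡ j))) a
      (rational-relation (λ i → proj₁ (spanning (a i))) x kernel a (λ i → proj₂ (spanning (a i))))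

-- Subgroups of a number field and dimensions over 𝔽₃

module Subgroups (L : NumberField) where
  open Field L public
  open NumberField L using (sum)

  -- Membership is ¬¬-stable, so that dimensions can be counted classically.
  record Subgroup : Set₁ where
    field
      mem  : Pred Carrier 0ℓ
      resp : ∀ {x y} → x ≈ y → mem x → mem y
      0∈   : mem 0#
      +∈   : ∀ {x y} → mem x → mem y → mem (x + y)
      neg∈ : ∀ {x} → mem x → mem (- x)
      stable : ∀ {x} → DN (mem x) → mem x

  open Subgroup public

  into : ∀ {a} {A : Set a} S {x} → DN A → (A → mem S x) → mem S x
  into S m f = stable S (m >>= λ a → return (f a))

  infix 4 _∈_ _∉_ _⊆_
  infixl 6 _⊞_ _+ℤ_
  infixr 6 _⊓_
  infixr 7 _∙_

  _∈_ _∉_ : Carrier → Subgroup → Set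
  x ∈ A = mem A x
  x ∉ A = ¬ x ∈ A

  _⊆_ : Subgroup → Subgroup → Set
  A ⊆ B = ∀ {x} → x ∈ A → x ∈ B

  -∈ : ∀ A {x y} → x ∈ A → y ∈ A → x - y ∈ A
  -∈ A x∈A y∈A = +∈ A x∈A (neg∈ A y∈A)

  ℕ∙∈ : ∀ A k {x} → x ∈ A → ιℤ (+ k) * x ∈ A
  ℕ∙∈ A zero    x∈A = resp A (sym (trans (*-congʳ ι-0) (zeroˡ _))) (0∈ A)
  ℕ∙∈ A (suc k) {x} x∈A = resp A (sym step) (+∈ A x∈A (ℕ∙∈ A k x∈A))
    where
    step : ιℤ (+ suc k) * x ≈ x + ιℤ (+ k) * x
    step = trans (*-congʳ (trans (ιℤ-+ (+ 1) (+ k)) (+-congʳ ι-1)))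
                 (trans (distribʳ x 1# (ιℤ (+ k))) (+-congʳ (*-identityˡ x)))

  ℤ∙∈ : ∀ A k {x} → x ∈ A → ιℤ k * x ∈ A
  ℤ∙∈ A (+ k) x∈A = ℕ∙∈ A k x∈A
  ℤ∙∈ A -[1+ k ] {x} x∈A = resp A (sym (trans (*-congʳ (ιℤ-neg (+ suc k))) (sym (-‿distribˡ-* _ x)))) (neg∈ A (ℕ∙∈ A (suc k) x∈A))

  _⊞_ : Subgroup → Subgroup → Subgroup
  A ⊞ B = record
    { mem  = λ x → DN (∃[ a ] ∃[ b ] a ∈ A × b ∈ B × x ≈ a + b)
    ; resp = λ x≈y m → m >>= λ { (a , b , a∈ , b∈ , e) → return (a , b , a∈ , b∈ , trans (sym x≈y) e) }
    ; 0∈   = return (0# , 0# , 0∈ A , 0∈ B , sym (+-identityˡ 0#))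
    ; +∈   = λ m m′ → m >>= λ { (a , b , a∈ , b∈ , e) → m′ >>= λ { (a′ , b′ , a∈′ , b∈′ , e′) →
               return (a + a′ , b + b′ , +∈ A a∈ a∈′ , +∈ B b∈ b∈′ ,
               trans (+-cong e e′) (solve 4 (λ a b c d → a :+ b :+ (c :+ d) := a :+ c :+ (b :+ d)) refl a b a′ b′)) } }
    ; neg∈ = λ m → m >>= λ { (a , b , a∈ , b∈ , e) → return (- a , - b , neg∈ A a∈ , neg∈ B b∈ ,
               trans (-‿cong e) (sym (-‿+-comm a b))) }
    ; stable = λ m → m >>= id
    }

  ⊞-in : ∀ A B {x y} → x ∈ A → y ∈ B → x + y ∈ A ⊞ B
  ⊞-in A B x∈A y∈B = return (_ , _ , x∈A , y∈B , refl)

  ⊞ˡ : ∀ A B → A ⊆ A ⊞ B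
  ⊞ˡ A B {x} x∈A = return (x , 0# , x∈A , 0∈ B , sym (+-identityʳ x))

  ⊞ʳ : ∀ A B → B ⊆ A ⊞ B
  ⊞ʳ A B {x} x∈B = return (0# , x , 0∈ A , x∈B , sym (+-identityˡ x))

  ⊞-least : ∀ A B C → A ⊆ C → B ⊆ C → A ⊞ B ⊆ C
  ⊞-least A B C A⊆C B⊆C m = into C m λ { (a , b , a∈ , b∈ , e) → resp C (sym e) (+∈ C (A⊆C a∈) (B⊆C b∈)) }

  _⊓_ : Subgroup → Subgroup → Subgroup
  A ⊓ B = record
    { mem  = λ x → x ∈ A × x ∈ B
    ; resp = λ { e (p , q) → resp A e p , resp B e q }
    ; 0∈   = 0∈ A , 0∈ B
    ; +∈   = λ { (p , q) (p′ , q′) → +∈ A p p′ , +∈ B q q′ }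
    ; neg∈ = λ { (p , q) → neg∈ A p , neg∈ B q }
    ; stable = λ m → into A m proj₁ , into B m proj₂
    }

  _∙_ : Carrier → Subgroup → Subgroup
  θ ∙ A = record
    { mem  = λ x → DN (∃[ a ] a ∈ A × x ≈ θ * a)
    ; resp = λ x≈y m → m >>= λ { (a , a∈ , e) → return (a , a∈ , trans (sym x≈y) e) }
    ; 0∈   = return (0# , 0∈ A , sym (zeroʳ θ))
    ; +∈   = λ m m′ → m >>= λ { (a , a∈ , e) → m′ >>= λ { (b , b∈ , e′) →
               return (a + b , +∈ A a∈ b∈ , trans (+-cong e e′) (sym (distribˡ θ a b))) } }
    ; neg∈ = λ m → m >>= λ { (a , a∈ , e) → return (- a , neg∈ A a∈ , trans (-‿cong e) (-‿distribʳ-* θ a)) }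
    ; stable = λ m → m >>= id
    }

  ∙-in : ∀ θ A {x} → x ∈ A → θ * x ∈ θ ∙ A
  ∙-in θ A x∈A = return (_ , x∈A , refl)

  _+ℤ_ : Subgroup → Carrier → Subgroup
  B +ℤ a = record
    { mem  = λ x → DN (∃[ k ] x - ιℤ k * a ∈ B)
    ; resp = λ e m → m >>= λ { (k , p) → return (k , resp B (+-congʳ e) p) }
    ; 0∈   = return (0ℤ , resp B (sym zero′) (0∈ B))
    ; +∈   = λ {x} {y} m m′ → m >>= λ { (k , p) → m′ >>= λ { (l , q) → return (k ℤ.+ l , resp B (add x y k l) (+∈ B p q)) } }
    ; neg∈ = λ {x} m → m >>= λ { (k , p) → return (ℤ.- k , resp B (neg x k) (neg∈ B p)) }
    ; stable = λ m → m >>= id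
    }
    where
    zero′ : 0# - ιℤ 0ℤ * a ≈ 0#
    zero′ = trans (+-congˡ (trans (-‿cong (trans (*-congʳ ι-0) (zeroˡ a))) -0#≈0#)) (+-identityʳ 0#)
    add : ∀ x y k l → x - ιℤ k * a + (y - ιℤ l * a) ≈ x + y - ιℤ (k ℤ.+ l) * a
    add x y k l = trans (solve 5 (λ x y k l a → x :- k :* a :+ (y :- l :* a) := x :+ y :- (k :+ l) :* a) refl x y (ιℤ k) (ιℤ l) a)
      (+-congˡ (-‿cong (*-congʳ (sym (ιℤ-+ k l)))))
    neg : ∀ x k → - (x - ιℤ k * a) ≈ - x - ιℤ (ℤ.- k) * a
    neg x k = trans (solve 3 (λ x k a → :- (x :- k :* a) := :- x :- (:- k) :* a) refl x (ιℤ k) a)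
      (+-congˡ (-‿cong (*-congʳ (sym (ιℤ-neg k)))))

  ⊆+ℤ : ∀ B a → B ⊆ B +ℤ a
  ⊆+ℤ B a {x} x∈B = return (0ℤ , resp B (sym (trans (+-congˡ (trans (-‿cong (trans (*-congʳ ι-0) (zeroˡ a))) -0#≈0#)) (+-identityʳ x))) x∈B)

  a∈+ℤ : ∀ B a → a ∈ B +ℤ a
  a∈+ℤ B a = return (1ℤ , resp B (sym (trans (+-congˡ (-‿cong (trans (*-congʳ ι-1) (*-identityˡ a)))) (-‿inverseʳ a))) (0∈ B))

  x-y+y≈x : ∀ x y → x - y + y ≈ x
  x-y+y≈x = solve 2 (λ x y → x :- y :+ y := x) refl

  +ℤ-least : ∀ B a C → B ⊆ C → a ∈ C → B +ℤ a ⊆ C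
  +ℤ-least B a C B⊆C a∈C {x} m = into C m λ { (k , p) → resp C (x-y+y≈x x (ιℤ k * a)) (+∈ C (B⊆C p) (ℤ∙∈ C k a∈C)) }

  -- The dimension of A/B over 𝔽₃, for 3A ⊆ B ⊆ A, as the length of a flag.
  Dim : Subgroup → Subgroup → ℕ → Set
  Dim A B zero    = A ⊆ B
  Dim A B (suc d) = ∃[ a ] a ∈ A × a ∉ B × Dim A (B +ℤ a) d

  ThreeKills : Subgroup → Subgroup → Set
  ThreeKills A B = ∀ {x} → x ∈ A → three * x ∈ B

  kills-multiple : ∀ {A B} → ThreeKills A B → ∀ k t {x} → k ≡ t ℤ.* + 3 → x ∈ A → ιℤ k * x ∈ B
  kills-multiple {A} {B} 3A⊆B k t {x} ≡.refl x∈A =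
    resp B (trans (sym (*-assoc (ιℤ t) three x)) (*-congʳ (sym (ιℤ-* t (+ 3))))) (ℤ∙∈ B t (3A⊆B x∈A))

  -- An integer prime to 3 is its own inverse modulo 3.
  exchange-generators : ∀ {A B} → ThreeKills A B → ∀ k t {x y} → k ℤ.* k ≡ 1ℤ ℤ.+ t ℤ.* + 3 →
    y ∈ A → x - ιℤ k * y ∈ B → y - ιℤ k * x ∈ B
  exchange-generators {A} {B} 3A⊆B k t {x} {y} k²≡ y∈A p =
    resp B (trans (+-congˡ (-‿cong (*-congʳ (ιℤ-* t (+ 3))))) (trans (rearrange (ιℤ k) x y (ιℤ t * three)) (trans (+-congˡ (-‿cong (*-congʳ k²≈))) (final x y (ιℤ k) (ιℤ t * three)))))
      (-∈ B (neg∈ B (ℤ∙∈ B k p)) (kills-multiple {A} {B} 3A⊆B (t ℤ.* + 3) t ≡.refl y∈A))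
    where
    rearrange : ∀ k x y s → - (k * (x - k * y)) - s * y ≈ - (k * x) - s * y - (- (k * k)) * y
    rearrange = solve 4 (λ k x y s → :- (k :* (x :- k :* y)) :- s :* y := :- (k :* x) :- s :* y :- (:- (k :* k)) :* y) refl
    k²≈ : - (ιℤ k * ιℤ k) ≈ - (1# + ιℤ t * three)
    k²≈ = -‿cong (trans (sym (ιℤ-* k k)) (trans (ιℤ-cong k²≡) (trans (ιℤ-+ 1ℤ (t ℤ.* + 3)) (+-cong ι-1 (ιℤ-* t (+ 3))))))
    final : ∀ x y k s → - (k * x) - s * y - (- (1# + s)) * y ≈ y - k * x
    final x y k s = trans (+-congˡ (-‿cong (*-congʳ (-‿cong (+-congʳ (sym ι-1))))))
      (solve 4 (λ x y k s → :- (k :* x) :- s :* y :- (:- (con 1ℤ :+ s)) :* y := y :- k :* x) refl x y k s)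

  -- A map inducing an isomorphism from A/B to A′/B′ carries a flag to a flag. The map is asked to
  -- respect just the combinations `x - k a` that occur when a generator is adjoined, and
  -- surjectivity is asked up to double negation.
  Dim-transport : (f : Carrier → Carrier) → (∀ x k a → f (x - ιℤ k * a) ≈ f x - ιℤ k * f a) →
    ∀ d {A B A′ B′} →
    (∀ {x} → x ∈ A → f x ∈ A′) → (∀ {x} → x ∈ B → f x ∈ B′) →
    (∀ {x} → x ∈ A → f x ∈ B′ → x ∈ B) → (∀ {y} → y ∈ A′ → DN (∃[ x ] x ∈ A × y - f x ∈ B′)) →
    Dim A B d → Dim A′ B′ d
  Dim-transport f f-linear zero {A} {B} {A′} {B′} fA fB inj surj A⊆B y∈A′ =
    into B′ (surj y∈A′) λ { (x , x∈A , p) → resp B′ (x-y+y≈x _ (f x)) (+∈ B′ p (fB (A⊆B x∈A))) }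
  Dim-transport f f-linear (suc d) {A} {B} {A′} {B′} fA fB inj surj (a , a∈A , a∉B , flag) =
    f a , fA a∈A , (λ fa∈B′ → a∉B (inj a∈A fa∈B′)) ,
    Dim-transport f f-linear d fA
      (λ {x} m → m >>= λ { (k , p) → return (k , resp B′ (f-linear x k a) (fB p)) })
      (λ {x} x∈A m → m >>= λ { (k , p) → return (k , inj (-∈ A x∈A (ℤ∙∈ A k a∈A)) (resp B′ (sym (f-linear x k a)) p)) })
      (λ y∈A′ → surj y∈A′ >>= λ { (x , x∈A , p) → return (x , x∈A , ⊆+ℤ B′ (f a) p) })
      flag

  Dim-cong : ∀ d {A B A′ B′} → A ⊆ A′ → A′ ⊆ A → B ⊆ B′ → B′ ⊆ B → Dim A B d → Dim A′ B′ d
  Dim-cong d {B′ = B′} A⊆A′ A′⊆A B⊆B′ B′⊆B =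
    Dim-transport id (λ _ _ _ → refl) d A⊆A′ B⊆B′ (λ _ → B′⊆B)
      (λ {y} y∈A′ → return (y , A′⊆A y∈A′ , resp B′ (sym (-‿inverseʳ y)) (0∈ B′)))

  -- The flag of B/C is run through before that of A/B.
  Dim-+ : ∀ d e {A B C} → C ⊆ B → B ⊆ A → Dim A B d → Dim B C e → Dim A C (e ℕ.+ d)
  Dim-+ d zero    C⊆B B⊆A A/B B⊆C = Dim-cong d id id B⊆C C⊆B A/B
  Dim-+ d (suc e) {A} {B} {C} C⊆B B⊆A A/B (c , c∈B , c∉C , flag) =
    c , B⊆A c∈B , c∉C , Dim-+ d e (+ℤ-least C c B C⊆B c∈B) B⊆A A/B flag

  -- Steinitz exchange: any `a` outside `B` may be the first generator of a flag. If `a` lies in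
  -- `B +ℤ c`, the integer relating `a` to `c` is prime to 3, hence invertible modulo 3, and both
  -- generate the same group over `B`. Otherwise `a` is exchanged further up, over `B +ℤ c`, and the
  -- order of `a` and `c` is reversed.
  Dim-exchange : ∀ d {A B} → B ⊆ A → ThreeKills A B → ∀ {a} → a ∈ A → a ∉ B →
    Dim A B (suc d) → DN (Dim A (B +ℤ a) d)
  Dim-exchange d {A} {B} B⊆A 3A⊆B {a} a∈A a∉B (c , c∈A , c∉B , flag) =
    excluded-middle (a ∈ B +ℤ c) >>= λ
      { (yes m) → m >>= case
      ; (no a∉) → other d flag a∉ }
    where
    case : ∃[ k ] a - ιℤ k * c ∈ B → DN (Dim A (B +ℤ a) d)
    case (k , p) with 3∤⇒square k
    ... | inj₁ (t , k≡3t) = λ _ → a∉B (resp B (x-y+y≈x a (ιℤ k * c)) (+∈ B p (kills-multiple {A} {B} 3A⊆B k t k≡3t c∈A)))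
    ... | inj₂ (t , k²≡) = return (Dim-cong d id id
      (+ℤ-least B c (B +ℤ a) (⊆+ℤ B a) (return (k , exchange-generators {A} {B} 3A⊆B k t k²≡ c∈A p)))
      (+ℤ-least B a (B +ℤ c) (⊆+ℤ B c) (return (k , p))) flag)
    other : ∀ d → Dim A (B +ℤ c) d → a ∉ B +ℤ c → DN (Dim A (B +ℤ a) d)
    other zero    A⊆ a∉ = λ _ → a∉ (A⊆ a∈A)
    other (suc d) flag a∉ =
      Dim-exchange d {A} {B +ℤ c} (+ℤ-least B c A B⊆A c∈A) (⊆+ℤ B c ∘ 3A⊆B) a∈A a∉ flag >>= λ flag′ →
      return (c , c∈A , c∉B+a , Dim-cong d id id
        (+ℤ-least (B +ℤ c) a ((B +ℤ a) +ℤ c)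
          (+ℤ-least B c ((B +ℤ a) +ℤ c) (⊆+ℤ (B +ℤ a) c ∘ ⊆+ℤ B a) (a∈+ℤ (B +ℤ a) c))
          (⊆+ℤ (B +ℤ a) c (a∈+ℤ B a)))
        (+ℤ-least (B +ℤ a) c ((B +ℤ c) +ℤ a)
          (+ℤ-least B a ((B +ℤ c) +ℤ a) (⊆+ℤ (B +ℤ c) a ∘ ⊆+ℤ B c) (a∈+ℤ (B +ℤ c) a))
          (⊆+ℤ (B +ℤ c) a (a∈+ℤ B c))) flag′)
      where
      c∉B+a : c ∉ B +ℤ a
      c∉B+a m = m λ { (k , p) → c∉ k p }
        where
        c∉ : ∀ k → c - ιℤ k * a ∉ B
        c∉ k p with 3∤⇒square k
        ... | inj₁ (t , k≡3t) = c∉B (resp B (x-y+y≈x c (ιℤ k * a)) (+∈ B p (kills-multiple {A} {B} 3A⊆B k t k≡3t a∈A)))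
        ... | inj₂ (t , k²≡) = a∉ (return (k , exchange-generators {A} {B} 3A⊆B k t k²≡ a∈A p))

  Dim-unique : ∀ d e {A B} → B ⊆ A → ThreeKills A B → Dim A B d → Dim A B e → d ≡ e
  Dim-unique d e B⊆A 3A⊆B A/B A/B′ = decidable-stable (d ℕ.≟ e) (go d e B⊆A 3A⊆B A/B A/B′)
    where
    go : ∀ d e {A B} → B ⊆ A → ThreeKills A B → Dim A B d → Dim A B e → DN (d ≡ e)
    go zero    zero    _ _ _ _ = return ≡.refl
    go zero    (suc e) _ _ A⊆B (a , a∈A , a∉B , _) = λ _ → a∉B (A⊆B a∈A)
    go (suc d) zero    _ _ (a , a∈A , a∉B , _) A⊆B = λ _ → a∉B (A⊆B a∈A)
    go (suc d) (suc e) {A} {B} B⊆A 3A⊆B (a , a∈A , a∉B , flag) flag′ =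
      Dim-exchange e {A} {B} B⊆A 3A⊆B a∈A a∉B flag′ >>= λ flag″ →
      go d e {A} {B +ℤ a} (+ℤ-least B a A B⊆A a∈A) (⊆+ℤ B a ∘ 3A⊆B) flag flag″ >>= λ d≡e →
      return (≡.cong suc d≡e)

  private
    span : Subgroup → ∀ {s} → (Fin s → Carrier) → Subgroup
    span B {zero}  a = B
    span B {suc s} a = span B (a ∘ suc) +ℤ a zero

    ⊆span : ∀ B {s} (a : Fin s → Carrier) → B ⊆ span B a
    ⊆span B {zero}  a x∈B = x∈B
    ⊆span B {suc s} a x∈B = ⊆+ℤ (span B (a ∘ suc)) (a zero) (⊆span B (a ∘ suc) x∈B)

    Independent : Subgroup → Subgroup → ∀ s → (Fin s → Carrier) → Set
    Independent A B zero    a = ⊤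
    Independent A B (suc s) a = a zero ∈ A × a zero ∉ span B (a ∘ suc) × Independent A B s (a ∘ suc)

    span⊆ : ∀ {A B} → B ⊆ A → ∀ s a → Independent A B s a → span B a ⊆ A
    span⊆ B⊆A zero    a _ = B⊆A
    span⊆ {A} {B} B⊆A (suc s) a (a∈A , _ , ind) = +ℤ-least (span B (a ∘ suc)) (a zero) A (span⊆ {A} {B} B⊆A s (a ∘ suc) ind) a∈A

    combination∈span : ∀ B {s} (a : Fin s → Carrier) (y : Fin s → ℤ) → sum (λ i → ιℤ (y i) * a i) ∈ span B a
    combination∈span B {zero}  a y = 0∈ B
    combination∈span B {suc s} a y = +∈ (span B a) (ℤ∙∈ (span B a) (y zero) (a∈+ℤ (span B (a ∘ suc)) (a zero)))
      (⊆+ℤ (span B (a ∘ suc)) (a zero) (combination∈span B (a ∘ suc) (y ∘ suc)))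

    drop : ∀ x y → x + y - y ≈ x
    drop = solve 2 (λ x y → x :+ y :- y := x) refl

    drop′ : ∀ x y → x + y - x ≈ y
    drop′ = solve 2 (λ x y → x :+ y :- x := y) refl

    unsquare : ∀ k a t → k * k ≈ 1# + t → k * (k * a) - t * a ≈ a
    unsquare k a t k²≈ = trans (+-congʳ (trans (sym (*-assoc k k a)) (*-congʳ k²≈)))
      (trans (+-congʳ (trans (distribʳ a 1# t) (+-congʳ (*-identityˡ a)))) (drop a (t * a)))

    -- If the first coefficient were prime to 3, multiplying the relation by it would exhibit
    -- `a zero` in the span of the later elements. So it is a multiple of 3, its term lies in `B`,
    -- and the rest of the relation is treated in the same way.
    independent⇒3∣ : ∀ {A B} → ThreeKills A B → ∀ s a → Independent A B s a → (y : Fin s → ℤ) →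
      sum (λ i → ιℤ (y i) * a i) ∈ B → ∀ i → (+ 3) ℤ∣.∣ y i
    independent⇒3∣ {A} {B} 3A⊆B (suc s) a (a∈A , a∉ , ind) y s∈B with 3∤⇒square (y zero)
    ... | inj₁ (t , y₀≡) = λ
      { zero    → divides t y₀≡
      ; (suc i) → independent⇒3∣ {A} {B} 3A⊆B s (a ∘ suc) ind (y ∘ suc)
          (resp B (drop′ (ιℤ (y zero) * a zero) (sum (λ i → ιℤ (y (suc i)) * a (suc i)))) (-∈ B s∈B (kills-multiple {A} {B} 3A⊆B (y zero) t y₀≡ a∈A))) i }
    ... | inj₂ (t , y₀²≡) = ⊥-elim (a∉ (resp S (unsquare (ιℤ (y zero)) (a zero) (ιℤ (t ℤ.* + 3)) y₀²≈)
        (-∈ S (ℤ∙∈ S (y zero) y₀a₀∈) (⊆span B (a ∘ suc) (kills-multiple {A} {B} 3A⊆B (t ℤ.* + 3) t ≡.refl a∈A)))))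
      where
      S = span B (a ∘ suc)
      y₀a₀∈ : ιℤ (y zero) * a zero ∈ S
      y₀a₀∈ = resp S (drop (ιℤ (y zero) * a zero) (sum (λ i → ιℤ (y (suc i)) * a (suc i))))
        (-∈ S (⊆span B (a ∘ suc) s∈B) (combination∈span B (a ∘ suc) (y ∘ suc)))
      y₀²≈ : ιℤ (y zero) * ιℤ (y zero) ≈ 1# + ιℤ (t ℤ.* + 3)
      y₀²≈ = trans (sym (ιℤ-* (y zero) (y zero))) (trans (ιℤ-cong y₀²≡) (trans (ιℤ-+ 1ℤ (t ℤ.* + 3)) (+-congʳ ι-1)))

    -- An independent family is enlarged greedily; `fuel` counts the elements that are still missing
    -- to `degree + 1`, where a relation that is nontrivial modulo 3 becomes unavoidable.
    extend : ∀ {A B} → B ⊆ A → ThreeKills A B → ∀ fuel s a → fuel ℕ.+ s ≡ suc degree → Independent A B s a →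
      DN (∃[ d ] d ℕ.< suc fuel × Dim A (span B a) d)
    extend {A} {B} B⊆A 3A⊆B zero s a ≡.refl ind = λ _ →
      let y , (i , 3∤yᵢ) , relation = primitive-relation a
      in 3∤yᵢ (independent⇒3∣ {A} {B} 3A⊆B s a ind y (resp B (sym relation) (0∈ B)) i)
    extend {A} {B} B⊆A 3A⊆B (suc fuel) s a eq ind =
      excluded-middle (∃[ x ] x ∈ A × x ∉ span B a) >>= λ
        { (yes (x , x∈A , x∉)) →
            extend {A} {B} B⊆A 3A⊆B fuel (suc s) (x Vector.∷ a) (≡.trans (ℕ.+-suc fuel s) eq) (x∈A , x∉ , ind) >>= λ
              { (d , d< , flag) → return (suc d , s≤s d< , x , x∈A , x∉ , flag) }
        ; (no ∄x) → return (0 , s≤s z≤n , λ {x} x∈A → stable (span B a) λ x∉ → ∄x (x , x∈A , x∉)) }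

  -- The bound is uniform in `A` and `B`. It is used in the even case, where the exponent of a power
  -- has to exceed every dimension that may occur.
  Dim-exists : ∀ {A B} → B ⊆ A → ThreeKills A B → DN (∃[ d ] d ℕ.< suc (suc degree) × Dim A B d)
  Dim-exists {A} {B} B⊆A 3A⊆B = extend {A} {B} B⊆A 3A⊆B (suc degree) 0 (λ ()) (ℕ.+-identityʳ (suc degree)) tt

-- Dimensions modulo 3 and multiplier rings

module Dimensions (L : NumberField) where
  open Subgroups L public

  Dim-⊆ : ∀ d {A B A′ B′} → A ⊆ A′ → B ⊆ B′ → (∀ {x} → x ∈ A → x ∈ B′ → x ∈ B) →
    (∀ {y} → y ∈ A′ → DN (∃[ x ] x ∈ A × y - x ∈ B′)) → Dim A B d → Dim A′ B′ d
  Dim-⊆ d = Dim-transport id (λ _ _ _ → refl) d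

  Dim-* : ∀ d θ {A B} → ¬ θ ≈ 0# → Dim A B d → Dim (θ ∙ A) (θ ∙ B) d
  Dim-* d θ {A} {B} θ≉0 = Dim-transport (θ *_) (λ x k a → linear θ x (ιℤ k) a) d (∙-in θ A) (∙-in θ B)
    (λ {x} _ θx∈θB → into B θx∈θB λ { (b , b∈B , e) → resp B (sym (cancelˡ θ≉0 e)) b∈B })
    (λ {y} y∈θA → y∈θA >>= λ { (a , a∈A , e) → return (a , a∈A , resp (θ ∙ B) (sym (trans (+-congʳ e) (-‿inverseʳ (θ * a)))) (0∈ (θ ∙ B))) })
    where
    linear : ∀ θ x k a → θ * (x - k * a) ≈ θ * x - k * (θ * a)
    linear = solve 4 (λ θ x k a → θ :* (x :- k :* a) := θ :* x :- k :* (θ :* a)) refl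

  ∙-mono : ∀ θ {A B} → A ⊆ B → θ ∙ A ⊆ θ ∙ B
  ∙-mono θ A⊆B m = m >>= λ { (a , a∈A , e) → return (a , A⊆B a∈A , e) }

  3∙⊆ : ∀ A → three ∙ A ⊆ A
  3∙⊆ A m = into A m λ { (a , a∈A , e) → resp A (sym e) (ℤ∙∈ A (+ 3) a∈A) }

  Dim₃ : Subgroup → ℕ → Set
  Dim₃ A = Dim A (three ∙ A)

  Dim₃-exists : ∀ A → DN (∃[ d ] Dim₃ A d)
  Dim₃-exists A = Dim-exists {A} {three ∙ A} (3∙⊆ A) (∙-in three A) >>= λ { (d , _ , flag) → return (d , flag) }

  Dim₃-unique : ∀ {A d e} → Dim₃ A d → Dim₃ A e → d ≡ e
  Dim₃-unique {A} {d} {e} = Dim-unique d e {A} {three ∙ A} (3∙⊆ A) (∙-in three A)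

  Dim₃-split : ∀ {A B d e f} → three ∙ A ⊆ B → B ⊆ A → Dim A B d → Dim B (three ∙ A) e → Dim₃ A f → f ≡ e ℕ.+ d
  Dim₃-split {A} {B} {d} {e} {f} 3A⊆B B⊆A A/B B/3A A/3A = Dim₃-unique {A} A/3A (Dim-+ d e 3A⊆B B⊆A A/B B/3A)

  -- The exact sequence 0 → A ∩ B → A ⊕ B → A + B → 0 stays exact modulo 3.
  Dim₃-modular : ∀ A B {dA dB d⊓ d⊞} → Dim₃ A dA → Dim₃ B dB → Dim₃ (A ⊓ B) d⊓ → Dim₃ (A ⊞ B) d⊞ →
    DN (d⊓ ℕ.+ d⊞ ≡ dA ℕ.+ dB)
  Dim₃-modular A B {dA} {dB} {d⊓} {d⊞} A/ B/ ⊓/ ⊞/ =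
    Dim-exists {A} {T₁} T₁⊆A 3A→T₁ >>= λ { (a₁ , _ , A/T₁) →
    Dim-exists {A ⊓ B} {T₂} proj₁ 3K→T₂ >>= λ { (a₂ , _ , K/T₂) →
    Dim-exists {T₂} {three ∙ (A ⊓ B)} 3K⊆T₂ (λ {x} x∈T₂ → ∙-in three (A ⊓ B) (proj₁ x∈T₂)) >>= λ { (c , _ , T₂/3K) →
    Dim-exists {B} {T₄} T₄⊆B (λ x∈B → ⊞ʳ T₂ (three ∙ B) (∙-in three B x∈B)) >>= λ { (b₁ , _ , B/T₄) →
    return (add-up a₁ a₂ c b₁
      (Dim₃-split {A} {T₁} (⊞ʳ (A ⊓ B) (three ∙ A)) T₁⊆A A/T₁ (T₁/3A a₂ K/T₂) A/)
      (Dim₃-split {A ⊓ B} {T₂} 3K⊆T₂ proj₁ K/T₂ T₂/3K ⊓/)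
      (Dim₃-split {A ⊞ B} {T₃} 3S⊆T₃ T₃⊆S (S/T₃ a₁ A/T₁) (T₃/3S b₁ B/T₄) ⊞/)
      (Dim₃-split {B} {T₄} (⊞ʳ T₂ (three ∙ B)) T₄⊆B B/T₄ (T₄/3B c T₂/3K) B/)) }}}}
    where
    K = A ⊓ B
    S = A ⊞ B
    -- These groups cut each of A/3A, K/3K, S/3S, B/3B into two pieces, which agree in pairs: A/T₁ ≅
    -- S/T₃, K/T₂ ≅ T₁/3A, T₂/3K ≅ T₄/3B and B/T₄ ≅ T₃/3S. The common dimensions are `a₁`, `a₂`,
    -- `c`, `b₁`.
    T₁ = K ⊞ three ∙ A
    T₂ = K ⊓ three ∙ A
    T₃ = B ⊞ three ∙ A
    T₄ = T₂ ⊞ three ∙ B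
    T₁⊆A : T₁ ⊆ A
    T₁⊆A = ⊞-least K (three ∙ A) A proj₁ (3∙⊆ A)
    3A→T₁ : ThreeKills A T₁
    3A→T₁ x∈A = ⊞ʳ K (three ∙ A) (∙-in three A x∈A)
    3K→T₂ : ThreeKills K T₂
    3K→T₂ x∈K = ℤ∙∈ K (+ 3) x∈K , ∙-in three A (proj₁ x∈K)
    3K⊆T₂ : three ∙ K ⊆ T₂
    3K⊆T₂ x∈3K = 3∙⊆ K x∈3K , ∙-mono three {K} {A} proj₁ x∈3K
    T₄⊆B : T₄ ⊆ B
    T₄⊆B = ⊞-least T₂ (three ∙ B) B (proj₂ ∘ proj₁) (3∙⊆ B)
    T₃⊆S : T₃ ⊆ S
    T₃⊆S = ⊞-least B (three ∙ A) S (⊞ʳ A B) (⊞ˡ A B ∘ 3∙⊆ A)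
    x+y-x∈ : ∀ S x y → y ∈ S → x + y - x ∈ S
    x+y-x∈ S x y = resp S (solve 2 (λ x y → y := x :+ y :- x) refl x y)
    x+y-y≈x : ∀ x y → x + y - y ≈ x
    x+y-y≈x = solve 2 (λ x y → x :+ y :- y := x) refl
    3S⊆T₃ : three ∙ S ⊆ T₃
    3S⊆T₃ m = into T₃ m λ { (s , s∈S , e) → into T₃ s∈S λ { (a , b , a∈A , b∈B , e′) →
      resp T₃ (sym (trans e (trans (*-congˡ e′) (trans (distribˡ three a b) (+-comm (three * a) (three * b))))))
        (⊞-in B (three ∙ A) (ℤ∙∈ B (+ 3) b∈B) (∙-in three A a∈A)) } }
    T₁/3A : ∀ d → Dim K T₂ d → Dim T₁ (three ∙ A) d
    T₁/3A d = Dim-⊆ d (⊞ˡ K (three ∙ A)) proj₂ (λ x∈K x∈3A → x∈K , x∈3A)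
      (λ m → m >>= λ { (x , y , x∈K , y∈3A , e) → return (x , x∈K , resp (three ∙ A) (sym (+-congʳ e)) (x+y-x∈ (three ∙ A) x y y∈3A)) })
    S/T₃ : ∀ d → Dim A T₁ d → Dim S T₃ d
    S/T₃ d = Dim-⊆ d (⊞ˡ A B) (⊞-least K (three ∙ A) T₃ (⊞ˡ B (three ∙ A) ∘ proj₂) (⊞ʳ B (three ∙ A)))
      (λ {x} x∈A m → into T₁ m λ { (b , t , b∈B , t∈3A , e) →
        resp T₁ (sym e) (⊞-in K (three ∙ A) (resp A (trans (+-congʳ e) (x+y-y≈x b t)) (-∈ A x∈A (3∙⊆ A t∈3A)) , b∈B) t∈3A) })
      (λ m → m >>= λ { (a , b , a∈A , b∈B , e) → return (a , a∈A , resp T₃ (sym (+-congʳ e)) (x+y-x∈ T₃ a b (⊞ˡ B (three ∙ A) b∈B))) })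
    T₃/3S : ∀ d → Dim B T₄ d → Dim T₃ (three ∙ S) d
    T₃/3S d = Dim-⊆ d (⊞ˡ B (three ∙ A))
      (⊞-least T₂ (three ∙ B) (three ∙ S) (∙-mono three {A} {S} (⊞ˡ A B) ∘ proj₂) (∙-mono three {B} {S} (⊞ʳ A B)))
      (λ {x} x∈B m → into T₄ m λ { (s , s∈S , e) → into T₄ s∈S λ { (a , b , a∈A , b∈B , e′) →
        let x≈ = trans e (trans (*-congˡ e′) (distribˡ three a b))
        in resp T₄ (sym x≈) (⊞-in T₂ (three ∙ B)
             ((ℤ∙∈ A (+ 3) a∈A , resp B (trans (+-congʳ x≈) (x+y-y≈x (three * a) (three * b))) (-∈ B x∈B (ℤ∙∈ B (+ 3) b∈B))) , ∙-in three A a∈A)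
             (∙-in three B b∈B)) } })
      (λ m → m >>= λ { (b , t , b∈B , t∈3A , e) → return (b , b∈B , resp (three ∙ S) (sym (+-congʳ e)) (x+y-x∈ (three ∙ S) b t (∙-mono three {A} {S} (⊞ˡ A B) t∈3A))) })
    T₄/3B : ∀ d → Dim T₂ (three ∙ K) d → Dim T₄ (three ∙ B) d
    T₄/3B d = Dim-⊆ d (⊞ˡ T₂ (three ∙ B)) (∙-mono three {K} {B} proj₂)
      (λ {x} x∈T₂ x∈3B → into (three ∙ K) (proj₂ x∈T₂) λ { (a , a∈A , e) → into (three ∙ K) x∈3B λ { (b , b∈B , e′) →
        return (a , (a∈A , resp B (cancelˡ three≉0 (trans (sym e′) e)) b∈B) , e) } })
      (λ m → m >>= λ { (x , y , x∈T₂ , y∈3B , e) → return (x , x∈T₂ , resp (three ∙ B) (sym (+-congʳ e)) (x+y-x∈ (three ∙ B) x y y∈3B)) })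
    add-up : ∀ a₁ a₂ c b₁ → dA ≡ a₂ ℕ.+ a₁ → d⊓ ≡ c ℕ.+ a₂ → d⊞ ≡ b₁ ℕ.+ a₁ → dB ≡ c ℕ.+ b₁ →
      d⊓ ℕ.+ d⊞ ≡ dA ℕ.+ dB
    add-up a₁ a₂ c b₁ ≡.refl ≡.refl ≡.refl ≡.refl =
      solve′ 4 (λ a₁ a₂ c b₁ → c :+′ a₂ :+′ (b₁ :+′ a₁) :=′ a₂ :+′ a₁ :+′ (c :+′ b₁)) ≡.refl a₁ a₂ c b₁
      where
      open ℕSolver using () renaming (solve to solve′; _:+_ to _:+′_; _:=_ to _:=′_)

  -- In the chain 3N ⊆ 3M ⊆ N ⊆ M the outer quotients M/N and 3M/3N are isomorphic, so both
  -- dimensions equal dim M/N + dim N/3M.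
  Dim₃-index-3 : ∀ {N M d e} → N ⊆ M → ThreeKills M N → Dim₃ N d → Dim₃ M e → DN (d ≡ e)
  Dim₃-index-3 {N} {M} {d} {e} N⊆M 3M→N N/ M/ =
    Dim-exists {M} {N} N⊆M 3M→N >>= λ { (x , _ , M/N) →
    Dim-exists {N} {three ∙ M} 3M⊆N (λ x∈N → ∙-in three M (N⊆M x∈N)) >>= λ { (y , _ , N/3M) →
    return (≡.trans (Dim₃-split {N} {three ∙ M} (∙-mono three {N} {M} N⊆M) 3M⊆N N/3M (Dim-* x three three≉0 M/N) N/)
      (≡.trans (ℕ.+-comm x y) (≡.sym (Dim₃-split {M} {N} 3M⊆N N⊆M M/N N/3M M/)))) }}
    where
    3M⊆N : three ∙ M ⊆ N
    3M⊆N m = into N m λ { (x , x∈M , e) → resp N (sym e) (3M→N x∈M) }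

  -- The group N + 3ᵉM is inserted between `N` and `M`: multiplication by 3 takes it into `N`, and
  -- it contains 3ᵉM, so that `e` drops by one.
  Dim₃-commensurable : ∀ e {N M d d′} → N ⊆ M → (∀ {x} → x ∈ M → three ^ e * x ∈ N) →
    Dim₃ N d → Dim₃ M d′ → DN (d ≡ d′)
  Dim₃-commensurable zero {N} {M} {d} {d′} N⊆M 3ᵉM⊆N N/ M/ = return (Dim₃-unique {M} (Dim-cong d N⊆M M⊆N (∙-mono three {N} {M} N⊆M) (∙-mono three {M} {N} M⊆N) N/) M/)
    where
    M⊆N : M ⊆ N
    M⊆N {x} x∈M = resp N (*-identityˡ x) (3ᵉM⊆N x∈M)
  Dim₃-commensurable (suc e) {N} {M} {d} {d′} N⊆M 3ᵉM⊆N N/ M/ =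
    Dim₃-exists M′ >>= λ { (x , M′/) →
    Dim₃-index-3 {N} {M′} (⊞ˡ N (three ^ e ∙ M)) 3M′→N N/ M′/ >>= λ d≡x →
    Dim₃-commensurable e {M′} {M} (⊞-least N (three ^ e ∙ M) M N⊆M (3^∙⊆ e)) (λ x∈M → ⊞ʳ N (three ^ e ∙ M) (∙-in (three ^ e) M x∈M)) M′/ M/ >>= λ x≡d′ →
    return (≡.trans d≡x x≡d′) }
    where
    M′ = N ⊞ three ^ e ∙ M
    3^∈ : ∀ e {x} → x ∈ M → three ^ e * x ∈ M
    3^∈ zero {x} x∈M = resp M (sym (*-identityˡ x)) x∈M
    3^∈ (suc e) {x} x∈M = resp M (sym (*-assoc three (three ^ e) x)) (ℤ∙∈ M (+ 3) (3^∈ e x∈M))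
    3^∙⊆ : ∀ e → three ^ e ∙ M ⊆ M
    3^∙⊆ e m = into M m λ { (x , x∈M , eq) → resp M (sym eq) (3^∈ e x∈M) }
    3M′→N : ThreeKills M′ N
    3M′→N m = into N m λ { (x , t , x∈N , t∈ , eq) → into N t∈ λ { (y , y∈M , eq′) →
      resp N (sym (trans (*-congˡ (trans eq (+-congˡ eq′))) (trans (distribˡ three x (three ^ e * y)) (+-congˡ (sym (*-assoc three (three ^ e) y))))))
        (+∈ N (ℤ∙∈ N (+ 3) x∈N) (3ᵉM⊆N y∈M)) } }

  -- The multiplier ring of `N`, which takes the place of a valuation ring.
  R : Subgroup → Carrier → Set
  R N x = ∀ {y} → y ∈ N → x * y ∈ N

  R-resp : ∀ N {x y} → x ≈ y → R N x → R N y
  R-resp N x≈y r y∈N = resp N (*-congʳ x≈y) (r y∈N)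

  R-1 : ∀ N → R N 1#
  R-1 N {y} y∈N = resp N (sym (*-identityˡ y)) y∈N

  R-ℤ : ∀ N k → R N (ιℤ k)
  R-ℤ N k y∈N = ℤ∙∈ N k y∈N

  R-+ : ∀ N {x y} → R N x → R N y → R N (x + y)
  R-+ N {x} {y} r s {z} z∈N = resp N (sym (distribʳ z x y)) (+∈ N (r z∈N) (s z∈N))

  R-neg : ∀ N {x} → R N x → R N (- x)
  R-neg N {x} r {z} z∈N = resp N (-‿distribˡ-* x z) (neg∈ N (r z∈N))

  R-* : ∀ N {x y} → R N x → R N y → R N (x * y)
  R-* N {x} {y} r s {z} z∈N = resp N (sym (*-assoc x y z)) (r (s z∈N))

  R-^ : ∀ N {x} → R N x → ∀ k → R N (x ^ k)
  R-^ N r zero    = R-1 N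
  R-^ N r (suc k) = R-* N r (R-^ N r k)

  ^≉0 : ∀ {x} → ¬ x ≈ 0# → ∀ k → ¬ x ^ k ≈ 0#
  ^≉0 x≉0 zero    1≈0 = 0≉1 (sym 1≈0)
  ^≉0 x≉0 (suc k) e   = ^≉0 x≉0 k (xy≈0⇒y≈0 x≉0 e)

  R-∙⊆ : ∀ N {φ} → R N φ → φ ∙ N ⊆ N
  R-∙⊆ N r m = into N m λ { (x , x∈N , e) → resp N (sym e) (r x∈N) }

  -- Each quotient of φⁱN by φⁱ⁺¹N is a copy of N/φN, by multiplication with φⁱ.
  Dim-powers : ∀ N {φ w} → ¬ φ ≈ 0# → R N φ → Dim N (φ ∙ N) w → ∀ i → Dim N (φ ^ i ∙ N) (i ℕ.* w)
  Dim-powers N {φ} {w} φ≉0 r N/φN zero {x} x∈N = return (x , x∈N , sym (*-identityˡ x))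
  Dim-powers N {φ} {w} φ≉0 r N/φN (suc i) =
    Dim-+ (i ℕ.* w) w step (R-∙⊆ N (R-^ N r i)) (Dim-powers N φ≉0 r N/φN i)
      (Dim-cong w id id to from (Dim-* w (φ ^ i) {N} {φ ∙ N} (^≉0 φ≉0 i) N/φN))
    where
    swap : ∀ a b x → a * b * x ≈ b * (a * x)
    swap = solve 3 (λ a b x → a :* b :* x := b :* (a :* x)) refl
    step : φ ^ suc i ∙ N ⊆ φ ^ i ∙ N
    step m = m >>= λ { (x , x∈N , e) → return (φ * x , r x∈N , trans e (swap φ (φ ^ i) x)) }
    to : φ ^ i ∙ φ ∙ N ⊆ φ ^ suc i ∙ N
    to m = m >>= λ { (y , y∈ , e) → y∈ >>= λ { (x , x∈N , e′) → return (x , x∈N , trans e (trans (*-congˡ e′) (sym (swap φ (φ ^ i) x)))) } }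
    from : φ ^ suc i ∙ N ⊆ φ ^ i ∙ φ ∙ N
    from m = m >>= λ { (x , x∈N , e) → return (φ * x , ∙-in φ N x∈N , trans e (swap φ (φ ^ i) x)) }

  -- If 3 is an m-th power up to a unit κ, the filtration by powers of φ has m isomorphic steps.
  Dim₃-root : ∀ N m {φ κ κ⁻¹ d} → 1 ℕ.≤ m → R N φ → R N κ → R N κ⁻¹ → κ * κ⁻¹ ≈ 1# → φ ^ m ≈ three * κ →
    Dim₃ N d → DN (∃[ w ] Dim N (φ ∙ N) w × d ≡ m ℕ.* w)
  Dim₃-root N (suc m) {φ} {κ} {κ⁻¹} {d} _ rφ rκ rκ⁻¹ κκ⁻¹≈1 φᵐ≈3κ N/ =
    Dim-exists {N} {φ ∙ N} (R-∙⊆ N rφ) kills >>= λ { (w , _ , N/φN) →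
    return (w , N/φN , Dim₃-unique {N} {d} N/ (Dim-cong (suc m ℕ.* w) id id to from (Dim-powers N φ≉0 rφ N/φN (suc m)))) }
    where
    3≈ : three ≈ φ ^ suc m * κ⁻¹
    3≈ = sym (trans (*-congʳ φᵐ≈3κ) (trans (*-assoc three κ κ⁻¹) (trans (*-congˡ κκ⁻¹≈1) (*-identityʳ three))))
    φ≉0 : ¬ φ ≈ 0#
    φ≉0 φ≈0 = three≉0 (trans 3≈ (trans (*-congʳ (trans (*-congʳ φ≈0) (zeroˡ (φ ^ m)))) (zeroˡ κ⁻¹)))
    kills : ThreeKills N (φ ∙ N)
    kills {x} x∈N = return (φ ^ m * κ⁻¹ * x , R-* N (R-^ N rφ m) rκ⁻¹ x∈N ,
      trans (*-congʳ 3≈) (solve 4 (λ a b c x → a :* b :* c :* x := a :* (b :* c :* x)) refl φ (φ ^ m) κ⁻¹ x))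
    to : φ ^ suc m ∙ N ⊆ three ∙ N
    to mem = mem >>= λ { (x , x∈N , e) → return (κ * x , rκ x∈N , trans e (trans (*-congʳ φᵐ≈3κ) (*-assoc three κ x))) }
    from : three ∙ N ⊆ φ ^ suc m ∙ N
    from mem = mem >>= λ { (x , x∈N , e) → return (κ⁻¹ * x , rκ⁻¹ x∈N , trans e (trans (*-congʳ 3≈) (*-assoc (φ ^ suc m) κ⁻¹ x))) }

  -- A square root of -1 makes A/B a vector space over 𝔽₉.
  Dim-even : ∀ j d {A B} → B ⊆ A → ThreeKills A B → R A j → R B j → (∀ {x} → x ∈ A → j * (j * x) + x ∈ B) →
    Dim A B d → 2 ℕ∣.∣ d
  Dim-even j d B⊆A 3A⊆B jA jB j²+1 flag = decidable-stable (2 ℕ∣.∣? d) (go d (<-wellFounded d) B⊆A 3A⊆B jA jB j²+1 flag)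
    where
    go : ∀ d → Acc ℕ._<_ d → ∀ {A B} → B ⊆ A → ThreeKills A B → R A j → R B j → (∀ {x} → x ∈ A → j * (j * x) + x ∈ B) →
      Dim A B d → DN (2 ℕ∣.∣ d)
    go zero    _ _ _ _ _ _ _ = return (2 ℕ∣.∣0)
    go (suc d) (acc rec) {A} {B} B⊆A 3A⊆B jA jB j²+1 flag@(a , a∈A , a∉B , _) =
      Dim-exists {A} {A′} A′⊆A (B⊆A′ ∘ 3A⊆B) >>= λ { (e , _ , A/A′) →
      let d≡ = Dim-unique (suc d) (2 ℕ.+ e) {A} {B} B⊆A 3A⊆B flag (Dim-+ e 2 {A} {A′} {B} B⊆A′ A′⊆A A/A′ A′/B)
      in go e (rec (≡.subst (suc e ℕ.≤_) (≡.sym d≡) (ℕ.n≤1+n (suc e)))) {A} {A′} A′⊆A (B⊆A′ ∘ 3A⊆B) jA jA′ (B⊆A′ ∘ j²+1) A/A′ >>= λ 2∣e →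
      return (≡.subst (2 ℕ∣.∣_) (≡.sym d≡) (ℕ∣.∣m∣n⇒∣m+n (ℕ∣.∣-refl {2}) 2∣e)) }
      where
      -- `A′` is `B` enlarged by the 𝔽₉-line through `a`; it is stable under `j` and has dimension 2
      -- over `B`.
      B₁ = B +ℤ a
      A′ = B₁ +ℤ (j * a)
      B⊆A′ : B ⊆ A′
      B⊆A′ = ⊆+ℤ B₁ (j * a) ∘ ⊆+ℤ B a
      A′⊆A : A′ ⊆ A
      A′⊆A = +ℤ-least B₁ (j * a) A (+ℤ-least B a A B⊆A a∈A) (jA a∈A)
      a∈A′ : a ∈ A′
      a∈A′ = ⊆+ℤ B₁ (j * a) (a∈+ℤ B a)
      ja∉B₁ : j * a ∉ B₁
      ja∉B₁ m = m λ { (k , p) → ja∉ k p }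
        where
        -- Suppose ja ≡ ka modulo `B`. If 3 divides `k`, then ja, hence j²a ≡ -a, lies in `B`.
        -- Otherwise (1 + k²)a lies in `B`, and so does (k² + 2)a since k² + 2 is a multiple of 3;
        -- the difference is `a`. This is the place where -1 is a nonsquare modulo 3.
        ja∉ : ∀ k → j * a - ιℤ k * a ∉ B
        ja∉ k p with 3∤⇒square k
        ... | inj₁ (t , k≡3t) = a∉B (resp B (drop (j * (j * a)) a) (-∈ B (j²+1 a∈A) (jB
            (resp B (x-y+y≈x (j * a) (ιℤ k * a)) (+∈ B p (kills-multiple {A} {B} 3A⊆B k t k≡3t a∈A))))))
          where
          drop : ∀ x y → x + y - x ≈ y
          drop = solve 2 (λ x y → x :+ y :- x := y) refl
        ... | inj₂ (t , k²≡) = a∉B (resp B (trans (+-congˡ (-‿cong (norm j (ιℤ k) a))) (final a (ιℤ k * ιℤ k) (ιℤ ((1ℤ ℤ.+ t) ℤ.* + 3)) k²≈))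
            (-∈ B (kills-multiple {A} {B} 3A⊆B ((1ℤ ℤ.+ t) ℤ.* + 3) (1ℤ ℤ.+ t) ≡.refl a∈A)
              (-∈ B (-∈ B (j²+1 a∈A) (jB p)) (ℤ∙∈ B k p))))
          where
          norm : ∀ j k a → j * (j * a) + a - j * (j * a - k * a) - k * (j * a - k * a) ≈ a + k * k * a
          norm = solve 3 (λ j k a → j :* (j :* a) :+ a :- j :* (j :* a :- k :* a) :- k :* (j :* a :- k :* a) := a :+ k :* k :* a) refl
          k²≈ : ιℤ ((1ℤ ℤ.+ t) ℤ.* + 3) ≈ ιℤ k * ιℤ k + ιℤ (+ 2)
          k²≈ = trans (ιℤ-cong (≡.trans (shift t) (≡.cong (ℤ._+ + 2) (≡.sym k²≡)))) (trans (ιℤ-+ (k ℤ.* k) (+ 2)) (+-congʳ (ιℤ-* k k)))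
            where
            shift : ∀ t → (1ℤ ℤ.+ t) ℤ.* + 3 ≡ 1ℤ ℤ.+ t ℤ.* + 3 ℤ.+ + 2
            shift = ℤSolver.solve 1 (λ t → (ℤSolver.con 1ℤ ℤSolver.:+ t) ℤSolver.:* ℤSolver.con (+ 3) ℤSolver.:= ℤSolver.con 1ℤ ℤSolver.:+ t ℤSolver.:* ℤSolver.con (+ 3) ℤSolver.:+ ℤSolver.con (+ 2)) ≡.refl
          final : ∀ a k² s → s ≈ k² + ιℤ (+ 2) → s * a - (a + k² * a) ≈ a
          final a k² s e = trans (+-congʳ (*-congʳ e)) (solve 2 (λ a k² → (k² :+ con (+ 2)) :* a :- (a :+ k² :* a) := a) refl a k²)
      A′/B : Dim A′ B 2
      A′/B = a , a∈A′ , a∉B , j * a , a∈+ℤ B₁ (j * a) , ja∉B₁ , id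
      jA′ : R A′ j
      jA′ {x} m = into A′ m λ { (k , p) → into A′ p λ { (l , q) →
        resp A′ (recombine j a (ιℤ k) (ιℤ l) x)
          (+∈ A′ (B⊆A′ (jB q)) (+∈ A′ (ℤ∙∈ A′ k (-∈ A′ (B⊆A′ (j²+1 a∈A)) a∈A′)) (ℤ∙∈ A′ l (a∈+ℤ B₁ (j * a))))) } }
        where
        recombine : ∀ j a k l x → j * (x - k * (j * a) - l * a) + (k * (j * (j * a) + a - a) + l * (j * a)) ≈ j * x
        recombine = solve 5 (λ j a k l x → j :* (x :- k :* (j :* a) :- l :* a) :+ (k :* (j :* (j :* a) :+ a :- a) :+ l :* (j :* a)) := j :* x) refl

-- Enlarging the multiplier ring until given elements are comparable

module Charts (L : NumberField) where
  open Dimensions L public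

  -- Ascending unions

  module _ (Y : ℕ → Subgroup) (asc : ∀ k → Y k ⊆ Y (suc k)) where

    ascend : ∀ k l → Y k ⊆ Y (k ℕ.+ l)
    ascend k zero    {x} x∈ = ≡.subst (λ i → x ∈ Y i) (≡.sym (ℕ.+-identityʳ k)) x∈
    ascend k (suc l) {x} x∈ = ≡.subst (λ i → x ∈ Y i) (≡.sym (ℕ.+-suc k l)) (asc (k ℕ.+ l) (ascend k l x∈))

    ascendʳ : ∀ k l → Y l ⊆ Y (k ℕ.+ l)
    ascendʳ k l {x} x∈ = ≡.subst (λ i → x ∈ Y i) (ℕ.+-comm l k) (ascend l k x∈)

    ⋃ : Subgroup
    ⋃ = record
      { mem    = λ x → DN (∃[ k ] x ∈ Y k)
      ; resp   = λ e m → m >>= λ { (k , p) → return (k , resp (Y k) e p) }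
      ; 0∈     = return (0 , 0∈ (Y 0))
      ; +∈     = λ m m′ → m >>= λ { (k , p) → m′ >>= λ { (l , q) → return (k ℕ.+ l , +∈ (Y (k ℕ.+ l)) (ascend k l p) (ascendʳ k l q)) } }
      ; neg∈   = λ m → m >>= λ { (k , p) → return (k , neg∈ (Y k) p) }
      ; stable = λ m → m >>= id
      }

    ⊆⋃ : ∀ k → Y k ⊆ ⋃
    ⊆⋃ k p = return (k , p)

    R-⋃ : ∀ {x} → (∀ k → R (Y k) x) → R ⋃ x
    R-⋃ r m = m >>= λ { (k , p) → return (k , r k p) }

    -- A flag has finitely many generators, all of which have appeared by some stage of the union.
    generated : ∀ d {B} → Dim ⋃ B d → DN (∃[ k ] ⋃ ⊆ Y k ⊞ B)
    generated zero    {B} ⋃⊆B = return (0 , λ {_} x∈ → ⊞ʳ (Y 0) B (⋃⊆B x∈))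
    generated (suc d) {B} (a , a∈⋃ , _ , flag) =
      a∈⋃ >>= λ { (l , a∈Yₗ) →
      generated d flag >>= λ { (k , ⋃⊆) →
      let Z = Y (k ℕ.+ l) in
      return (k ℕ.+ l , λ {_} x∈ → ⊞-least (Y k) (B +ℤ a) (Z ⊞ B) (⊞ˡ Z B ∘ ascend k l)
        (+ℤ-least B a (Z ⊞ B) (⊞ʳ Z B) (⊞ˡ Z B (ascendʳ k l a∈Yₗ))) (⋃⊆ x∈)) }}

    -- A Nakayama argument: the union `U` equals Y k + 3U for some `k`, hence Y k + 3ᵉU by
    -- iteration, and 3ᵉU is contained in `Y 0`.
    stabilises : ∀ e → (∀ k {x} → x ∈ Y k → three ^ e * x ∈ Y 0) → DN (∃[ k ] ∀ l → Y l ⊆ Y k)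
    stabilises e 3ᵉY⊆Y₀ =
      Dim₃-exists ⋃ >>= λ { (d , ⋃/) →
      generated d ⋃/ >>= λ { (k , ⋃⊆) →
      return (k , λ l {_} x∈ → finish k (iterate k ⋃⊆ e (⊆⋃ l x∈))) }}
      where
      iterate : ∀ k → ⋃ ⊆ Y k ⊞ three ∙ ⋃ → ∀ i → ⋃ ⊆ Y k ⊞ three ^ i ∙ ⋃
      iterate k ⋃⊆ zero {x} x∈ = ⊞ʳ (Y k) (1# ∙ ⋃) (return (x , x∈ , sym (*-identityˡ x)))
      iterate k ⋃⊆ (suc i) {x} x∈ =
        iterate k ⋃⊆ i x∈ >>= λ { (y , t , y∈ , t∈ , x≈) → t∈ >>= λ { (u , u∈ , t≈) →
        ⋃⊆ u∈ >>= λ { (y′ , t′ , y′∈ , t′∈ , u≈) → t′∈ >>= λ { (u′ , u′∈ , t′≈) →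
        return (y + three ^ i * y′ , three ^ suc i * u′ , +∈ (Y k) y∈ (R-^ (Y k) (R-ℤ (Y k) (+ 3)) i y′∈) , ∙-in (three ^ suc i) ⋃ u′∈ ,
          trans x≈ (trans (+-congˡ (trans t≈ (*-congˡ (trans u≈ (+-congˡ t′≈))))) (rearrange y (three ^ i) y′ three u′))) }}}}
        where
        rearrange : ∀ y a y′ b u → y + a * (y′ + b * u) ≈ y + a * y′ + b * a * u
        rearrange = solve 5 (λ y a y′ b u → y :+ a :* (y′ :+ b :* u) := y :+ a :* y′ :+ b :* a :* u) refl
      finish : ∀ k → Y k ⊞ three ^ e ∙ ⋃ ⊆ Y k
      finish k = ⊞-least (Y k) (three ^ e ∙ ⋃) (Y k) id λ m →
        into (Y k) m λ { (u , u∈ , x≈) → into (Y k) u∈ λ { (l , u∈Yₗ) → resp (Y k) (sym x≈) (ascend 0 k (3ᵉY⊆Y₀ l u∈Yₗ)) } }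

  -- For invertible θ this is θ⁻¹A, described without the inverse so that chains of such groups only
  -- involve powers of θ.
  pre : Carrier → Subgroup → Subgroup
  pre θ A = record
    { mem    = λ x → θ * x ∈ A
    ; resp   = λ e → resp A (*-congˡ e)
    ; 0∈     = resp A (sym (zeroʳ θ)) (0∈ A)
    ; +∈     = λ {x} {y} p q → resp A (sym (distribˡ θ x y)) (+∈ A p q)
    ; neg∈   = λ {x} p → resp A (-‿distribʳ-* θ x) (neg∈ A p)
    ; stable = stable A
    }

  R-pre : ∀ θ A {x} → R A x → R (pre θ A) x
  R-pre θ A {x} r {y} y∈ = resp A (solve 3 (λ x θ y → x :* (θ :* y) := θ :* (x :* y)) refl x θ y) (r y∈)

  R-⊞ : ∀ A B {x} → R A x → R B x → R (A ⊞ B) x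
  R-⊞ A B {x} r s m = m >>= λ { (a , b , a∈ , b∈ , e) → return (x * a , x * b , r a∈ , s b∈ , trans (*-congˡ e) (distribˡ x a b)) }

  R-∙ : ∀ θ A {x} → R A x → R (θ ∙ A) x
  R-∙ θ A {x} r m = m >>= λ { (a , a∈ , e) → return (x * a , r a∈ , trans (*-congˡ e) (solve 3 (λ x θ a → x :* (θ :* a) := θ :* (x :* a)) refl x θ a)) }

  infix 4 _⊑_
  -- Inclusion of multiplier rings. Every reduction moves upwards in this order, hence preserves all
  -- divisibilities already obtained.
  _⊑_ : Subgroup → Subgroup → Set
  N ⊑ M = ∀ {x} → R N x → R M x

  -- Gluing the two charts of the projective line with coordinate θ

  module ProjectiveLine (N : Subgroup) (θ θ⁻¹ : Carrier) (θθ⁻¹≈1 : θ * θ⁻¹ ≈ 1#) (e : ℕ) (3ᵉθ∈R : R N (three ^ e * θ)) where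

    -- `P k` is N + θN + ⋯ + θᵏN, the analogue of the sections of O(k) on the projective line.
    P : ℕ → Subgroup
    P zero    = N
    P (suc k) = N ⊞ θ ∙ P k

    P-asc : ∀ k → P k ⊆ P (suc k)
    P-asc zero    = ⊞ˡ N (θ ∙ N)
    P-asc (suc k) = ⊞-least N (θ ∙ P k) (P (suc (suc k))) (⊞ˡ N (θ ∙ P (suc k))) (⊞ʳ N (θ ∙ P (suc k)) ∘ ∙-mono θ {P k} {P (suc k)} (P-asc k))

    θP⊆P : ∀ k {x} → x ∈ P k → θ * x ∈ P (suc k)
    θP⊆P k x∈ = ⊞ʳ N (θ ∙ P k) (∙-in θ (P k) x∈)

    -- Only the summand θᵏ⁺¹N is new. It is taken together with θᵏN, as the defect that has to be
    -- controlled, `Y`, consists of elements of `P 1`.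
    P-top : ∀ k → P (suc k) ⊆ P k ⊞ θ ^ k ∙ P 1
    P-top zero    {x} x∈ = ⊞ʳ N (1# ∙ P 1) (return (x , x∈ , sym (*-identityˡ x)))
    P-top (suc k) = ⊞-least N (θ ∙ P (suc k)) V (⊞ˡ (P (suc k)) (θ ^ suc k ∙ P 1) ∘ ⊞ˡ N (θ ∙ P k))
      λ m → m >>= λ { (x , x∈ , y≈) → P-top k x∈ >>= λ { (a , b , a∈ , b∈ , x≈) → b∈ >>= λ { (c , c∈ , b≈) →
        return (θ * a , θ ^ suc k * c , θP⊆P k a∈ , ∙-in (θ ^ suc k) (P 1) c∈ ,
          trans y≈ (trans (*-congˡ (trans x≈ (+-congˡ b≈))) (rearrange θ a (θ ^ k) c))) }}}
      where
      V = P (suc k) ⊞ θ ^ suc k ∙ P 1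
      rearrange : ∀ θ a t c → θ * (a + t * c) ≈ θ * a + θ * t * c
      rearrange = solve 4 (λ θ a t c → θ :* (a :+ t :* c) := θ :* a :+ θ :* t :* c) refl

    N⊑P : ∀ k → N ⊑ P k
    N⊑P zero    r = r
    N⊑P (suc k) r = R-⊞ N (θ ∙ P k) r (R-∙ θ (P k) (N⊑P k r))

    P-bounded : ∀ k → ∃[ f ] (∀ {x} → x ∈ P k → three ^ f * x ∈ N)
    P-bounded zero    = 0 , λ {x} x∈ → resp N (sym (*-identityˡ x)) x∈
    P-bounded (suc k) = let f , bounded = P-bounded k in e ℕ.+ f , λ {x} m → into N m λ { (a , t , a∈ , t∈ , x≈) →
      into N t∈ λ { (b , b∈ , t≈) →
      resp N (sym (trans (*-congˡ (trans x≈ (+-congˡ t≈))) (trans (distribˡ _ a (θ * b)) (+-congˡ (trans (*-congʳ (^-homo-* three e f)) (rearrange (three ^ e) (three ^ f) θ b))))))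
        (+∈ N (R-^ N (R-ℤ N (+ 3)) (e ℕ.+ f) a∈) (3ᵉθ∈R (bounded b∈))) } }
      where
      rearrange : ∀ a b θ x → a * b * (θ * x) ≈ a * θ * (b * x)
      rearrange = solve 4 (λ a b θ x → a :* b :* (θ :* x) := a :* θ :* (b :* x)) refl

    -- The elements q of N + θN for which θᵏq is already in `P k`, so that they contribute nothing
    -- new to `P (suc k)`. As N + θN is commensurable with `N`, this chain stabilises, and the stage
    -- where it does so is the `k₀` below.
    Y : ℕ → Subgroup
    Y k = P 1 ⊓ pre (θ ^ k) (P k)

    Y-asc : ∀ k → Y k ⊆ Y (suc k)
    Y-asc k {x} (p , q) = p , resp (P (suc k)) (sym (*-assoc θ (θ ^ k) x)) (θP⊆P k q)

    Y-bounded : ∀ k {x} → x ∈ Y k → three ^ proj₁ (P-bounded 1) * x ∈ Y 0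
    Y-bounded k {x} (p , _) = R-^ (P 1) (R-ℤ (P 1) (+ 3)) (proj₁ (P-bounded 1)) p ,
      resp N (sym (*-identityˡ (three ^ proj₁ (P-bounded 1) * x))) (proj₂ (P-bounded 1) p)

    -- A is N[θ], and B below is θ^k₀ N[θ⁻¹], where k₀ is so large that A ∩ B = P k₀.
    A : Subgroup
    A = ⋃ P P-asc

    module _ (k₀ : ℕ) (Y⊆Yk₀ : ∀ l → Y l ⊆ Y k₀) where

      B′ : ℕ → Subgroup
      B′ s = pre (θ ^ s) (P (k₀ ℕ.+ s))

      B′-asc : ∀ s → B′ s ⊆ B′ (suc s)
      B′-asc s {x} p = ≡.subst (λ k → θ ^ suc s * x ∈ P k) (≡.sym (ℕ.+-suc k₀ s))
        (resp (P (suc (k₀ ℕ.+ s))) (sym (*-assoc θ (θ ^ s) x)) (θP⊆P (k₀ ℕ.+ s) p))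

      B : Subgroup
      B = ⋃ B′ B′-asc

      θ^k∈ : ∀ l {x} → x ∈ Y k₀ → θ ^ (k₀ ℕ.+ l) * x ∈ P (k₀ ℕ.+ l)
      θ^k∈ l {x} x∈ = proj₂ (ascend Y Y-asc k₀ l x∈)

      -- Let k = k₀ + l and write x = p + θᵏq with p in `P k` and q in `P 1`. Then θᵏ⁺¹q = θx - θp
      -- lies in `P (suc k)`, so q is in `Y (suc k)`, hence in `Y k₀`; therefore θᵏq, and with it x,
      -- is in `P k`.
      saturated : ∀ l {x} → x ∈ P (suc (k₀ ℕ.+ l)) → θ * x ∈ P (suc (k₀ ℕ.+ l)) → x ∈ P (k₀ ℕ.+ l)
      saturated l {x} x∈ θx∈ = into (P k) (P-top k x∈) λ { (p , t , p∈ , t∈ , x≈) → into (P k) t∈ λ { (q , q∈ , t≈) →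
        let x≈′ = trans x≈ (+-congˡ t≈)
            q∈Y : q ∈ Y (suc k)
            q∈Y = q∈ , resp (P (suc k)) (trans (+-congʳ (*-congˡ x≈′)) (isolate θ p (θ ^ k) q)) (-∈ (P (suc k)) θx∈ (θP⊆P k p∈))
        in resp (P k) (sym x≈′) (+∈ (P k) p∈ (θ^k∈ l (Y⊆Yk₀ (suc k) q∈Y))) } }
        where
        k = k₀ ℕ.+ l
        isolate : ∀ θ p t q → θ * (p + t * q) - θ * p ≈ θ * t * q
        isolate = solve 4 (λ θ p t q → θ :* (p :+ t :* q) :- θ :* p := θ :* t :* q) refl

      descend : ∀ l r {x} → x ∈ P (k₀ ℕ.+ l ℕ.+ r) → θ * x ∈ P (suc (k₀ ℕ.+ l)) → x ∈ P (k₀ ℕ.+ l)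
      descend l zero    {x} x∈ _ = ≡.subst (λ k → x ∈ P k) (ℕ.+-identityʳ (k₀ ℕ.+ l)) x∈
      descend l (suc r) {x} x∈ θx∈ = descend l r
        (≡.subst (λ k → x ∈ P k) (≡.sym (ℕ.+-assoc k₀ l r)) (saturated (l ℕ.+ r)
          (≡.subst (λ k → x ∈ P k) (≡.trans (ℕ.+-suc (k₀ ℕ.+ l) r) (≡.cong suc (ℕ.+-assoc k₀ l r))) x∈)
          (≡.subst (λ k → θ * x ∈ P k) (≡.cong suc (ℕ.+-assoc k₀ l r)) (ascend P P-asc (suc (k₀ ℕ.+ l)) r θx∈)))) θx∈

      -- For l = 0 this is the inclusion of A ∩ B in `P k₀`: `r` bounds the stage at which x occurs
      -- in `A`, and `s` is its stage in `B`. The parameter `l` serves the induction on `s`, which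
      -- passes from x to θx.
      intersect : ∀ s l r {x} → x ∈ P (k₀ ℕ.+ l ℕ.+ r) → θ ^ s * x ∈ P (k₀ ℕ.+ l ℕ.+ s) → x ∈ P (k₀ ℕ.+ l)
      intersect zero    l r {x} _ p = resp (P (k₀ ℕ.+ l)) (*-identityˡ x) (≡.subst (λ k → 1# * x ∈ P k) (ℕ.+-identityʳ (k₀ ℕ.+ l)) p)
      intersect (suc s) l r {x} x∈ p = descend l r x∈ (≡.subst (λ k → θ * x ∈ P k) (ℕ.+-suc k₀ l)
        (intersect s (suc l) r
          (≡.subst (λ k → θ * x ∈ P k) (≡.sym (≡.cong (ℕ._+ r) (ℕ.+-suc k₀ l))) (θP⊆P (k₀ ℕ.+ l ℕ.+ r) x∈))
          (≡.subst (λ k → θ ^ s * (θ * x) ∈ P k) (≡.trans (ℕ.+-suc (k₀ ℕ.+ l) s) (≡.cong (ℕ._+ s) (≡.sym (ℕ.+-suc k₀ l))))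
            (resp (P (k₀ ℕ.+ l ℕ.+ suc s)) (swap θ (θ ^ s) x) p))))
        where
        swap : ∀ θ t x → θ * t * x ≈ t * (θ * x)
        swap = solve 3 (λ θ t x → θ :* t :* x := t :* (θ :* x)) refl

      A⊓B⊆P : A ⊓ B ⊆ P k₀
      A⊓B⊆P {x} (p , q) = into (P k₀) p λ { (k , x∈) → into (P k₀) q λ { (s , θˢx∈) →
        ≡.subst (λ i → x ∈ P i) (ℕ.+-identityʳ k₀) (intersect s 0 k
          (≡.subst (λ i → x ∈ P (i ℕ.+ k)) (≡.sym (ℕ.+-identityʳ k₀)) (ascendʳ P P-asc k₀ k x∈))
          (≡.subst (λ i → θ ^ s * x ∈ P (i ℕ.+ s)) (≡.sym (ℕ.+-identityʳ k₀)) θˢx∈)) } }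

      P⊆A⊓B : P k₀ ⊆ A ⊓ B
      P⊆A⊓B {x} x∈ = ⊆⋃ P P-asc k₀ x∈ , return (0 , ≡.subst (λ k → 1# * x ∈ P k) (≡.sym (ℕ.+-identityʳ k₀)) (resp (P k₀) (sym (*-identityˡ x)) x∈))

      N⊑A : N ⊑ A
      N⊑A r = R-⋃ P P-asc (λ k → N⊑P k r)

      N⊑B : N ⊑ B
      N⊑B r = R-⋃ B′ B′-asc (λ s → R-pre (θ ^ s) (P (k₀ ℕ.+ s)) (N⊑P (k₀ ℕ.+ s) r))

      θA⊆A : R A θ
      θA⊆A m = m >>= λ { (k , x∈) → return (suc k , θP⊆P k x∈) }

      cancel-θ : ∀ x → θ * (θ⁻¹ * x) ≈ x
      cancel-θ x = trans (sym (*-assoc θ θ⁻¹ x)) (trans (*-congʳ θθ⁻¹≈1) (*-identityˡ x))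

      θ⁻¹B⊆B : R B θ⁻¹
      θ⁻¹B⊆B {x} m = m >>= λ { (s , p) → return (suc s , ≡.subst (λ k → θ ^ suc s * (θ⁻¹ * x) ∈ P k) (≡.sym (ℕ.+-suc k₀ s))
        (P-asc (k₀ ℕ.+ s) (resp (P (k₀ ℕ.+ s)) (sym (trans (swap θ (θ ^ s) (θ⁻¹ * x)) (*-congˡ (cancel-θ x)))) p))) }
        where
        swap : ∀ θ t x → θ * t * x ≈ t * (θ * x)
        swap = solve 3 (λ θ t x → θ :* t :* x := t :* (θ :* x)) refl

      -- For x at stage `s` of `B` the element θ · θˢx lies in `P (suc k)` = P k + θᵏP 1 with k = k₀
      -- + s. Dividing by θˢ leaves an element of `B` and one of θ^k₀ P 1, which is contained in
      -- `A`.
      θB⊆A⊞B : ∀ {x} → x ∈ B → θ * x ∈ A ⊞ B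
      θB⊆A⊞B {x} m = m >>= λ { (s , p) → let k = k₀ ℕ.+ s in P-top k (θP⊆P k p) >>= λ { (a , t , a∈ , t∈ , θy≈) → t∈ >>= λ { (c , c∈ , t≈) →
        let b = θ * x - θ ^ k₀ * c
            b∈ : θ ^ s * b ∈ P k
            b∈ = resp (P k) (sym (begin
              θ ^ s * (θ * x - θ ^ k₀ * c)           ≈⟨ rearrange (θ ^ s) θ x (θ ^ k₀) c ⟩
              θ * (θ ^ s * x) - θ ^ k₀ * θ ^ s * c   ≈⟨ +-cong (trans θy≈ (+-congˡ t≈)) (-‿cong (*-congʳ (sym (^-homo-* θ k₀ s)))) ⟩
              a + θ ^ k * c - θ ^ k * c              ≈⟨ drop a (θ ^ k * c) ⟩
              a                                      ∎)) a∈
        in return (θ ^ k₀ * c , b , return (k₀ ℕ.+ 1 , shift c∈ k₀) , return (s , b∈) , sym (recombine (θ ^ k₀ * c) (θ * x))) }}}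
        where
        open ≈R
        rearrange : ∀ t θ x u c → t * (θ * x - u * c) ≈ θ * (t * x) - u * t * c
        rearrange = solve 5 (λ t θ x u c → t :* (θ :* x :- u :* c) := θ :* (t :* x) :- u :* t :* c) refl
        drop : ∀ x y → x + y - y ≈ x
        drop = solve 2 (λ x y → x :+ y :- y := x) refl
        recombine : ∀ x y → x + (y - x) ≈ y
        recombine = solve 2 (λ x y → x :+ (y :- x) := y) refl
        shift : ∀ {c} → c ∈ P 1 → ∀ k → θ ^ k * c ∈ P (k ℕ.+ 1)
        shift {c} c∈ zero    = resp (P 1) (sym (*-identityˡ c)) c∈
        shift {c} c∈ (suc k) = resp (P (suc (k ℕ.+ 1))) (sym (*-assoc θ (θ ^ k) c)) (θP⊆P (k ℕ.+ 1) (shift c∈ k))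

      A⊞B-θ : R (A ⊞ B) θ
      A⊞B-θ {x} m = into (A ⊞ B) m λ { (a , b , a∈ , b∈ , e) →
        resp (A ⊞ B) (sym (trans (*-congˡ e) (distribˡ θ a b))) (+∈ (A ⊞ B) (⊞ˡ A B (θA⊆A a∈)) (θB⊆A⊞B b∈)) }

      -- The intersection of the two charts is `P k₀` rather than `N`, but these are commensurable
      -- and so have the same dimension.
      Dim₃-glue : ∀ {dN dA dB d⊞} → Dim₃ N dN → Dim₃ A dA → Dim₃ B dB → Dim₃ (A ⊞ B) d⊞ → DN (dN ℕ.+ d⊞ ≡ dA ℕ.+ dB)
      Dim₃-glue {dN} {dA} {dB} {d⊞} N/ A/ B/ ⊞/ =
        Dim₃-exists (A ⊓ B) >>= λ { (d , ⊓/) →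
        Dim₃-commensurable (proj₁ (P-bounded k₀)) {N} {A ⊓ B} (P⊆A⊓B ∘ ascend P P-asc 0 k₀) (proj₂ (P-bounded k₀) ∘ A⊓B⊆P) N/ ⊓/ >>= λ dN≡d →
        Dim₃-modular A B A/ B/ ⊓/ ⊞/ >>= λ eq →
        return (≡.trans (≡.cong (ℕ._+ d⊞) dN≡d) eq) }

  Divides₃ : ℕ → Subgroup → Set
  Divides₃ m N = ∀ {d} → Dim₃ N d → m ℕ∣.∣ d

  -- The finiteness that keeps the chains above bounded. It is expressed by multipliers because in
  -- this form it passes to N[θ], even when that group contains 1/3 and is no longer a lattice.
  Commensurable : Subgroup → Set
  Commensurable N = ∀ x → ∃[ e ] R N (three ^ e * x)

  -- As dim N/3N + dim (A + B)/3(A + B) = dim A/3A + dim B/3B, the multipliers of N may be assumed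
  -- to behave like a valuation ring on finitely many given θ.
  dichotomy : ∀ m N → Commensurable N → ∀ {θ θ⁻¹} → θ * θ⁻¹ ≈ 1# →
    (∀ N′ → N ⊑ N′ → R N′ θ ⊎ R N′ θ⁻¹ → Divides₃ m N′) → Divides₃ m N
  dichotomy m N comm {θ} {θ⁻¹} θθ⁻¹≈1 rest {d} N/ = decidable-stable (m ℕ∣.∣? d)
    (stabilises Y Y-asc (proj₁ (P-bounded 1)) Y-bounded >>= λ { (k₀ , stable-k₀) →
     let B₀ = B k₀ stable-k₀ in
     Dim₃-exists A >>= λ { (dA , A/) →
     Dim₃-exists B₀ >>= λ { (dB , B/) →
     Dim₃-exists (A ⊞ B₀) >>= λ { (d⊞ , ⊞/) →
     Dim₃-glue k₀ stable-k₀ N/ A/ B/ ⊞/ >>= λ eq →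
     -- Of the four dimensions in the gluing formula three belong to groups stable under θ or θ⁻¹,
     -- so their divisibility by `m` yields the fourth.
     return (ℕ∣.∣m+n∣m⇒∣n (≡.subst (m ℕ∣.∣_) (≡.trans (≡.sym eq) (ℕ.+-comm d d⊞))
       (ℕ∣.∣m∣n⇒∣m+n (rest A (N⊑A k₀ stable-k₀) (inj₁ (θA⊆A k₀ stable-k₀)) A/) (rest B₀ (N⊑B k₀ stable-k₀) (inj₂ (θ⁻¹B⊆B k₀ stable-k₀)) B/)))
       (rest (A ⊞ B₀) (λ r → R-⊞ A B₀ (N⊑A k₀ stable-k₀ r) (N⊑B k₀ stable-k₀ r)) (inj₁ (A⊞B-θ k₀ stable-k₀)) ⊞/)) }}}})
    where
    open ProjectiveLine N θ θ⁻¹ θθ⁻¹≈1 (proj₁ (comm θ)) (proj₂ (comm θ))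

  3-invertible : ∀ m N {t} → R N t → three * t ≈ 1# → Divides₃ m N
  3-invertible m N {t} rt 3t≈1 {d} N/ = ≡.subst (m ℕ∣.∣_) (Dim₃-unique {N} {0} {d} N⊆3N N/) (m ℕ∣.∣0)
    where
    N⊆3N : N ⊆ three ∙ N
    N⊆3N {x} x∈ = return (t * x , rt x∈ , sym (trans (sym (*-assoc three t x)) (trans (*-congʳ 3t≈1) (*-identityˡ x))))

  -- Inverting 1 + 3r does not change N modulo 3.
  invert-1+3r : ∀ m N {r} → R N r →
    (∀ N′ → N ⊑ N′ → (∃[ u ] (1# + three * r) * u ≈ 1# × R N′ u) → Divides₃ m N′) → Divides₃ m N
  invert-1+3r m N {r} rr rest {d} N/ with ≈0? (1# + three * r)
  -- If 1 + 3r vanishes, then -r is an inverse of 3 and N = 3N.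
  ... | yes θ≈0 = 3-invertible m N (R-neg N rr) (trans (sym (-‿distribʳ-* three r))
      (trans (sym (+-identityˡ (- (three * r)))) (trans (+-congʳ (sym θ≈0)) (cancel 1# (three * r))))) N/
    where
    cancel : ∀ x y → x + y - y ≈ x
    cancel = solve 2 (λ x y → x :+ y :- y := x) refl
  ... | no θ≉0 = rest U N⊑U (θ⁻¹ , θθ⁻¹≈1 , θ⁻¹∈R) (Dim-⊆ d N⊆U 3N⊆3U inj surj N/)
    where
    θ = 1# + three * r
    θ⁻¹ = proj₁ (inverse θ θ≉0)
    θθ⁻¹≈1 = proj₂ (inverse θ θ≉0)
    rθ : R N θ
    rθ = R-+ N (R-1 N) (R-* N (R-ℤ N (+ 3)) rr)
    V : ℕ → Subgroup
    V k = pre (θ ^ k) N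
    V-asc : ∀ k → V k ⊆ V (suc k)
    V-asc k {x} p = resp N (sym (*-assoc θ (θ ^ k) x)) (rθ p)
    U = ⋃ V V-asc
    N⊑U : N ⊑ U
    N⊑U rx = R-⋃ V V-asc (λ k → R-pre (θ ^ k) N rx)
    N⊆U : N ⊆ U
    N⊆U {x} x∈ = return (0 , resp N (sym (*-identityˡ x)) x∈)
    3N⊆3U : three ∙ N ⊆ three ∙ U
    3N⊆3U = ∙-mono three {N} {U} N⊆U
    θ⁻¹∈R : R U θ⁻¹
    θ⁻¹∈R {x} mm = mm >>= λ { (k , p) → return (suc k , resp N (sym (trans (rearrange θ (θ ^ k) θ⁻¹ x) (trans (*-congʳ θθ⁻¹≈1) (*-identityˡ (θ ^ k * x))))) p) }
      where
      rearrange : ∀ θ t i x → θ * t * (i * x) ≈ θ * i * (t * x)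
      rearrange = solve 4 (λ θ t i x → θ :* t :* (i :* x) := θ :* i :* (t :* x)) refl
    -- A power of 1 + 3r again has this form and so acts as the identity modulo 3. Hence an element
    -- y of `U` with θᵏy in `N` is represented modulo 3U by θᵏy itself.
    power : ∀ k → ∃[ s ] R N s × θ ^ k ≈ 1# + three * s
    power zero    = 0# , R-resp N ι-0 (R-ℤ N 0ℤ) , sym (trans (+-congˡ (zeroʳ three)) (+-identityʳ 1#))
    power (suc k) = let s , rs , e = power k in r + (s + three * (r * s)) ,
      R-+ N rr (R-+ N rs (R-* N (R-ℤ N (+ 3)) (R-* N rr rs))) ,
      trans (*-congˡ e) (trans (*-cong (+-congʳ (sym ι-1)) (+-congʳ (sym ι-1))) (trans (expand r s three) (+-congʳ ι-1)))
      where
      expand : ∀ r s t → (ιℤ 1ℤ + t * r) * (ιℤ 1ℤ + t * s) ≈ ιℤ 1ℤ + t * (r + (s + t * (r * s)))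
      expand = solve 3 (λ r s t → (con 1ℤ :+ t :* r) :* (con 1ℤ :+ t :* s) := con 1ℤ :+ t :* (r :+ (s :+ t :* (r :* s)))) refl
    split : ∀ x t s → t ≈ 1# + three * s → t * x - three * (s * x) ≈ x
    split x t s e = trans (+-congʳ (trans (*-congʳ e) (trans (distribʳ x 1# (three * s)) (+-congʳ (*-identityˡ x)))))
      (solve 3 (λ x a s → x :+ a :* s :* x :- a :* (s :* x) := x) refl x three s)
    inj : ∀ {x} → x ∈ N → x ∈ three ∙ U → x ∈ three ∙ N
    inj {x} x∈ mm = mm >>= λ { (u , u∈ , x≈) → u∈ >>= λ { (k , θᵏu∈) → let s , rs , e = power k in
      resp (three ∙ N) (split x (θ ^ k) s e) (-∈ (three ∙ N)
        (return (θ ^ k * u , θᵏu∈ , trans (*-congˡ x≈) (solve 3 (λ t a u → t :* (a :* u) := a :* (t :* u)) refl (θ ^ k) three u)))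
        (∙-in three N (rs x∈))) }}
    surj : ∀ {y} → y ∈ U → DN (∃[ x ] x ∈ N × y - x ∈ three ∙ U)
    surj {y} y∈ = y∈ >>= λ { (k , p) → let s , rs , e = power k in return (θ ^ k * y , p ,
      resp (three ∙ U) (trans (solve 2 (λ a b → :- a := b :- a :- b) refl (three * (s * y)) (θ ^ k * y)) (+-congʳ (split y (θ ^ k) s e)))
        (neg∈ (three ∙ U) (∙-in three U (N⊑U rs y∈)))) }

-- Divisibility, ties and ramification

half : ∀ m → ∃[ k ] (m ≡ k ℕ.+ k ⊎ m ≡ suc (k ℕ.+ k))
half zero          = 0 , inj₁ ≡.refl
half (suc zero)    = 0 , inj₂ ≡.refl
half (suc (suc m)) with half m
... | k , inj₁ e = suc k , inj₁ (≡.cong suc (≡.trans (≡.cong suc e) (≡.sym (ℕ.+-suc k k))))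
... | k , inj₂ e = suc k , inj₂ (≡.cong suc (≡.cong suc (≡.trans e (≡.sym (ℕ.+-suc k k)))))

n<3^n : ∀ n → n ℕ.< 3 ℕ.^ n
n<3^n zero    = s≤s z≤n
n<3^n (suc n) = ℕ.≤-trans (s≤s (n<3^n n)) (ℕ.≤-trans (ℕ.+-monoˡ-≤ (3 ℕ.^ n) (ℕ.≤-trans (s≤s z≤n) (n<3^n n))) (ℕ.+-monoʳ-≤ (3 ℕ.^ n) (ℕ.m≤m+n (3 ℕ.^ n) _)))

module Ties (L : NumberField) (m : ℕ) (1≤m : 1 ℕ.≤ m) where
  open Charts L public

  -- The substitute for v(a) ≤ v(b).
  Div : Subgroup → Carrier → Carrier → Set
  Div N a b = ∃[ c ] R N c × b ≈ c * a

  Div-⊑ : ∀ {N N′ a b} → N ⊑ N′ → Div N a b → Div N′ a b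
  Div-⊑ N⊑N′ (c , r , e) = c , N⊑N′ r , e

  Div-refl : ∀ N a → Div N a a
  Div-refl N a = 1# , R-1 N , sym (*-identityˡ a)

  Div-trans : ∀ N {a b c} → Div N a b → Div N b c → Div N a c
  Div-trans N {a} (x , rx , b≈) (y , ry , c≈) = y * x , R-* N ry rx , trans c≈ (trans (*-congˡ b≈) (sym (*-assoc y x a)))

  Div-* : ∀ N {a b c d} → Div N a b → Div N c d → Div N (a * c) (b * d)
  Div-* N {a} {b} {c} {d} (x , rx , b≈) (y , ry , d≈) = x * y , R-* N rx ry ,
    trans (*-cong b≈ d≈) (solve 4 (λ x a y c → x :* a :* (y :* c) := x :* y :* (a :* c)) refl x a y c)

  Div-^ : ∀ N {a b} → Div N a b → ∀ k → Div N (a ^ k) (b ^ k)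
  Div-^ N d zero    = Div-refl N 1#
  Div-^ N d (suc k) = Div-* N d (Div-^ N d k)

  Commensurable-⊑ : ∀ {N N′} → N ⊑ N′ → Commensurable N → Commensurable N′
  Commensurable-⊑ N⊑N′ comm x = let e , r = comm x in e , N⊑N′ r

  -- The dichotomy is applied to θ = b/a. A continuation is needed because the comparison may come
  -- out differently over the different enlargements of `N`, and need not hold over `N` itself.
  compare : ∀ N → Commensurable N → ∀ a b →
    (∀ N′ → Commensurable N′ → N ⊑ N′ → Div N′ a b ⊎ Div N′ b a → Divides₃ m N′) → Divides₃ m N
  compare N comm a b rest with ≈0? a | ≈0? b
  ... | yes a≈0 | _       = rest N comm id (inj₂ (0# , R-resp N ι-0 (R-ℤ N 0ℤ) , trans a≈0 (sym (zeroˡ b))))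
  ... | no  _   | yes b≈0 = rest N comm id (inj₁ (0# , R-resp N ι-0 (R-ℤ N 0ℤ) , trans b≈0 (sym (zeroˡ a))))
  ... | no a≉0  | no b≉0  = dichotomy m N comm {b * a⁻¹} {a * b⁻¹}
      (trans (solve 4 (λ a a⁻¹ b b⁻¹ → b :* a⁻¹ :* (a :* b⁻¹) := a :* a⁻¹ :* (b :* b⁻¹)) refl a a⁻¹ b b⁻¹) (trans (*-cong aa⁻¹ bb⁻¹) (*-identityˡ 1#)))
      λ { N′ N⊑N′ (inj₁ r) → rest N′ (Commensurable-⊑ {N} {N′} N⊑N′ comm) N⊑N′ (inj₁ (b * a⁻¹ , r , sym (undo b a a⁻¹ aa⁻¹)))
        ; N′ N⊑N′ (inj₂ r) → rest N′ (Commensurable-⊑ {N} {N′} N⊑N′ comm) N⊑N′ (inj₂ (a * b⁻¹ , r , sym (undo a b b⁻¹ bb⁻¹))) }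
    where
    a⁻¹ = proj₁ (inverse a a≉0)
    aa⁻¹ = proj₂ (inverse a a≉0)
    b⁻¹ = proj₁ (inverse b b≉0)
    bb⁻¹ = proj₂ (inverse b b≉0)
    undo : ∀ x y i → y * i ≈ 1# → x * i * y ≈ x
    undo x y i e = trans (*-assoc x i y) (trans (*-congˡ (trans (*-comm i y) e)) (*-identityʳ x))

  Least : Subgroup → Carrier → Carrier → Carrier → Set
  Least N a b c = ∃[ w ] (w ≡ a ⊎ w ≡ b ⊎ w ≡ c) × Div N w a × Div N w b × Div N w c

  Least-⊑ : ∀ {N N′ a b c} → N ⊑ N′ → Least N a b c → Least N′ a b c
  Least-⊑ {N} {N′} N⊑N′ (w , w∈ , p , q , r) = w , w∈ , Div-⊑ {N} {N′} N⊑N′ p , Div-⊑ {N} {N′} N⊑N′ q , Div-⊑ {N} {N′} N⊑N′ r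

  least : ∀ N {a b c} → Div N a b ⊎ Div N b a → Div N b c ⊎ Div N c b → Div N a c ⊎ Div N c a → Least N a b c
  least N {a} {b} {c} (inj₁ ab) _ (inj₁ ac) = a , inj₁ ≡.refl , Div-refl N a , ab , ac
  least N {a} {b} {c} (inj₁ ab) _ (inj₂ ca) = c , inj₂ (inj₂ ≡.refl) , ca , Div-trans N ca ab , Div-refl N c
  least N {a} {b} {c} (inj₂ ba) (inj₁ bc) _ = b , inj₂ (inj₁ ≡.refl) , ba , Div-refl N b , bc
  least N {a} {b} {c} (inj₂ ba) (inj₂ cb) _ = c , inj₂ (inj₂ ≡.refl) , Div-trans N cb ba , cb , Div-refl N c

  compare₃ : ∀ N → Commensurable N → ∀ a b c →
    (∀ N′ → Commensurable N′ → N ⊑ N′ → Least N′ a b c → Divides₃ m N′) → Divides₃ m N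
  compare₃ N comm a b c rest =
    compare N comm a b λ N₁ comm₁ N⊑N₁ ab →
    compare N₁ comm₁ b c λ N₂ comm₂ N₁⊑N₂ bc →
    compare N₂ comm₂ a c λ N₃ comm₃ N₂⊑N₃ ac →
    rest N₃ comm₃ (N₂⊑N₃ ∘ N₁⊑N₂ ∘ N⊑N₁) (least N₃
      (lift {N₁} {N₃} (N₂⊑N₃ ∘ N₁⊑N₂) ab) (lift {N₂} {N₃} N₂⊑N₃ bc) ac)
    where
    lift : ∀ {N N′ a b} → N ⊑ N′ → Div N a b ⊎ Div N b a → Div N′ a b ⊎ Div N′ b a
    lift {N} {N′} N⊑N′ (inj₁ p) = inj₁ (Div-⊑ {N} {N′} N⊑N′ p)
    lift {N} {N′} N⊑N′ (inj₂ p) = inj₂ (Div-⊑ {N} {N′} N⊑N′ p)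

  -- The substitute for v(a) = v(b), with the unit made explicit.
  record Associated (N : Subgroup) (a b : Carrier) : Set where
    field
      κ κ⁻¹ : Carrier
      κ∈    : R N κ
      κ⁻¹∈  : R N κ⁻¹
      κκ⁻¹  : κ * κ⁻¹ ≈ 1#
      b≈κa  : b ≈ κ * a

  Associated-sym : ∀ {N a b} → Associated N a b → Associated N b a
  Associated-sym {N} {a} {b} as = record
    { κ = κ⁻¹ ; κ⁻¹ = κ ; κ∈ = κ⁻¹∈ ; κ⁻¹∈ = κ∈ ; κκ⁻¹ = trans (*-comm κ⁻¹ κ) κκ⁻¹
    ; b≈κa = sym (trans (*-congˡ b≈κa) (trans (sym (*-assoc κ⁻¹ κ a)) (trans (*-congʳ (trans (*-comm κ⁻¹ κ) κκ⁻¹)) (*-identityˡ a)))) }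
    where open Associated as

  -- In a vanishing sum modulo 3 the least term is associated to another term.
  tie : ∀ N → Commensurable N → ∀ {g p q ρ} → ¬ g ≈ 0# → Div N g p → Div N g q → R N ρ → g + (p + q) ≈ three * (ρ * g) →
    (∀ N′ → Commensurable N′ → N ⊑ N′ → Associated N′ g p → Divides₃ m N′) →
    (∀ N′ → Commensurable N′ → N ⊑ N′ → Associated N′ g q → Divides₃ m N′) → Divides₃ m N
  tie N comm {g} {p} {q} {ρ} g≉0 (p′ , rp , p≈) (q′ , rq , q≈) rρ relation restp restq =
    -- Division by g gives 1 + p′ + q′ = 3ρ. If q′ = c p′, this reads p′ · (-(1 + c)) = 1 - 3ρ, so
    -- p′ becomes a unit once 1 - 3ρ is inverted; the other case is symmetric.
    compare N comm p′ q′ λ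
      { N₁ comm₁ N⊑N₁ (inj₁ (c , rc , q′≈)) → invert-1+3r m N₁ (R-neg N₁ (N⊑N₁ rρ)) λ { N₂ N₁⊑N₂ (u , eu , ru) →
          restp N₂ (Commensurable-⊑ {N₁} {N₂} N₁⊑N₂ comm₁) (N₁⊑N₂ ∘ N⊑N₁)
            (unit N₂ p≈ (N₁⊑N₂ (N⊑N₁ rp)) (N₁⊑N₂ rc) ru (trans (*-congʳ (solved p′ c (trans (+-congˡ (+-congˡ (sym q′≈))) sum≈))) eu)) }
      ; N₁ comm₁ N⊑N₁ (inj₂ (c , rc , p′≈)) → invert-1+3r m N₁ (R-neg N₁ (N⊑N₁ rρ)) λ { N₂ N₁⊑N₂ (u , eu , ru) →
          restq N₂ (Commensurable-⊑ {N₁} {N₂} N₁⊑N₂ comm₁) (N₁⊑N₂ ∘ N⊑N₁)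
            (unit N₂ q≈ (N₁⊑N₂ (N⊑N₁ rq)) (N₁⊑N₂ rc) ru (trans (*-congʳ (solved q′ c (trans (+-congˡ (trans (+-congˡ (sym p′≈)) (+-comm q′ p′))) sum≈))) eu)) } }
    where
    sum≈ : 1# + (p′ + q′) ≈ three * ρ
    sum≈ = cancelˡ g≉0 (begin
      g * (1# + (p′ + q′))       ≈⟨ trans (distribˡ g 1# (p′ + q′)) (+-congʳ (*-identityʳ g)) ⟩
      g + g * (p′ + q′)          ≈⟨ +-congˡ (trans (distribˡ g p′ q′) (+-cong (trans (*-comm g p′) (sym p≈)) (trans (*-comm g q′) (sym q≈)))) ⟩
      g + (p + q)                ≈⟨ relation ⟩
      three * (ρ * g)            ≈⟨ solve 3 (λ t ρ g → t :* (ρ :* g) := g :* (t :* ρ)) refl three ρ g ⟩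
      g * (three * ρ)            ∎)
      where open ≈R
    solved : ∀ x c → 1# + (x + c * x) ≈ three * ρ → x * - (1# + c) ≈ 1# + three * - ρ
    solved x c e = sym (begin
      1# + three * - ρ                 ≈⟨ +-congˡ (trans (sym (-‿distribʳ-* three ρ)) (-‿cong (sym e))) ⟩
      1# - (1# + (x + c * x))          ≈⟨ +-cong (sym ι-1) (-‿cong (+-congʳ (sym ι-1))) ⟩
      ιℤ 1ℤ - (ιℤ 1ℤ + (x + c * x))    ≈⟨ solve 2 (λ x c → con 1ℤ :- (con 1ℤ :+ (x :+ c :* x)) := x :* :- (con 1ℤ :+ c)) refl x c ⟩
      x * - (ιℤ 1ℤ + c)                ≈⟨ *-congˡ (-‿cong (+-congʳ ι-1)) ⟩
      x * - (1# + c)                   ∎)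
      where open ≈R
    unit : ∀ N′ {y x c u} → y ≈ x * g → R N′ x → R N′ c → R N′ u → x * - (1# + c) * u ≈ 1# → Associated N′ g y
    unit N′ {y} {x} {c} {u} y≈ rx rc ru e = record
      { κ = x ; κ⁻¹ = - (1# + c) * u ; κ∈ = rx ; κ⁻¹∈ = R-* N′ (R-neg N′ (R-+ N′ (R-1 N′) rc)) ru
      ; κκ⁻¹ = trans (sym (*-assoc x (- (1# + c)) u)) e ; b≈κa = y≈ }

  ^-1 : ∀ k → 1# ^ k ≈ 1#
  ^-1 zero    = refl
  ^-1 (suc k) = trans (*-identityˡ (1# ^ k)) (^-1 k)

  -- Roots of multipliers are multipliers as soon as they are comparable with 1.
  R-root : ∀ N k {u c} → 1 ℕ.≤ k → R N c → u * c ≈ 1# → R N (u ^ k) → R N u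
  R-root N (suc k) {u} {c} _ rc uc≈1 ruᵏ = R-resp N (begin
    u * u ^ k * c ^ k      ≈⟨ *-assoc u (u ^ k) (c ^ k) ⟩
    u * (u ^ k * c ^ k)    ≈⟨ *-congˡ (trans (sym (^-distrib-* u c k)) (trans (^-congˡ k uc≈1) (^-1 k))) ⟩
    u * 1#                 ≈⟨ *-identityʳ u ⟩
    u                      ∎) (R-* N ruᵏ (R-^ N rc k))
    where open ≈R

  module _ {a b : Carrier} (b≉0 : ¬ b ≈ 0#) where

    ratio : Carrier
    ratio = a * proj₁ (inverse b b≉0)

    ratio-* : ratio * b ≈ a
    ratio-* = trans (*-assoc a _ b) (trans (*-congˡ (trans (*-comm _ b) (proj₂ (inverse b b≉0)))) (*-identityʳ a))

    ratio-^ : ∀ k {t} → a ^ k ≈ t * b ^ k → ratio ^ k ≈ t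
    ratio-^ k {t} e = cancelˡ (^≉0 b≉0 k) (begin
      b ^ k * ratio ^ k   ≈⟨ *-comm (b ^ k) (ratio ^ k) ⟩
      ratio ^ k * b ^ k   ≈⟨ sym (^-distrib-* ratio b k) ⟩
      (ratio * b) ^ k     ≈⟨ ^-congˡ k ratio-* ⟩
      a ^ k               ≈⟨ e ⟩
      t * b ^ k           ≈⟨ *-comm t (b ^ k) ⟩
      b ^ k * t           ∎)
      where open ≈R

    -- The multiplier ring need not be integrally closed; comparability of `a` and `b` is what
    -- allows a root to be taken inside it.
    R-ratio : ∀ N k {t} → 1 ℕ.≤ k → Div N a b ⊎ Div N b a → R N t → a ^ k ≈ t * b ^ k → R N ratio
    R-ratio N k {t} _ (inj₂ (c , rc , a≈)) _ _ = R-resp N (cancelˡ b≉0 (trans (*-comm b c) (trans (sym a≈) (trans (sym ratio-*) (*-comm ratio b))))) rc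
    R-ratio N k {t} 1≤k (inj₁ (c , rc , b≈)) rt e = R-root N k 1≤k rc
      (cancelˡ b≉0 (trans (solve 3 (λ b u c → b :* (u :* c) := c :* (u :* b)) refl b ratio c) (trans (*-congˡ ratio-*) (trans (sym b≈) (sym (*-identityʳ b))))))
      (R-resp N (sym (ratio-^ k e)) rt)

  Divides₃-root : ∀ N {φ κ κ⁻¹} → R N φ → R N κ → R N κ⁻¹ → κ * κ⁻¹ ≈ 1# → φ ^ m ≈ three * κ → Divides₃ m N
  Divides₃-root N rφ rκ rκ⁻¹ κκ⁻¹ e {d} N/ = decidable-stable (m ℕ∣.∣? d)
    (Dim₃-root N m {d = d} 1≤m rφ rκ rκ⁻¹ κκ⁻¹ e N/ >>= λ { (w , _ , d≡) → return (≡.subst (m ℕ∣.∣_) (≡.sym d≡) (ℕ∣.m∣m*n w)) })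

  -- The quotient a/b is an `m`-th root of 3 up to a unit.
  ramified : ∀ N {a b} → ¬ b ≈ 0# → Div N a b ⊎ Div N b a → Associated N (three * b ^ m) (a ^ m) → Divides₃ m N
  ramified N {a} {b} b≉0 ab as = Divides₃-root N
    (R-ratio b≉0 N m 1≤m ab (R-* N (R-ℤ N (+ 3)) κ∈) aᵐ≈) κ∈ κ⁻¹∈ κκ⁻¹ (ratio-^ {a} {b} b≉0 m aᵐ≈)
    where
    open Associated as
    aᵐ≈ : a ^ m ≈ three * κ * b ^ m
    aᵐ≈ = trans b≈κa (solve 3 (λ k t b → k :* (t :* b) := t :* k :* b) refl κ three (b ^ m))

  module SquareTie (N : Subgroup) (comm : Commensurable N) {a b : Carrier} (b≉0 : ¬ b ≈ 0#) (a≉0 : ¬ a ≈ 0#)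
    (ab : Div N a b ⊎ Div N b a) (as : Associated N (three * three * b ^ m) (a ^ m)) where

    open Associated as

    v : Carrier
    v = ratio {a} {b} b≉0

    aᵐ≈ : a ^ m ≈ three * three * κ * b ^ m
    aᵐ≈ = trans b≈κa (solve 3 (λ k t b → k :* (t :* t :* b) := t :* t :* k :* b) refl κ three (b ^ m))

    v∈R : R N v
    v∈R = R-ratio b≉0 N m 1≤m ab (R-* N (R-* N (R-ℤ N (+ 3)) (R-ℤ N (+ 3))) κ∈) aᵐ≈

    vᵐ≈ : v ^ m ≈ three * three * κ
    vᵐ≈ = ratio-^ b≉0 m aᵐ≈

    v≉0 : ¬ v ≈ 0#
    v≉0 v≈0 = a≉0 (trans (sym (ratio-* b≉0)) (trans (*-congʳ v≈0) (zeroˡ b)))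

    -- With m = 2k + 1 the element 3/vᵏ is an `m`-th root of 3 up to a unit: its `m`-th power is
    -- 3²ᵏ⁺¹/(9κ)ᵏ = 3κ⁻ᵏ.
    odd : ∀ k → m ≡ suc (k ℕ.+ k) → Divides₃ m N
    odd k m≡ = compare N comm three (v ^ k) λ N′ _ N⊑N′ cmp →
      Divides₃-root N′ (R-ratio vᵏ≉0 N′ m 1≤m cmp (R-* N′ (R-ℤ N′ (+ 3)) (R-^ N′ (N⊑N′ κ⁻¹∈) k)) 3ᵐ≈)
        (R-^ N′ (N⊑N′ κ⁻¹∈) k) (R-^ N′ (N⊑N′ κ∈) k)
        (trans (sym (^-distrib-* κ⁻¹ κ k)) (trans (^-congˡ k (trans (*-comm κ⁻¹ κ) κκ⁻¹)) (^-1 k)))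
        (ratio-^ {three} {v ^ k} vᵏ≉0 m 3ᵐ≈)
      where
      open ≈R
      vᵏ≉0 = ^≉0 v≉0 k
      3ᵐ≈ : three ^ m ≈ three * κ⁻¹ ^ k * (v ^ k) ^ m
      3ᵐ≈ = sym (begin
        three * κ⁻¹ ^ k * (v ^ k) ^ m                    ≈⟨ *-congˡ (trans (^-assocʳ v k m) (trans (reflexive (≡.cong (v ^_) (ℕ.*-comm k m))) (sym (^-assocʳ v m k)))) ⟩
        three * κ⁻¹ ^ k * (v ^ m) ^ k                    ≈⟨ *-congˡ (trans (^-congˡ k vᵐ≈) (trans (^-distrib-* (three * three) κ k) (*-congʳ (^-distrib-* three three k)))) ⟩
        three * κ⁻¹ ^ k * (three ^ k * three ^ k * κ ^ k)  ≈⟨ solve 4 (λ t i s κ → t :* i :* (s :* s :* κ) := t :* (s :* s) :* (κ :* i)) refl three (κ⁻¹ ^ k) (three ^ k) (κ ^ k) ⟩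
        three * (three ^ k * three ^ k) * (κ ^ k * κ⁻¹ ^ k)  ≈⟨ *-cong (*-congˡ (sym (^-homo-* three k k))) (trans (sym (^-distrib-* κ κ⁻¹ k)) (trans (^-congˡ k κκ⁻¹) (^-1 k))) ⟩
        three * three ^ (k ℕ.+ k) * 1#                   ≈⟨ *-identityʳ _ ⟩
        three ^ suc (k ℕ.+ k)                            ≈⟨ reflexive (≡.cong (three ^_) (≡.sym m≡)) ⟩
        three ^ m                                        ∎)

    -- When m = 2k the square root j of κ reduces to a square root of -1 wherever τ is nilpotent
    -- modulo 3, and elsewhere τ is invertible.
    module Even (k′ : ℕ) (m≡ : m ≡ suc k′ ℕ.+ suc k′) {τ ρ : Carrier} where

      k : ℕ
      k = suc k′

      -- As m = 2k, the square of vᵏ/3 is vᵐ/9 = κ.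
      j : Carrier
      j = ratio {v ^ k} {three} three≉0

      [vᵏ]²≈ : (v ^ k) ^ 2 ≈ κ * three ^ 2
      [vᵏ]²≈ = begin
        v ^ k * (v ^ k * 1#)       ≈⟨ *-congˡ (*-identityʳ (v ^ k)) ⟩
        v ^ k * v ^ k              ≈⟨ sym (^-homo-* v k k) ⟩
        v ^ (k ℕ.+ k)              ≈⟨ reflexive (≡.cong (v ^_) (≡.sym m≡)) ⟩
        v ^ m                      ≈⟨ vᵐ≈ ⟩
        three * three * κ          ≈⟨ *-comm (three * three) κ ⟩
        κ * (three * three)        ≈⟨ *-congˡ (*-congˡ (sym (*-identityʳ three))) ⟩
        κ * (three * (three * 1#)) ∎
        where open ≈R

      j²≈κ : j * j ≈ κ
      j²≈κ = trans (*-congˡ (sym (*-identityʳ j))) (ratio-^ three≉0 2 [vᵏ]²≈)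

      j-unit : j * (j * κ⁻¹) ≈ 1#
      j-unit = trans (sym (*-assoc j j κ⁻¹)) (trans (*-congʳ j²≈κ) κκ⁻¹)

      vᵏ≈3j : v ^ k ≈ three * j
      vᵏ≈3j = trans (sym (ratio-* three≉0)) (*-comm j three)

      -- Frobenius: modulo 3 cubing is additive, so the relation survives with j² and τ replaced by
      -- their 3ᵉ-th powers. The purpose is to make the power of τ either divisible by v or too
      -- divisible by τ to be a divisor of v.
      cube : ∀ N′ → R N′ τ → R N′ ρ → j * j + 1# + τ ≈ three * ρ → ∀ e →
        ∃[ r ] R N′ r × (j * j) ^ (3 ℕ.^ e) + 1# + τ ^ (3 ℕ.^ e) ≈ three * r
      cube N′ rτ rρ relation zero = ρ , rρ , trans (+-cong (+-congʳ (*-identityʳ (j * j))) (*-identityʳ τ)) relation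
      cube N′ rτ rρ relation (suc e) with cube N′ rτ rρ relation e
      ... | r , rr , eq = s , rs , (begin
        (j * j) ^ (3 ℕ.* n) + 1# + τ ^ (3 ℕ.* n)    ≈⟨ +-cong (+-congʳ (power (j * j))) (power τ) ⟩
        x * (x * x) + 1# + t * (t * t)              ≈⟨ +-congʳ (+-congˡ (sym ι-1)) ⟩
        x * (x * x) + ιℤ 1ℤ + t * (t * t)           ≈⟨ +-congʳ (+-congʳ (*-cong x≈ (*-cong x≈ x≈))) ⟩
        y * (y * y) + ιℤ 1ℤ + t * (t * t)           ≈⟨ expand t r ⟩
        three * s                                   ∎)
        where
        open ≈R
        n = 3 ℕ.^ e
        x = (j * j) ^ n
        t = τ ^ n
        y = three * r - (ιℤ 1ℤ + t)
        u = ιℤ 1ℤ + t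
        -- From x = 3r - u with u = 1 + t: the cube contributes 27r³ - 27r²u + 9ru² - u³, and -u³ +
        -- 1 + t³ = -3(t + t²).
        s = three * three * (r * (r * r)) - three * three * (r * r * u) + three * (r * (u * u)) - (t + t * t)
        rt : R N′ t
        rt = R-^ N′ rτ n
        ru : R N′ u
        ru = R-+ N′ (R-ℤ N′ 1ℤ) rt
        r3 : R N′ three
        r3 = R-ℤ N′ (+ 3)
        rs : R N′ s
        rs = R-+ N′ (R-+ N′ (R-+ N′ (R-* N′ (R-* N′ r3 r3) (R-* N′ rr (R-* N′ rr rr))) (R-neg N′ (R-* N′ (R-* N′ r3 r3) (R-* N′ (R-* N′ rr rr) ru))))
          (R-* N′ r3 (R-* N′ rr (R-* N′ ru ru)))) (R-neg N′ (R-+ N′ rt (R-* N′ rt rt)))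
        power : ∀ z → z ^ (3 ℕ.* n) ≈ z ^ n * (z ^ n * z ^ n)
        power z = trans (^-homo-* z n (n ℕ.+ (n ℕ.+ 0))) (*-congˡ (trans (^-homo-* z n (n ℕ.+ 0)) (*-congˡ (reflexive (≡.cong (z ^_) (ℕ.+-identityʳ n))))))
        x≈ : x ≈ y
        x≈ = trans (isolate x 1# t) (+-cong eq (-‿cong (+-congʳ (sym ι-1))))
          where
          isolate : ∀ x o t → x ≈ x + o + t - (o + t)
          isolate = solve 3 (λ x o t → x := x :+ o :+ t :- (o :+ t)) refl
        expand : ∀ t r → let u = ιℤ 1ℤ + t; y = three * r - u in
          y * (y * y) + ιℤ 1ℤ + t * (t * t) ≈
          three * (three * three * (r * (r * r)) - three * three * (r * r * u) + three * (r * (u * u)) - (t + t * t))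
        expand = solve 2 (λ t r → let u = con 1ℤ :+ t; three = con (+ 3); y = three :* r :- u in
          y :* (y :* y) :+ con 1ℤ :+ t :* (t :* t) :=
          three :* (three :* three :* (r :* (r :* r)) :- three :* three :* (r :* r :* u) :+ three :* (r :* (u :* u)) :- (t :+ t :* t))) refl

      -- Since vᵏ = 3j and jκ⁻¹ is the inverse of j, the number 3 equals vᵏ · jκ⁻¹ and is divisible
      -- by v, hence by every divisor of v.
      kills : ∀ N′ → N ⊑ N′ → R N′ j → ∀ {θ} → Div N′ θ v → ThreeKills N′ (θ ∙ N′)
      kills N′ N⊑N′ rj {θ} (c , rc , v≈) {x} x∈ =
        return (c * (v ^ k′ * (j * κ⁻¹ * x)) , rc (R-^ N′ (N⊑N′ v∈R) k′ (R-* N′ rj (N⊑N′ κ⁻¹∈) x∈)) , (begin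
          three * x                                ≈⟨ *-congʳ (sym (trans (*-assoc three j (j * κ⁻¹)) (trans (*-congˡ j-unit) (*-identityʳ three)))) ⟩
          three * j * (j * κ⁻¹) * x                ≈⟨ *-congʳ (*-congʳ (sym vᵏ≈3j)) ⟩
          v * v ^ k′ * (j * κ⁻¹) * x               ≈⟨ *-congʳ (*-congʳ (*-congʳ v≈)) ⟩
          c * θ * v ^ k′ * (j * κ⁻¹) * x           ≈⟨ solve 5 (λ c θ w i x → c :* θ :* w :* i :* x := θ :* (c :* (w :* (i :* x)))) refl c θ (v ^ k′) (j * κ⁻¹) x ⟩
          θ * (c * (v ^ k′ * (j * κ⁻¹ * x)))       ∎))
        where open ≈R

      Div-power : ∀ N′ → R N′ τ → ∀ n → 1 ℕ.≤ n → Div N′ τ (τ ^ n)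
      Div-power N′ rτ (suc n) _ = τ ^ n , R-^ N′ rτ n , *-comm τ (τ ^ n)

      τ^≉0⇒τ≉0 : ∀ n → 1 ℕ.≤ n → ¬ τ ^ n ≈ 0# → ¬ τ ≈ 0#
      τ^≉0⇒τ≉0 (suc n) _ τⁿ≉0 τ≈0 = τⁿ≉0 (trans (*-congʳ τ≈0) (zeroˡ (τ ^ n)))

      -- As vᵏ is 3 up to a unit, the dimension is k · w with w = dim N₂/vN₂, and w has to be even.
      -- If v divides τˢ, a square root of -1 acts on N₂/vN₂. If τˢ divides v, the chain N₂ ⊇ τN₂ ⊇
      -- ⋯ ⊇ τˢN₂ ⊇ vN₂ is too long for the available dimension unless all steps before the last are
      -- equalities; then τ is a unit, and the claim is left to `rest`.
      even : R N τ → R N ρ → κ + 1# + τ ≈ three * ρ →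
        (∀ N′ → Commensurable N′ → N ⊑ N′ → ∀ τ⁻¹ → R N′ τ⁻¹ → τ * τ⁻¹ ≈ 1# → Divides₃ m N′) → Divides₃ m N
      even rτ rρ relation rest =
        -- The square κ of j is a unit, so j is a multiplier as soon as it is comparable with 1.
        compare N comm (v ^ k) three λ N₁ comm₁ N⊑N₁ cmp →
        let rj = R-ratio three≉0 N₁ 2 (s≤s z≤n) cmp (N⊑N₁ κ∈) [vᵏ]²≈
        in compare N₁ comm₁ v (τ ^ s) λ N₂ comm₂ N₁⊑N₂ cmp′ {d} N₂/ →
        let N⊑N₂ : N ⊑ N₂
            N⊑N₂ = N₁⊑N₂ ∘ N⊑N₁
        in decidable-stable (m ℕ∣.∣? d)
          (Dim₃-root N₂ k {d = d} (s≤s z≤n) (N⊑N₂ v∈R) (N₁⊑N₂ rj) (R-* N₂ (N₁⊑N₂ rj) (N⊑N₂ κ⁻¹∈)) j-unit vᵏ≈3j N₂/ >>= λ { (w , N₂/v , d≡) →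
           nilpotent-or-unit N₂ comm₂ N⊑N₂ (N₁⊑N₂ rj) cmp′ w N₂/v d≡ N₂/ })
        where
        -- Every dimension furnished by `Dim-exists` is less than f, and f < 3ᶠ. The exponent is a
        -- power of 3 so that `cube` applies.
        f = suc (suc degree)
        s = 3 ℕ.^ f
        nilpotent-or-unit : ∀ N₂ → Commensurable N₂ → N ⊑ N₂ → R N₂ j → Div N₂ v (τ ^ s) ⊎ Div N₂ (τ ^ s) v →
          ∀ w {d} → Dim N₂ (v ∙ N₂) w → d ≡ k ℕ.* w → Dim₃ N₂ d → DN (m ℕ∣.∣ d)
        nilpotent-or-unit N₂ comm₂ N⊑N₂ rj (inj₁ (c , rc , τˢ≈)) w {d} N₂/v d≡ _ =
          return (≡.subst₂ ℕ∣._∣_ (≡.trans (≡.cong (k ℕ.+_) (ℕ.+-identityʳ k)) (≡.sym m≡) ) (≡.sym (≡.trans d≡ (ℕ.*-comm k w)))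
            (ℕ∣.*-monoˡ-∣ k 2∣w))
          where
          -- Here J² + 1 = 3r - τˢ, and both 3 and τˢ are multiples of v.
          J = j ^ s
          r = proj₁ (cube N₂ (N⊑N₂ rτ) (N⊑N₂ rρ) (trans (+-congʳ (+-congʳ j²≈κ)) relation) f)
          rr = proj₁ (proj₂ (cube N₂ (N⊑N₂ rτ) (N⊑N₂ rρ) (trans (+-congʳ (+-congʳ j²≈κ)) relation) f))
          eq = proj₂ (proj₂ (cube N₂ (N⊑N₂ rτ) (N⊑N₂ rρ) (trans (+-congʳ (+-congʳ j²≈κ)) relation) f))
          v∙ : v ∙ N₂ ⊆ N₂
          v∙ = R-∙⊆ N₂ (N⊑N₂ v∈R)
          J²+1 : ∀ {x} → x ∈ N₂ → J * (J * x) + x ∈ v ∙ N₂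
          J²+1 {x} x∈ = resp (v ∙ N₂) x-value
            (-∈ (v ∙ N₂) (kills N₂ N⊑N₂ rj (Div-refl N₂ v) (rr x∈)) (∙-in v N₂ (rc x∈)))
            where
            open ≈R
            x-value : three * (r * x) - v * (c * x) ≈ J * (J * x) + x
            x-value = begin
              three * (r * x) - v * (c * x)                  ≈⟨ solve 5 (λ t r x v c → t :* (r :* x) :- v :* (c :* x) := (t :* r :- c :* v) :* x) refl three r x v c ⟩
              (three * r - c * v) * x                        ≈⟨ *-congʳ (+-cong (sym eq) (-‿cong (sym τˢ≈))) ⟩
              ((j * j) ^ s + 1# + τ ^ s - τ ^ s) * x         ≈⟨ *-congʳ (solve 2 (λ a t → a :+ t :- t := a) refl ((j * j) ^ s + 1#) (τ ^ s)) ⟩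
              ((j * j) ^ s + 1#) * x                         ≈⟨ trans (distribʳ x ((j * j) ^ s) 1#) (+-cong (trans (*-congʳ (^-distrib-* j j s)) (*-assoc J J x)) (*-identityˡ x)) ⟩
              J * (J * x) + x                                ∎
          2∣w : 2 ℕ∣.∣ w
          2∣w = Dim-even J w {N₂} {v ∙ N₂} v∙ (kills N₂ N⊑N₂ rj (Div-refl N₂ v)) (R-^ N₂ rj s) (R-∙ v N₂ (R-^ N₂ rj s)) J²+1 N₂/v
        nilpotent-or-unit N₂ comm₂ N⊑N₂ rj (inj₂ τˢ∣v) w {d} N₂/v d≡ N₂/ =
          Dim-exists {N₂} {τ ∙ N₂} (R-∙⊆ N₂ (N⊑N₂ rτ)) (kills N₂ N⊑N₂ rj τ∣v) >>= λ { (e , _ , N₂/τ) →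
          Dim-exists {τ ^ s ∙ N₂} {v ∙ N₂} v∙⊆ (λ x∈ → kills N₂ N⊑N₂ rj (Div-refl N₂ v) (R-∙⊆ N₂ (R-^ N₂ (N⊑N₂ rτ) s) x∈)) >>= λ { (g , _ , τˢ/v) →
          -- The dimension of N₂/vN₂ is counted afresh for the sake of the bound `w′ < f`, which `w`
          -- does not come with.
          Dim-exists {N₂} {v ∙ N₂} v∙ (kills N₂ N⊑N₂ rj (Div-refl N₂ v)) >>= λ { (w′ , w′<f , N₂/v′) →
          finish e N₂/τ w′ w′<f (Dim-unique w′ (g ℕ.+ s ℕ.* e) {N₂} {v ∙ N₂} v∙ (kills N₂ N⊑N₂ rj (Div-refl N₂ v)) N₂/v′
            (Dim-+ (s ℕ.* e) g v∙⊆ (R-∙⊆ N₂ (R-^ N₂ (N⊑N₂ rτ) s)) (Dim-powers N₂ τ≉0 (N⊑N₂ rτ) N₂/τ s) τˢ/v)) }}}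
          where
          v∙ : v ∙ N₂ ⊆ N₂
          v∙ = R-∙⊆ N₂ (N⊑N₂ v∈R)
          1≤s : 1 ℕ.≤ s
          1≤s = ℕ.≤-trans (s≤s z≤n) (n<3^n f)
          τ∣v : Div N₂ τ v
          τ∣v = Div-trans N₂ (Div-power N₂ (N⊑N₂ rτ) s 1≤s) τˢ∣v
          v∙⊆ : v ∙ N₂ ⊆ τ ^ s ∙ N₂
          v∙⊆ mem = mem >>= λ { (x , x∈ , e) → let c , rc , v≈ = τˢ∣v in
            return (c * x , rc x∈ , trans e (trans (*-congʳ v≈) (solve 3 (λ c t x → c :* t :* x := t :* (c :* x)) refl c (τ ^ s) x))) }
          τ≉0 : ¬ τ ≈ 0#
          τ≉0 = τ^≉0⇒τ≉0 s 1≤s λ τˢ≈0 → v≉0 (let c , _ , v≈ = τˢ∣v in trans v≈ (trans (*-congˡ τˢ≈0) (zeroʳ c)))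
          finish : ∀ e → Dim N₂ (τ ∙ N₂) e → ∀ w′ → w′ ℕ.< f → ∀ {g} → w′ ≡ g ℕ.+ s ℕ.* e → DN (m ℕ∣.∣ d)
          finish (suc e) _ w′ w′<f {g} w′≡ = ⊥-elim (ℕ.<-irrefl ≡.refl (ℕ.<-≤-trans (ℕ.<-trans w′<f (n<3^n f))
            (ℕ.≤-trans (ℕ.m≤m*n s (suc e)) (ℕ.≤-trans (ℕ.m≤n+m (s ℕ.* suc e) g) (ℕ.≤-reflexive (≡.sym w′≡))))))
          finish zero N₂⊆τN₂ _ _ _ = return (rest N₂ comm₂ N⊑N₂ (proj₁ (inverse τ τ≉0))
            (λ {x} x∈ → into N₂ (N₂⊆τN₂ x∈) λ { (y , y∈ , e) → resp N₂ (sym (begin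
              proj₁ (inverse τ τ≉0) * x        ≈⟨ *-congˡ e ⟩
              proj₁ (inverse τ τ≉0) * (τ * y)  ≈⟨ solve 3 (λ i t y → i :* (t :* y) := t :* i :* y) refl (proj₁ (inverse τ τ≉0)) τ y ⟩
              τ * proj₁ (inverse τ τ≉0) * y    ≈⟨ *-congʳ (proj₂ (inverse τ τ≉0)) ⟩
              1# * y                           ≈⟨ *-identityˡ y ⟩
              y                                ∎)) y∈ })
            (proj₂ (inverse τ τ≉0)) N₂/)
            where open ≈R

-- The possible ties between the three leading terms

module LocalAnalysis (L : NumberField) (m : ℕ) (1≤m : 1 ℕ.≤ m) where
  open Ties L m 1≤m public

  Associated-⊑ : ∀ {N N′ a b} → N ⊑ N′ → Associated N a b → Associated N′ a b
  Associated-⊑ N⊑N′ as = record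
    { κ = κ ; κ⁻¹ = κ⁻¹ ; κ∈ = N⊑N′ κ∈ ; κ⁻¹∈ = N⊑N′ κ⁻¹∈ ; κκ⁻¹ = κκ⁻¹ ; b≈κa = b≈κa }
    where open Associated as

  ^m≉0⇒≉0 : ∀ {x} → ¬ x ^ m ≈ 0# → ¬ x ≈ 0#
  ^m≉0⇒≉0 {x} = go m 1≤m
    where
    go : ∀ n → 1 ℕ.≤ n → ¬ x ^ n ≈ 0# → ¬ x ≈ 0#
    go (suc n) _ xⁿ≉0 x≈0 = xⁿ≉0 (trans (*-congʳ x≈0) (zeroˡ (x ^ n)))

  *≉0ʳ : ∀ {x y} → ¬ x * y ≈ 0# → ¬ y ≈ 0#
  *≉0ʳ {x} xy≉0 y≈0 = xy≉0 (trans (*-congˡ y≈0) (zeroʳ x))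

  ^m≈0⇒≈0 : ∀ {x} → x ^ m ≈ 0# → x ≈ 0#
  ^m≈0⇒≈0 {x} e with ≈0? x
  ... | yes x≈0 = x≈0
  ... | no  x≉0 = ⊥-elim (^≉0 x≉0 m e)

  module _ {X Y Z : Carrier} where

    private
      g₁ = X ^ m
      g₂ = three * Y ^ m
      g₃ = three * three * Z ^ m

    ratio-case : ∀ N → Commensurable N → ∀ {a b} → ¬ a ^ m ≈ 0# → Associated N (three * b ^ m) (a ^ m) → Divides₃ m N
    ratio-case N comm {a} {b} aᵐ≉0 as = compare N comm a b λ N′ _ N⊑N′ cmp →
      ramified N′ (^m≉0⇒≉0 (*≉0ʳ (*≉0ʳ (λ e → aᵐ≉0 (trans b≈κa e))))) cmp (Associated-⊑ {N} {N′} N⊑N′ as)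
      where open Associated as

    case-XY : ∀ N → Commensurable N → ¬ g₁ ≈ 0# → Associated N g₂ g₁ → Divides₃ m N
    case-XY N comm = ratio-case N comm

    -- Cancelling a factor 3 turns the tie into one between Yᵐ and 3Zᵐ.
    case-YZ : ∀ N → Commensurable N → ¬ g₂ ≈ 0# → Associated N g₃ g₂ → Divides₃ m N
    case-YZ N comm g₂≉0 as = ratio-case N comm (*≉0ʳ g₂≉0) record
      { κ = κ ; κ⁻¹ = κ⁻¹ ; κ∈ = κ∈ ; κ⁻¹∈ = κ⁻¹∈ ; κκ⁻¹ = κκ⁻¹
      ; b≈κa = cancelˡ three≉0 (trans b≈κa (solve 3 (λ k t z → k :* (t :* t :* z) := t :* (k :* (t :* z))) refl κ three (Z ^ m))) }
      where open Associated as

    -- The coefficients differ by 9, so X/Z is an `m`-th root of 9 up to a unit. The multiplier τ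
    -- expresses the middle term as τ g₃; dividing the relation by g₃ gives κ + 1 + τ = 3ρ, so κ is
    -- -1 modulo 3 up to τ.
    case-XZ : ∀ N → Commensurable N → ∀ {ρ} → ¬ g₁ ≈ 0# → Associated N g₃ g₁ → Div N g₃ g₂ → R N ρ →
      g₁ + (g₂ + g₃) ≈ three * (ρ * g₃) → Divides₃ m N
    case-XZ N₀ comm₀ {ρ} g₁≉0 as₀ (τ , rτ₀ , g₂≈) rρ₀ relation = compare N₀ comm₀ X Z λ N comm N₀⊑N cmp →
      let as = Associated-⊑ {N₀} {N} N₀⊑N as₀ in parity N comm cmp as (N₀⊑N rτ₀) (N₀⊑N rρ₀) {≡.refl} (half m)
      where
      open Associated as₀ using (κ; b≈κa)
      g₃≉0 : ¬ g₃ ≈ 0#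
      g₃≉0 = *≉0ʳ (λ e → g₁≉0 (trans b≈κa e))
      Z≉0 = ^m≉0⇒≉0 (*≉0ʳ g₃≉0)
      X≉0 = ^m≉0⇒≉0 g₁≉0
      sum≈ : κ + 1# + τ ≈ three * ρ
      sum≈ = cancelˡ g₃≉0 (begin
        g₃ * (κ + 1# + τ)              ≈⟨ trans (distribˡ g₃ (κ + 1#) τ) (+-congʳ (trans (distribˡ g₃ κ 1#) (+-congˡ (*-identityʳ g₃)))) ⟩
        g₃ * κ + g₃ + g₃ * τ           ≈⟨ solve 3 (λ a b c → b :* a :+ b :+ b :* c := a :* b :+ (c :* b :+ b)) refl κ g₃ τ ⟩
        κ * g₃ + (τ * g₃ + g₃)         ≈⟨ +-cong (sym b≈κa) (+-congʳ (sym g₂≈)) ⟩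
        g₁ + (g₂ + g₃)                 ≈⟨ relation ⟩
        three * (ρ * g₃)               ≈⟨ solve 3 (λ t r g → t :* (r :* g) := g :* (t :* r)) refl three ρ g₃ ⟩
        g₃ * (three * ρ)               ∎)
        where open ≈R
      -- The implicit equation records that enlarging the ring has left κ unchanged, so that `sum≈`
      -- remains applicable.
      parity : ∀ N → Commensurable N → Div N X Z ⊎ Div N Z X → (as : Associated N g₃ g₁) → R N τ → R N ρ →
        {e : Associated.κ as ≡ κ} → ∃[ k ] (m ≡ k ℕ.+ k ⊎ m ≡ suc (k ℕ.+ k)) → Divides₃ m N
      parity N comm cmp as rτ rρ (k , inj₂ m≡) = SquareTie.odd N comm Z≉0 X≉0 cmp as k m≡
      parity N comm cmp as rτ rρ (zero , inj₁ m≡) = ⊥-elim (ℕ.<-irrefl (≡.sym m≡) 1≤m)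
      parity N comm cmp as rτ rρ {≡.refl} (suc k , inj₁ m≡) =
        -- Where τ is a unit, g₂ = τ g₃ is associated to g₃, and the tie between Y and Z settles the
        -- case.
        SquareTie.Even.even N comm Z≉0 X≉0 cmp as k m≡ rτ rρ sum≈ λ N′ comm′ N⊑N′ τ⁻¹ rτ⁻¹ ττ⁻¹ →
          case-YZ N′ comm′ (λ g₂≈0 → g₃≉0 (begin
              g₃                  ≈⟨ sym (*-identityˡ g₃) ⟩
              1# * g₃             ≈⟨ *-congʳ (sym (trans (*-comm τ⁻¹ τ) ττ⁻¹)) ⟩
              τ⁻¹ * τ * g₃        ≈⟨ trans (*-assoc τ⁻¹ τ g₃) (*-congˡ (trans (sym g₂≈) g₂≈0)) ⟩
              τ⁻¹ * 0#            ≈⟨ zeroʳ τ⁻¹ ⟩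
              0#                  ∎))
            record { κ = τ ; κ⁻¹ = τ⁻¹ ; κ∈ = N⊑N′ rτ ; κ⁻¹∈ = rτ⁻¹ ; κκ⁻¹ = ττ⁻¹ ; b≈κa = g₂≈ }
        where open ≈R

    private
      nonzeroˡ : ∀ {N a b} → Associated N a b → ¬ a ≈ 0# → ¬ b ≈ 0#
      nonzeroˡ as a≉0 b≈0 = a≉0 (trans (Associated.b≈κa (Associated-sym as)) (trans (*-congˡ b≈0) (zeroʳ _)))

    -- The relation is supplied for every `N` and `g`, since the least term is known only after the
    -- multiplier ring has been enlarged.
    divides₃ : ¬ (X ≈ 0# × Y ≈ 0# × Z ≈ 0#) →
      (∀ N g → (∀ i j k → i ℕ.+ j ℕ.+ k ≡ m → Div N g (three * three * (X ^ i * (Y ^ j * Z ^ k)))) →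
        ∃[ ρ ] R N ρ × g₁ + (g₂ + g₃) ≈ three * (ρ * g)) →
      ∀ N → Commensurable N → Divides₃ m N
    divides₃ nonzero relation N₀ comm₀ =
      compare₃ N₀ comm₀ X Y Z λ N₁ comm₁ _ leastXYZ →
      compare₃ N₁ comm₁ g₁ g₂ g₃ λ N comm N₁⊑N leastg →
      cases N comm (Least-⊑ {N₁} {N} N₁⊑N leastXYZ) leastg
      where
      monomial : ∀ N {w} → Div N w X → Div N w Y → Div N w Z → ∀ i j k → i ℕ.+ j ℕ.+ k ≡ m → Div N (w ^ m) (X ^ i * (Y ^ j * Z ^ k))
      monomial N {w} wX wY wZ i j k ≡.refl =
        let c , rc , e = Div-* N (Div-^ N wX i) (Div-* N (Div-^ N wY j) (Div-^ N wZ k)) in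
        c , rc , trans e (*-congˡ (sym (trans (^-homo-* w (i ℕ.+ j) k) (trans (*-congʳ (^-homo-* w i j)) (*-assoc (w ^ i) (w ^ j) (w ^ k))))))
      -- If w is the least of X, Y, Z, then wᵐ divides every monomial of degree `m`, and 9wᵐ is a
      -- multiple of whichever of g₁, g₂, g₃ belongs to w, hence of g.
      divides-monomials : ∀ N {g} → Least N X Y Z → Div N g g₁ → Div N g g₂ → Div N g g₃ →
        ∀ i j k → i ℕ.+ j ℕ.+ k ≡ m → Div N g (three * three * (X ^ i * (Y ^ j * Z ^ k)))
      divides-monomials N {g} (w , which , wX , wY , wZ) d₁ d₂ d₃ i j k eq = by which (monomial N wX wY wZ i j k eq)
        where
        M = X ^ i * (Y ^ j * Z ^ k)
        by : w ≡ X ⊎ w ≡ Y ⊎ w ≡ Z → Div N (w ^ m) M → Div N g (three * three * M)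
        by (inj₁ ≡.refl) d = Div-trans N d₁ (Div-trans N d (three * three , R-* N (R-ℤ N (+ 3)) (R-ℤ N (+ 3)) , refl))
        by (inj₂ (inj₁ ≡.refl)) d = Div-trans N d₂ (Div-trans N (Div-* N (Div-refl N three) d)
          (three , R-ℤ N (+ 3) , *-assoc three three M))
        by (inj₂ (inj₂ ≡.refl)) d = Div-trans N d₃ (Div-* N (Div-refl N (three * three)) d)
      nonzero-least : ∀ N {g} → Div N g g₁ → Div N g g₂ → Div N g g₃ → ¬ g ≈ 0#
      nonzero-least N d₁ d₂ d₃ g≈0 = nonzero (^m≈0⇒≈0 (vanish d₁) , ^m≈0⇒≈0 (xy≈0⇒y≈0 three≉0 (vanish d₂)) ,
        ^m≈0⇒≈0 (xy≈0⇒y≈0 three≉0 (xy≈0⇒y≈0 three≉0 (trans (sym (*-assoc three three (Z ^ m))) (vanish d₃)))))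
        where
        vanish : ∀ {b} → Div N _ b → b ≈ 0#
        vanish (c , _ , e) = trans e (trans (*-congˡ g≈0) (zeroʳ c))
      cases : ∀ N → Commensurable N → Least N X Y Z → Least N g₁ g₂ g₃ → Divides₃ m N
      cases N comm leastXYZ (g , which , d₁ , d₂ , d₃) = by which
        where
        g≉0 = nonzero-least N d₁ d₂ d₃
        ρ = proj₁ (relation N g (divides-monomials N leastXYZ d₁ d₂ d₃))
        rρ = proj₁ (proj₂ (relation N g (divides-monomials N leastXYZ d₁ d₂ d₃)))
        rel : g₁ + (g₂ + g₃) ≈ three * (ρ * g)
        rel = proj₂ (proj₂ (relation N g (divides-monomials N leastXYZ d₁ d₂ d₃)))
        swap₁₂ : ∀ a b c → b + (a + c) ≈ a + (b + c)
        swap₁₂ = solve 3 (λ a b c → b :+ (a :+ c) := a :+ (b :+ c)) refl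
        rotate : ∀ a b c → c + (a + b) ≈ a + (b + c)
        rotate = solve 3 (λ a b c → c :+ (a :+ b) := a :+ (b :+ c)) refl
        by : g ≡ g₁ ⊎ g ≡ g₂ ⊎ g ≡ g₃ → Divides₃ m N
        by (inj₁ ≡.refl) = tie N comm g≉0 d₂ d₃ rρ rel
          (λ N′ comm′ _ as → case-XY N′ comm′ g≉0 (Associated-sym as))
          (λ N′ comm′ N⊑N′ as → let open Associated (Associated-sym as) in
            case-XZ N′ comm′ {ρ * κ} g≉0 (Associated-sym as)
              (Div-trans N′ (Associated.κ (Associated-sym as) , κ∈ , b≈κa) (Div-⊑ {N} {N′} N⊑N′ d₂))
              (R-* N′ (N⊑N′ rρ) κ∈) (trans rel (*-congˡ (trans (*-congˡ b≈κa) (sym (*-assoc ρ κ g₃))))))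
        by (inj₂ (inj₁ ≡.refl)) = tie N comm g≉0 d₁ d₃ rρ (trans (swap₁₂ g₁ g₂ g₃) rel)
          (λ N′ comm′ _ as → case-XY N′ comm′ (nonzeroˡ as g≉0) as)
          (λ N′ comm′ _ as → case-YZ N′ comm′ g≉0 (Associated-sym as))
        by (inj₂ (inj₂ ≡.refl)) = tie N comm g≉0 d₁ d₂ rρ (trans (rotate g₁ g₂ g₃) rel)
          (λ N′ comm′ N⊑N′ as → case-XZ N′ comm′ {ρ} (nonzeroˡ as g≉0) as (Div-⊑ {N} {N′} N⊑N′ d₂) (N⊑N′ rρ) rel)
          (λ N′ comm′ _ as → case-YZ N′ comm′ (nonzeroˡ as g≉0) as)

-- Integers prime to 3 and the Kronecker delta

-- Non-divisibility in positive form: the witness shows that `r` is its own inverse modulo 3.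
PrimeTo3 : ℤ → Set
PrimeTo3 r = ∃[ t ] r ℤ.* r ≡ 1ℤ ℤ.+ t ℤ.* + 3

private
  square-* : ∀ r s → (r ℤ.* s) ℤ.* (r ℤ.* s) ≡ (r ℤ.* r) ℤ.* (s ℤ.* s)
  square-* r s = solve 2 (λ r s → r :* s :* (r :* s) := r :* r :* (s :* s)) ≡.refl r s
    where open ℤSolver

  product-1+3 : ∀ t u → (1ℤ ℤ.+ t ℤ.* + 3) ℤ.* (1ℤ ℤ.+ u ℤ.* + 3) ≡ 1ℤ ℤ.+ (t ℤ.+ u ℤ.+ t ℤ.* u ℤ.* + 3) ℤ.* + 3
  product-1+3 = solve 2 (λ t u → (con 1ℤ :+ t :* con (+ 3)) :* (con 1ℤ :+ u :* con (+ 3)) := con 1ℤ :+ (t :+ u :+ t :* u :* con (+ 3)) :* con (+ 3)) ≡.refl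
    where open ℤSolver

PrimeTo3-* : ∀ {r s} → PrimeTo3 r → PrimeTo3 s → PrimeTo3 (r ℤ.* s)
PrimeTo3-* {r} {s} (t , r²≡) (u , s²≡) = t ℤ.+ u ℤ.+ t ℤ.* u ℤ.* + 3 , ≡.trans (square-* r s) (≡.trans (≡.cong₂ ℤ._*_ r²≡ s²≡) (product-1+3 t u))

PrimeTo3-1 : PrimeTo3 1ℤ
PrimeTo3-1 = 0ℤ , ≡.refl

PrimeTo3⇒3∤ : ∀ {r} → PrimeTo3 r → ¬ (+ 3) ℤ∣.∣ r
PrimeTo3⇒3∤ {r} (t , r²≡) 3∣r = 3∤1 (ℤ∣.∣m+n∣n⇒∣m {n = t ℤ.* + 3} (≡.subst ((+ 3) ℤ∣.∣_) r²≡ (ℤ∣.∣m⇒∣m*n r 3∣r)) (divides t ≡.refl))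
  where
  3∤1 : ¬ (+ 3) ℤ∣.∣ 1ℤ
  3∤1 3∣1 with ℕ∣.∣1⇒≡1 (ℤ∣.∣⇒∣ᵤ 3∣1)
  ... | ()

3∤⇒PrimeTo3 : ∀ {r} → ¬ (+ 3) ℤ∣.∣ r → PrimeTo3 r
3∤⇒PrimeTo3 {r} 3∤r with 3∤⇒square r
... | inj₁ (t , r≡) = ⊥-elim (3∤r (divides t r≡))
... | inj₂ p        = p

δ : ∀ {n} → Fin n → Fin n → ℤ
δ zero    zero    = 1ℤ
δ zero    (suc _) = 0ℤ
δ (suc _) zero    = 0ℤ
δ (suc i) (suc j) = δ i j

δ-diagonal : ∀ {n} (i : Fin n) → δ i i ≡ 1ℤ
δ-diagonal zero    = ≡.refl
δ-diagonal (suc i) = δ-diagonal i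

δ-off-diagonal : ∀ {n} {i j : Fin n} → i ≢ j → δ i j ≡ 0ℤ
δ-off-diagonal {i = zero}  {zero}  i≢j = ⊥-elim (i≢j ≡.refl)
δ-off-diagonal {i = zero}  {suc j} i≢j = ≡.refl
δ-off-diagonal {i = suc i} {zero}  i≢j = ≡.refl
δ-off-diagonal {i = suc i} {suc j} i≢j = δ-off-diagonal (i≢j ∘ ≡.cong suc)

-- The lattice from which the local analysis starts

module IntegralLattice (L : NumberField) where
  open Charts L public
  open NumberField L using (sum)

  combination : ∀ {n} → (Fin n → ℤ) → (Fin n → Carrier) → Carrier
  combination z a = sum (λ i → ιℤ (z i) * a i)

  ιℤ-sum : ∀ {n} (z : Fin n → ℤ) → ιℤ (ℤΣ.sum z) ≈ sum (ιℤ ∘ z)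
  ιℤ-sum {zero}  z = ι-0
  ιℤ-sum {suc n} z = trans (ιℤ-+ (z zero) (ℤΣ.sum (z ∘ suc))) (+-congˡ (ιℤ-sum (z ∘ suc)))

  combination-+ : ∀ {n} (y z : Fin n → ℤ) a → combination (λ i → y i ℤ.+ z i) a ≈ combination y a + combination z a
  combination-+ y z a = trans (sum-cong λ i → trans (*-congʳ (ιℤ-+ (y i) (z i))) (distribʳ (a i) (ιℤ (y i)) (ιℤ (z i))))
    (Σ′.∑-distrib-+ (λ i → ιℤ (y i) * a i) (λ i → ιℤ (z i) * a i))

  combination-* : ∀ {n} k (z : Fin n → ℤ) a → combination (λ i → k ℤ.* z i) a ≈ ιℤ k * combination z a
  combination-* k z a = trans (sum-cong λ i → trans (*-congʳ (ιℤ-* k (z i))) (*-assoc (ιℤ k) (ιℤ (z i)) (a i)))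
    (sym (*-sum (ιℤ k) (λ i → ιℤ (z i) * a i)))

  combination-neg : ∀ {n} (z : Fin n → ℤ) a → combination (λ i → ℤ.- z i) a ≈ - combination z a
  combination-neg z a = trans (sum-cong λ i → *-congʳ (ιℤ-cong (≡.sym (ℤ.-1*i≡-i (z i)))))
    (trans (combination-* (ℤ.-1ℤ) z a) (trans (*-congʳ (trans (ιℤ-neg 1ℤ) (-‿cong ι-1))) (trans (sym (-‿distribˡ-* 1# _)) (-‿cong (*-identityˡ _)))))

  combination-δ : ∀ {n} (i : Fin n) a → combination (δ i) a ≈ a i
  combination-δ zero    a = trans (+-cong (trans (*-congʳ ι-1) (*-identityˡ (a zero))) (sum-0 λ j → trans (*-congʳ ι-0) (zeroˡ (a (suc j))))) (+-identityʳ (a zero))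
  combination-δ (suc i) a = trans (+-cong (trans (*-congʳ ι-0) (zeroˡ (a zero))) (combination-δ i (a ∘ suc))) (+-identityˡ (a (suc i)))

  combination-injective : ∀ (y z : Fin degree → ℤ) → combination y basis ≈ combination z basis → ∀ i → y i ≡ z i
  combination-injective y z e i = fromℤ-injective (ℤ-0 (independent (λ i → fromℤ (y i ℤ.- z i)) (begin
    combination (λ i → y i ℤ.- z i) basis                     ≈⟨ combination-+ y (λ i → ℤ.- z i) basis ⟩
    combination y basis + combination (λ i → ℤ.- z i) basis   ≈⟨ +-cong e (combination-neg z basis) ⟩
    combination z basis - combination z basis                 ≈⟨ -‿inverseʳ _ ⟩
    0#                                                        ∎) i))
    where
    open ≈R
    ℤ-0 : fromℤ (y i ℤ.- z i) ≡ fromℤ 0ℤ → fromℤ (y i) ≡ fromℤ (z i)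
    ℤ-0 e = ≡.cong fromℤ (ℤ.i-j≡0⇒i≡j (y i) (z i) (fromℤ-injective e))

  -- The ℤ₍₃₎-span of the basis, with coordinates divisible by 3 from position k on
  Λ : ℕ → Subgroup
  Λ k = record
    { mem    = λ x → DN (Coordinates x)
    ; resp   = λ x≈y m → m >>= λ { (r , p , z , e , d) → return (r , p , z , trans (*-congˡ (sym x≈y)) e , d) }
    ; 0∈     = return (1ℤ , PrimeTo3-1 , (λ _ → 0ℤ) , trans (zeroʳ (ιℤ 1ℤ)) (sym (sum-0 λ i → trans (*-congʳ ι-0) (zeroˡ (basis i)))) , λ _ _ → divides 0ℤ ≡.refl)
    ; +∈     = λ {x} {y} m m′ → m >>= λ { (r , p , z , e , d) → m′ >>= λ { (r′ , p′ , z′ , e′ , d′) →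
        return (r ℤ.* r′ , PrimeTo3-* {r} {r′} p p′ , (λ i → r′ ℤ.* z i ℤ.+ r ℤ.* z′ i) , (begin
          ιℤ (r ℤ.* r′) * (x + y)                   ≈⟨ *-congʳ (ιℤ-* r r′) ⟩
          ιℤ r * ιℤ r′ * (x + y)                    ≈⟨ solve 4 (λ r s x y → r :* s :* (x :+ y) := s :* (r :* x) :+ r :* (s :* y)) refl (ιℤ r) (ιℤ r′) x y ⟩
          ιℤ r′ * (ιℤ r * x) + ιℤ r * (ιℤ r′ * y)   ≈⟨ +-cong (trans (*-congˡ e) (sym (combination-* r′ z basis))) (trans (*-congˡ e′) (sym (combination-* r z′ basis))) ⟩
          combination (λ i → r′ ℤ.* z i) basis + combination (λ i → r ℤ.* z′ i) basis   ≈⟨ sym (combination-+ (λ i → r′ ℤ.* z i) (λ i → r ℤ.* z′ i) basis) ⟩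
          combination (λ i → r′ ℤ.* z i ℤ.+ r ℤ.* z′ i) basis ∎) ,
          λ i k≤i → ℤ∣.∣m∣n⇒∣m+n (ℤ∣.∣n⇒∣m*n r′ (d i k≤i)) (ℤ∣.∣n⇒∣m*n r (d′ i k≤i))) }}
    ; neg∈   = λ {x} m → m >>= λ { (r , p , z , e , d) → return (r , p , (λ i → ℤ.- z i) ,
        trans (sym (-‿distribʳ-* (ιℤ r) x)) (trans (-‿cong e) (sym (combination-neg z basis))) , λ i k≤i → ℤ∣.∣m⇒∣-m (d i k≤i)) }
    ; stable = λ m → m >>= id
    }
    where
    open ≈R
    Coordinates : Carrier → Set
    Coordinates x = ∃[ r ] PrimeTo3 r × Σ (Fin degree → ℤ) λ z → ιℤ r * x ≈ combination z basis × (∀ i → k ℕ.≤ toℕ i → (+ 3) ℤ∣.∣ z i)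

  Λ-mono : ∀ {k l} → k ℕ.≤ l → Λ k ⊆ Λ l
  Λ-mono k≤l m = m >>= λ { (r , p , z , e , d) → return (r , p , z , e , λ i l≤i → d i (ℕ.≤-trans k≤l l≤i)) }

  Λ-3 : ∀ k l → ThreeKills (Λ k) (Λ l)
  Λ-3 k l {x} m = m >>= λ { (r , p , z , e , _) → return (r , p , (λ i → + 3 ℤ.* z i) ,
    trans (solve 3 (λ r t x → r :* (t :* x) := t :* (r :* x)) refl (ιℤ r) three x) (trans (*-congˡ e) (sym (combination-* (+ 3) z basis))) ,
    λ i _ → ℤ∣.∣m⇒∣m*n (z i) ℤ∣.∣-refl) }

  Λ-step : ∀ i → Dim (Λ (suc (toℕ i))) (Λ (toℕ i)) 1
  Λ-step i = basis i , eᵢ∈ , eᵢ∉ , λ {x} m → m >>= λ { (r , p@(t , r²≡) , z , e , d) →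
    -- The multiple c of `basis i` to be subtracted must satisfy rc ≡ z i modulo 3, and c = r · z i
    -- does because r² ≡ 1.
    return (r ℤ.* z i , return (r , p , (λ j → z j ℤ.- r ℤ.* (r ℤ.* z i) ℤ.* δ i j) , coordinates r z e , divisible r t r²≡ z d)) }
    where
    open ≈R
    eᵢ∈ : basis i ∈ Λ (suc (toℕ i))
    eᵢ∈ = return (1ℤ , PrimeTo3-1 , δ i , trans (*-congʳ ι-1) (trans (*-identityˡ (basis i)) (sym (combination-δ i basis))) ,
      λ j i<j → divides 0ℤ (δ-off-diagonal {i = i} {j} (λ { ≡.refl → ℕ.<-irrefl ≡.refl i<j })))
    eᵢ∉ : basis i ∉ Λ (toℕ i)
    eᵢ∉ m = m λ { (r , p , z , e , d) → PrimeTo3⇒3∤ {r} p (≡.subst ((+ 3) ℤ∣.∣_)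
      (≡.trans (combination-injective z (λ j → r ℤ.* δ i j) (trans (sym e) (trans (*-congˡ (sym (combination-δ i basis))) (sym (combination-* r (δ i) basis)))) i)
        (≡.trans (≡.cong (r ℤ.*_) (δ-diagonal i)) (ℤ.*-identityʳ r))) (d i ℕ.≤-refl)) }
    coordinates : ∀ {x} r z → ιℤ r * x ≈ combination z basis →
      ιℤ r * (x - ιℤ (r ℤ.* z i) * basis i) ≈ combination (λ j → z j ℤ.- r ℤ.* (r ℤ.* z i) ℤ.* δ i j) basis
    coordinates {x} r z e = begin
      ιℤ r * (x - ιℤ c * basis i)                          ≈⟨ solve 4 (λ r x c b → r :* (x :- c :* b) := r :* x :- r :* c :* b) refl (ιℤ r) x (ιℤ c) (basis i) ⟩
      ιℤ r * x - ιℤ r * ιℤ c * basis i                     ≈⟨ +-cong e (-‿cong (*-cong (sym (ιℤ-* r c)) (sym (combination-δ i basis)))) ⟩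
      combination z basis - ιℤ (r ℤ.* c) * combination (δ i) basis   ≈⟨ +-congˡ (-‿cong (sym (combination-* (r ℤ.* c) (δ i) basis))) ⟩
      combination z basis - combination (λ j → r ℤ.* c ℤ.* δ i j) basis   ≈⟨ +-congˡ (sym (combination-neg (λ j → r ℤ.* c ℤ.* δ i j) basis)) ⟩
      combination z basis + combination (λ j → ℤ.- (r ℤ.* c ℤ.* δ i j)) basis   ≈⟨ sym (combination-+ z (λ j → ℤ.- (r ℤ.* c ℤ.* δ i j)) basis) ⟩
      combination (λ j → z j ℤ.- r ℤ.* c ℤ.* δ i j) basis  ∎
      where c = r ℤ.* z i
    divisible : ∀ r t → r ℤ.* r ≡ 1ℤ ℤ.+ t ℤ.* + 3 → (z : Fin degree → ℤ) → (∀ j → suc (toℕ i) ℕ.≤ toℕ j → (+ 3) ℤ∣.∣ z j) →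
      ∀ j → toℕ i ℕ.≤ toℕ j → (+ 3) ℤ∣.∣ z j ℤ.- r ℤ.* (r ℤ.* z i) ℤ.* δ i j
    divisible r t r²≡ z d j i≤j with i Fin.≟ j
    ... | yes ≡.refl = divides (ℤ.- (t ℤ.* z i))
        (≡.trans (≡.cong (λ w → z i ℤ.- r ℤ.* (r ℤ.* z i) ℤ.* w) (δ-diagonal i))
        (≡.trans (≡.cong (λ w → z i ℤ.- w) (≡.trans (ℤ.*-identityʳ (r ℤ.* (r ℤ.* z i))) (≡.sym (ℤ.*-assoc r r (z i)))))
        (≡.trans (≡.cong (λ w → z i ℤ.- w ℤ.* z i) r²≡) (simplify (z i) t))))
      where
      simplify : ∀ z t → z ℤ.- (1ℤ ℤ.+ t ℤ.* + 3) ℤ.* z ≡ ℤ.- (t ℤ.* z) ℤ.* + 3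
      simplify = ℤSolver.solve 2 (λ z t → z ℤSolver.:- (ℤSolver.con 1ℤ ℤSolver.:+ t ℤSolver.:* ℤSolver.con (+ 3)) ℤSolver.:* z ℤSolver.:= ℤSolver.:- (t ℤSolver.:* z) ℤSolver.:* ℤSolver.con (+ 3)) ≡.refl
    ... | no i≢j = ℤ∣.∣m∣n⇒∣m+n (d j (ℕ.≤∧≢⇒< i≤j (i≢j ∘ Fin.toℕ-injective)))
        (divides 0ℤ (≡.cong ℤ.-_ (≡.trans (≡.cong (r ℤ.* (r ℤ.* z i) ℤ.*_) (δ-off-diagonal i≢j)) (ℤ.*-zeroʳ (r ℤ.* (r ℤ.* z i))))))

  Dim-Λ : ∀ k → k ℕ.≤ degree → Dim (Λ k) (Λ 0) k
  Dim-Λ zero    _   = id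
  Dim-Λ (suc k) k<n = Dim-cong-suc (Dim-+ 1 k {Λ (suc k)} {Λ k} {Λ 0} (Λ-mono z≤n) (Λ-mono (ℕ.n≤1+n k)) step (Dim-Λ k (ℕ.≤-trans (ℕ.n≤1+n k) k<n)))
    where
    step : Dim (Λ (suc k)) (Λ k) 1
    step = ≡.subst (λ i → Dim (Λ (suc i)) (Λ i) 1) (Fin.toℕ-fromℕ< k<n) (Λ-step (fromℕ< k<n))
    Dim-cong-suc : Dim (Λ (suc k)) (Λ 0) (k ℕ.+ 1) → Dim (Λ (suc k)) (Λ 0) (suc k)
    Dim-cong-suc = ≡.subst (Dim (Λ (suc k)) (Λ 0)) (ℕ.+-comm k 1)

  -- The subgroups `Λ k` form a flag from `Λ 0`, which is 3 times the whole lattice, up to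
  -- `Λ degree`, where no divisibility is imposed.
  Dim₃-Λ : Dim₃ (Λ degree) degree
  Dim₃-Λ = Dim-cong degree id id Λ0⊆ ⊆Λ0 (Dim-Λ degree ℕ.≤-refl)
    where
    ⊆Λ0 : three ∙ Λ degree ⊆ Λ 0
    ⊆Λ0 m = into (Λ 0) m λ { (x , x∈ , e) → resp (Λ 0) (sym e) (Λ-3 degree 0 x∈) }
    third = proj₁ (inverse three three≉0)
    Λ0⊆ : Λ 0 ⊆ three ∙ Λ degree
    Λ0⊆ {x} m = m >>= λ { (r , p , z , e , d) →
      let z′ = λ i → ℤ∣._∣_.quotient (d i z≤n) in
      return (third * x , return (r , p , z′ , cancelˡ three≉0 (begin
        three * (ιℤ r * (third * x))      ≈⟨ solve 4 (λ t r i x → t :* (r :* (i :* x)) := t :* i :* (r :* x)) refl three (ιℤ r) third x ⟩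
        three * third * (ιℤ r * x)        ≈⟨ trans (*-congʳ (proj₂ (inverse three three≉0))) (*-identityˡ _) ⟩
        ιℤ r * x                          ≈⟨ e ⟩
        combination z basis               ≈⟨ sum-cong (λ i → *-congʳ (ιℤ-cong (≡.trans (ℤ∣._∣_.equality (d i z≤n)) (ℤ.*-comm (z′ i) (+ 3))))) ⟩
        combination (λ i → + 3 ℤ.* z′ i) basis   ≈⟨ combination-* (+ 3) z′ basis ⟩
        three * combination z′ basis      ∎) , λ i n≤i → ⊥-elim (ℕ.<-irrefl ≡.refl (ℕ.<-≤-trans (Fin.toℕ<n i) n≤i))) ,
        sym (trans (sym (*-assoc three third x)) (trans (*-congʳ (proj₂ (inverse three three≉0))) (*-identityˡ x)))) }
      where open ≈R

  -- Multiplication by x has a matrix over ℚ with a common denominator D = 3ᵉr, where r is prime to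
  -- 3. The lattice is taken over ℤ₍₃₎ so that r is absorbed and the power 3ᵉ suffices.
  Λ-commensurable : Commensurable (Λ degree)
  Λ-commensurable x
    with common-denominator {degree ℕ.* degree} (λ k → let j , i = remQuot degree k in proj₁ (spanning (x * basis j)) i)
  ... | D , D≢0 , w , Dq≡w with strip-3 {1} (λ _ → D) zero D≢0
  ... | r , (e , D≡) , (zero , 3∤r) = e , λ {y} m → m >>= λ { (s , p , z , sy≈ , _) →
      return (r zero ℤ.* s , PrimeTo3-* {r zero} {s} (3∤⇒PrimeTo3 3∤r) p , (λ i → ℤΣ.sum (λ j → z j ℤ.* w′ j i)) , (begin
        ιℤ (r zero ℤ.* s) * (three ^ e * x * y)            ≈⟨ *-congʳ (ιℤ-* (r zero) s) ⟩
        ιℤ (r zero) * ιℤ s * (three ^ e * x * y)           ≈⟨ solve 5 (λ r s t x y → r :* s :* (t :* x :* y) := t :* r :* x :* (s :* y)) refl (ιℤ (r zero)) (ιℤ s) (three ^ e) x y ⟩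
        three ^ e * ιℤ (r zero) * x * (ιℤ s * y)           ≈⟨ *-cong (*-congʳ D≈) sy≈ ⟩
        ιℤ D * x * combination z basis                     ≈⟨ *-sum (ιℤ D * x) (λ j → ιℤ (z j) * basis j) ⟩
        sum (λ j → ιℤ D * x * (ιℤ (z j) * basis j))        ≈⟨ sum-cong (λ j → trans (solve 4 (λ d x z b → d :* x :* (z :* b) := z :* (d :* (x :* b))) refl (ιℤ D) x (ιℤ (z j)) (basis j))
                                                                (trans (*-congˡ (product j)) (sym (combination-* (z j) (w′ j) basis)))) ⟩
        sum (λ j → combination (λ i → z j ℤ.* w′ j i) basis)   ≈⟨ Σ′.∑-comm (λ j i → ιℤ (z j ℤ.* w′ j i) * basis i) ⟩
        sum (λ i → sum (λ j → ιℤ (z j ℤ.* w′ j i) * basis i))  ≈⟨ sum-cong (λ i → trans (sym (Σ′.*-distribʳ-sum (basis i) (λ j → ιℤ (z j ℤ.* w′ j i)))) (*-congʳ (sym (ιℤ-sum (λ j → z j ℤ.* w′ j i))))) ⟩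
        combination (λ i → ℤΣ.sum (λ j → z j ℤ.* w′ j i)) basis ∎) ,
        λ i n≤i → ⊥-elim (ℕ.<-irrefl ≡.refl (ℕ.<-≤-trans (Fin.toℕ<n i) n≤i))) }
    where
    open ≈R
    w′ : Fin degree → Fin degree → ℤ
    w′ j i = w (combine j i)
    q : Fin degree → Fin degree → ℚ
    q j i = proj₁ (spanning (x * basis j)) i
    ιℤ-^ : ∀ e → ιℤ ((+ 3) ℤ.^ e) ≈ three ^ e
    ιℤ-^ zero    = ι-1
    ιℤ-^ (suc e) = trans (ιℤ-* (+ 3) ((+ 3) ℤ.^ e)) (*-congˡ (ιℤ-^ e))
    D≈ : three ^ e * ιℤ (r zero) ≈ ιℤ D
    D≈ = trans (*-congʳ (sym (ιℤ-^ e))) (trans (sym (ιℤ-* ((+ 3) ℤ.^ e) (r zero))) (ιℤ-cong (≡.sym (D≡ zero))))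
    Dq≡w′ : ∀ j i → fromℤ D ℚ.* q j i ≡ fromℤ (w′ j i)
    Dq≡w′ j i = ≡.trans (≡.cong (λ p → fromℤ D ℚ.* uncurry q p) (≡.sym (Fin.remQuot-combine j i))) (Dq≡w (combine j i))
    product : ∀ j → ιℤ D * (x * basis j) ≈ combination (w′ j) basis
    product j = begin
      ιℤ D * (x * basis j)                              ≈⟨ *-congˡ (proj₂ (spanning (x * basis j))) ⟩
      ιℤ D * sum (λ i → ι (q j i) * basis i)            ≈⟨ *-sum (ιℤ D) (λ i → ι (q j i) * basis i) ⟩
      sum (λ i → ιℤ D * (ι (q j i) * basis i))          ≈⟨ sum-cong (λ i → trans (sym (*-assoc (ιℤ D) (ι (q j i)) (basis i)))
                                                             (*-congʳ (trans (sym (ι-* (fromℤ D) (q j i))) (ι-cong (Dq≡w′ j i))))) ⟩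
      combination (w′ j) basis                          ∎

-- The congruence modulo 27 and the degrees of points

-- The coefficient of xⁱyʲ in xᵐ + 3yᵐ + 9.
target : ℕ → ℕ → ℕ → ℤ
target m zero    zero    = + 9
target m zero    (suc j) = if suc j ≡ᵇ m then + 3 else 0ℤ
target m (suc i) zero    = if suc i ≡ᵇ m then 1ℤ else 0ℤ
target m (suc i) (suc j) = 0ℤ

CongruentToTarget : ℕ → ℤ[x,y] → Set
CongruentToTarget m f = ∀ i j → i ℕ.+ j ℕ.≤ m → ∃[ c ] coeff f i j ≡ target m i j ℤ.+ c ℤ.* + 27

T⇒≡true : ∀ {b} → T b → b ≡ true
T⇒≡true {true} _ = ≡.refl

≢⇒≡ᵇfalse : ∀ i j → i ≢ j → (i ≡ᵇ j) ≡ false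
≢⇒≡ᵇfalse i j i≢j with i ≡ᵇ j in eq
... | false = ≡.refl
... | true  = ⊥-elim (i≢j (ℕ.≡ᵇ⇒≡ i j (≡.subst T (≡.sym eq) _)))

≡⇒≡ᵇtrue : ∀ {i j} → i ≡ j → (i ≡ᵇ j) ≡ true
≡⇒≡ᵇtrue {i} {j} e = T⇒≡true (ℕ.≡⇒≡ᵇ i j e)

target-x : ∀ m → target (suc m) (suc m) 0 ≡ 1ℤ
target-x m = ≡.cong (if_then 1ℤ else 0ℤ) (≡⇒≡ᵇtrue {m} ≡.refl)

target-y : ∀ m → target (suc m) 0 (suc m) ≡ + 3
target-y m = ≡.cong (if_then + 3 else 0ℤ) (≡⇒≡ᵇtrue {m} ≡.refl)

target-0 : ∀ m i j → (i ≢ 0 ⊎ j ≢ 0) → (i ≢ m ⊎ j ≢ 0) → (i ≢ 0 ⊎ j ≢ m) → target m i j ≡ 0ℤ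
target-0 m zero    zero    (inj₁ i≢0) _ _ = ⊥-elim (i≢0 ≡.refl)
target-0 m zero    zero    (inj₂ j≢0) _ _ = ⊥-elim (j≢0 ≡.refl)
target-0 m zero    (suc j) _ _ (inj₁ i≢0) = ⊥-elim (i≢0 ≡.refl)
target-0 m zero    (suc j) _ _ (inj₂ j≢m) = ≡.cong (if_then + 3 else 0ℤ) (≢⇒≡ᵇfalse (suc j) m j≢m)
target-0 m (suc i) zero    _ (inj₁ i≢m) _ = ≡.cong (if_then 1ℤ else 0ℤ) (≢⇒≡ᵇfalse (suc i) m i≢m)
target-0 m (suc i) zero    _ (inj₂ j≢0) _ = ⊥-elim (j≢0 ≡.refl)
target-0 m (suc i) (suc j) _ _ _ = ≡.refl

homogenize-coeff : ∀ m f i j k → i ℕ.+ j ℕ.+ k ≡ m → homogenize m f (i , j , k) ≡ coeff f i j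
homogenize-coeff m f i j k e = ≡.cong (if_then coeff f i j else 0ℤ) (≡⇒≡ᵇtrue {i ℕ.+ j ℕ.+ k} e)

total : ∀ {m i j} → i ℕ.≤ m → j ℕ.≤ m ∸ i → i ℕ.+ j ℕ.+ (m ∸ i ∸ j) ≡ m
total {m} {i} {j} i≤m j≤ = ≡.trans (ℕ.+-assoc i j (m ∸ i ∸ j)) (≡.trans (≡.cong (i ℕ.+_) (ℕ.m+[n∸m]≡n j≤)) (ℕ.m+[n∸m]≡n i≤m))

module SingleTerm (L : NumberField) where
  open Field L public
  open NumberField L using (sum)

  sum-single : ∀ {n} (i : Fin n) (t : Fin n → Carrier) → (∀ j → j ≢ i → t j ≈ 0#) → sum t ≈ t i
  sum-single zero    t off = trans (+-congˡ (sum-0 λ j → off (suc j) λ ())) (+-identityʳ (t zero))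
  sum-single (suc i) t off = trans (+-cong (off zero λ ()) (sum-single i (t ∘ suc) λ j j≢i → off (suc j) (j≢i ∘ Fin.suc-injective))) (+-identityˡ (t (suc i)))

  sum-pair : ∀ {n} (i : Fin n) (t : Fin (suc n) → Carrier) → (∀ j → j ≢ i → t (suc j) ≈ 0#) → sum t ≈ t zero + t (suc i)
  sum-pair i t off = +-congˡ (sum-single i (t ∘ suc) off)

module DegreeDivides (L : NumberField) (m′ : ℕ) (f : ℤ[x,y]) (f≡ : CongruentToTarget (suc m′) f) (P : ProjectivePoint L)
  (on-curve : OnCurve L (suc m′) (homogenize (suc m′) f) P) where

  private m = suc m′
  open LocalAnalysis L m (s≤s z≤n)
  open SingleTerm L using (sum-single; sum-pair)
  open NumberField L using (sum)
  open ProjectivePoint P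

  monomial : ℕ → ℕ → ℕ → Carrier
  monomial i j k = X ^ i * (Y ^ j * Z ^ k)

  degree-z : Fin (suc m) → ℕ → ℕ
  degree-z i j = m ∸ toℕ i ∸ j

  double-sum : ((i : Fin (suc m)) → Fin (suc (m ∸ toℕ i)) → Carrier) → Carrier
  double-sum t = sum λ i → sum λ j → t i j

  quotient : (i : Fin (suc m)) → Fin (suc (m ∸ toℕ i)) → ℤ
  quotient i j = proj₁ (f≡ (toℕ i) (toℕ j) (bounded i j))
    where
    bounded : ∀ i j → toℕ i ℕ.+ toℕ j ℕ.≤ m
    bounded i j = ℕ.≤-trans (ℕ.+-monoʳ-≤ (toℕ i) (ℕ.≤-pred (Fin.toℕ<n j))) (ℕ.≤-reflexive (ℕ.m+[n∸m]≡n (ℕ.≤-pred (Fin.toℕ<n i))))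

  exponents : (i : Fin (suc m)) (j : Fin (suc (m ∸ toℕ i))) → toℕ i ℕ.+ toℕ j ℕ.+ degree-z i (toℕ j) ≡ m
  exponents i j = total (ℕ.≤-pred (Fin.toℕ<n i)) (ℕ.≤-pred (Fin.toℕ<n j))

  main-term error-term : (i : Fin (suc m)) → Fin (suc (m ∸ toℕ i)) → Carrier
  main-term  i j = ιℤ (target m (toℕ i) (toℕ j)) * monomial (toℕ i) (toℕ j) (degree-z i (toℕ j))
  error-term i j = ιℤ (quotient i j ℤ.* + 27) * monomial (toℕ i) (toℕ j) (degree-z i (toℕ j))

  evaluate≈ : double-sum main-term + double-sum error-term ≈ 0#
  evaluate≈ = trans (sym (trans (sum-cong λ i → trans (sum-cong λ j → split i j) (Σ′.∑-distrib-+ (main-term i) (error-term i)))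
    (Σ′.∑-distrib-+ (λ i → sum (main-term i)) (λ i → sum (error-term i))))) on-curve
    where
    split : ∀ i j → ιℤ (homogenize m f (toℕ i , toℕ j , degree-z i (toℕ j))) * monomial (toℕ i) (toℕ j) (degree-z i (toℕ j)) ≈ main-term i j + error-term i j
    split i j = trans (*-congʳ (trans (ιℤ-cong (≡.trans (homogenize-coeff m f (toℕ i) (toℕ j) _ (exponents i j)) (proj₂ (f≡ (toℕ i) (toℕ j) _))))
      (ιℤ-+ (target m (toℕ i) (toℕ j)) (quotient i j ℤ.* + 27)))) (distribʳ _ _ _)

  private
    g₁ = X ^ m
    g₂ = three * Y ^ m
    g₃ = three * three * Z ^ m

  zero-term : ∀ i j → target m (toℕ i) (toℕ j) ≡ 0ℤ → main-term i j ≈ 0#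
  zero-term i j e = trans (*-congʳ (trans (ιℤ-cong e) ι-0)) (zeroˡ _)

  main-sum : double-sum main-term ≈ g₁ + (g₂ + g₃)
  main-sum = begin
    double-sum main-term                     ≈⟨ sum-pair (fromℕ m′) (λ i → sum (main-term i)) middle ⟩
    sum (main-term zero) + sum (main-term (suc (fromℕ m′)))   ≈⟨ +-cong first last ⟩
    g₃ + g₂ + g₁                             ≈⟨ solve 3 (λ a b c → c :+ b :+ a := a :+ (b :+ c)) refl g₁ g₂ g₃ ⟩
    g₁ + (g₂ + g₃)                           ∎
    where
    open ≈R
    middle : ∀ i → i ≢ fromℕ m′ → sum (main-term (suc i)) ≈ 0#
    middle i i≢ = sum-0 λ j → zero-term (suc i) j (target-0 m (suc (toℕ i)) (toℕ j) (inj₁ λ ())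
      (inj₁ λ e → i≢ (Fin.toℕ-injective (≡.trans (ℕ.suc-injective e) (≡.sym (Fin.toℕ-fromℕ m′))))) (inj₁ λ ()))
    first : sum (main-term zero) ≈ g₃ + g₂
    first = trans (sum-pair (fromℕ m′) (main-term zero) inner) (+-cong
      (*-cong (ιℤ-* (+ 3) (+ 3)) (trans (*-identityˡ _) (*-identityˡ (Z ^ m))))
      (*-cong (ιℤ-cong (≡.trans (≡.cong (λ k → target m 0 (suc k)) (Fin.toℕ-fromℕ m′)) (target-y m′)))
        (trans (*-identityˡ _) (trans (*-cong (reflexive (≡.cong (λ k → Y ^ suc k) (Fin.toℕ-fromℕ m′)))
          (reflexive (≡.cong (Z ^_) (≡.trans (≡.cong (m′ ∸_) (Fin.toℕ-fromℕ m′)) (ℕ.n∸n≡0 m′))))) (*-identityʳ (Y ^ m))))))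
      where
      inner : ∀ j → j ≢ fromℕ m′ → main-term zero (suc j) ≈ 0#
      inner j j≢ = zero-term zero (suc j) (target-0 m 0 (suc (toℕ j)) (inj₂ λ ()) (inj₂ λ ())
        (inj₂ λ e → j≢ (Fin.toℕ-injective (≡.trans (ℕ.suc-injective e) (≡.sym (Fin.toℕ-fromℕ m′))))))
    last : sum (main-term (suc (fromℕ m′))) ≈ g₁
    last = trans (sum-single zero (main-term (suc (fromℕ m′))) λ { zero 0≢0 → ⊥-elim (0≢0 ≡.refl) ; (suc j) _ → zero-term (suc (fromℕ m′)) (suc j) ≡.refl })
      (trans (*-cong (trans (ιℤ-cong (≡.trans (≡.cong (λ k → target m (suc k) 0) (Fin.toℕ-fromℕ m′)) (target-x m′))) ι-1)
        (*-cong (reflexive (≡.cong (λ k → X ^ suc k) (Fin.toℕ-fromℕ m′)))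
          (trans (*-identityˡ _) (reflexive (≡.cong (Z ^_) (≡.trans (≡.cong (m′ ∸_) (Fin.toℕ-fromℕ m′)) (ℕ.n∸n≡0 m′)))))))
        (trans (*-identityˡ _) (*-identityʳ g₁)))

  -- The value of `f` at the point is the main sum plus terms 27qM for monomials M of degree `m`. As
  -- 9M is a multiple of g, each of these is a multiple of 3g.
  relation : ∀ N g → (∀ i j k → i ℕ.+ j ℕ.+ k ≡ m → Div N g (three * three * (X ^ i * (Y ^ j * Z ^ k)))) →
    ∃[ ρ ] R N ρ × g₁ + (g₂ + g₃) ≈ three * (ρ * g)
  relation N g divisible = - ρ , R-neg N ρ∈R , (begin
    g₁ + (g₂ + g₃)                                            ≈⟨ sym main-sum ⟩
    double-sum main-term                                      ≈⟨ solve 2 (λ a b → a := a :+ b :- b) refl (double-sum main-term) (double-sum error-term) ⟩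
    double-sum main-term + double-sum error-term - double-sum error-term   ≈⟨ +-cong evaluate≈ (-‿cong e≈) ⟩
    0# - three * (ρ * g)                                      ≈⟨ +-identityˡ _ ⟩
    - (three * (ρ * g))                                       ≈⟨ solve 3 (λ t r g → :- (t :* (r :* g)) := t :* ((:- r) :* g)) refl three ρ g ⟩
    three * (- ρ * g)                                         ∎)
    where
    open ≈R
    Multiple : Carrier → Set
    Multiple x = ∃[ ρ ] R N ρ × x ≈ three * (ρ * g)
    sum-multiple : ∀ {n} (t : Fin n → Carrier) → (∀ i → Multiple (t i)) → Multiple (sum t)
    sum-multiple {zero}  t _ = 0# , R-resp N ι-0 (R-ℤ N 0ℤ) , sym (trans (*-congˡ (zeroˡ g)) (zeroʳ three))
    sum-multiple {suc n} t h = let r , rr , e = h zero ; s , rs , e′ = sum-multiple (t ∘ suc) (h ∘ suc) in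
      r + s , R-+ N rr rs , trans (+-cong e e′) (solve 4 (λ t r s g → t :* (r :* g) :+ t :* (s :* g) := t :* ((r :+ s) :* g)) refl three r s g)
    error-multiple : ∀ i j → Multiple (error-term i j)
    error-multiple i j = let c , rc , e = divisible (toℕ i) (toℕ j) (degree-z i (toℕ j)) (exponents i j) in
      ιℤ (quotient i j) * c , R-* N (R-ℤ N (quotient i j)) rc , (begin
        ιℤ (quotient i j ℤ.* + 27) * M                      ≈⟨ *-congʳ (trans (ιℤ-* (quotient i j) (+ 27)) (*-congˡ (trans (ιℤ-* (+ 3) (+ 9)) (*-congˡ (ιℤ-* (+ 3) (+ 3)))))) ⟩
        ιℤ (quotient i j) * (three * (three * three)) * M   ≈⟨ solve 4 (λ q t u M → q :* (t :* u) :* M := t :* (q :* (u :* M))) refl (ιℤ (quotient i j)) three (three * three) M ⟩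
        three * (ιℤ (quotient i j) * (three * three * M))   ≈⟨ *-congˡ (trans (*-congˡ e) (sym (*-assoc (ιℤ (quotient i j)) c g))) ⟩
        three * (ιℤ (quotient i j) * c * g)                 ∎)
      where M = monomial (toℕ i) (toℕ j) (degree-z i (toℕ j))
    total-error = sum-multiple (λ i → sum (error-term i)) (λ i → sum-multiple (error-term i) (error-multiple i))
    ρ = proj₁ total-error
    ρ∈R : R N ρ
    ρ∈R = proj₁ (proj₂ total-error)
    e≈ : double-sum error-term ≈ three * (ρ * g)
    e≈ = proj₂ (proj₂ total-error)

  -- The dimension of the starting lattice modulo 3 is [L : ℚ] itself.
  m∣degree : m ℕ∣.∣ degree
  m∣degree = divides₃ nonzero relation (Λ degree) Λ-commensurable {degree} Dim₃-Λ
    where open IntegralLattice L using (Λ; Λ-commensurable; Dim₃-Λ)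

∣D : ∀ m → 1 ℕ.≤ m → ∀ f → CongruentToTarget m f → ∀ d → D m f d → m ℕ∣.∣ d
∣D (suc m′) _ f f≡ d (L , ≡.refl , P , on-curve , _) = DegreeDivides.m∣degree L m′ f f≡ P on-curve

-- The field defined by an Eisenstein polynomial at 3

snoc : ∀ {A : Set} {n} → (Fin n → A) → A → Fin (suc n) → A
snoc {n = zero}  f l zero    = l
snoc {n = suc n} f l zero    = f zero
snoc {n = suc n} f l (suc i) = snoc (f ∘ suc) l i

snoc-inject₁ : ∀ {A : Set} {n} (f : Fin n → A) l i → snoc f l (inject₁ i) ≡ f i
snoc-inject₁ f l zero    = ≡.refl
snoc-inject₁ f l (suc i) = snoc-inject₁ (f ∘ suc) l i

snoc-fromℕ : ∀ {A : Set} {n} (f : Fin n → A) l → snoc f l (fromℕ n) ≡ l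
snoc-fromℕ {n = zero}  f l = ≡.refl
snoc-fromℕ {n = suc n} f l = snoc-fromℕ (f ∘ suc) l

snoc-elim : ∀ {n} (P : Fin (suc n) → Set) → (∀ i → P (inject₁ i)) → P (fromℕ n) → ∀ i → P i
snoc-elim {zero}  P inner last zero    = last
snoc-elim {suc n} P inner last zero    = inner zero
snoc-elim {suc n} P inner last (suc i) = snoc-elim (P ∘ suc) (inner ∘ suc) last i

-- The field ℚ[x]/(xᵐ + aₘ₋₁xᵐ⁻¹ + ⋯ + a₀), realised as the commutant of the companion
-- matrix on ℚᵐ: evaluation at the cyclic vector e₀ identifies it with ℚᵐ, so that it is
-- commutative, and the ring laws come for free.

module Eisenstein (m′ : ℕ) (a : Fin (suc m′) → ℤ) (b : Fin (suc m′) → ℤ) (a≡3b : ∀ i → a i ≡ + 3 ℤ.* b i)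
  (b₀-prime : PrimeTo3 (b zero)) where

  m : ℕ
  m = suc m′

  ℚᵐ : Set
  ℚᵐ = Fin m → ℚ

  -- Multiplication by x in terms of the basis 1, x, ..., xᵐ⁻¹, the top coordinate being reduced by
  -- means of the polynomial.
  shift : ℚᵐ → ℚᵐ
  shift v zero    = ℚ.- (fromℤ (a zero) ℚ.* v (fromℕ m′))
  shift v (suc i) = v (inject₁ i) ℚ.- fromℤ (a (suc i)) ℚ.* v (fromℕ m′)

  shift-cong : ∀ {v w} → v ≗ w → shift v ≗ shift w
  shift-cong v≗w zero    = ≡.cong (λ q → ℚ.- (fromℤ (a zero) ℚ.* q)) (v≗w (fromℕ m′))
  shift-cong v≗w (suc i) = ≡.cong₂ (λ p q → p ℚ.- fromℤ (a (suc i)) ℚ.* q) (v≗w (inject₁ i)) (v≗w (fromℕ m′))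

  private
    linear₀ : ∀ a v w → ℚ.- (a ℚ.* (v ℚ.+ w)) ≡ ℚ.- (a ℚ.* v) ℚ.+ ℚ.- (a ℚ.* w)
    linear₀ = solve 3 (λ a v w → :- (a :* (v :+ w)) := :- (a :* v) :+ :- (a :* w)) ≡.refl where open ℚSolver
    linear₁ : ∀ a p q v w → (p ℚ.+ q) ℚ.- a ℚ.* (v ℚ.+ w) ≡ p ℚ.- a ℚ.* v ℚ.+ (q ℚ.- a ℚ.* w)
    linear₁ = solve 5 (λ a p q v w → p :+ q :- a :* (v :+ w) := p :- a :* v :+ (q :- a :* w)) ≡.refl where open ℚSolver
    scale₀ : ∀ a c v → ℚ.- (a ℚ.* (c ℚ.* v)) ≡ c ℚ.* (ℚ.- (a ℚ.* v))
    scale₀ = solve 3 (λ a c v → :- (a :* (c :* v)) := c :* (:- (a :* v))) ≡.refl where open ℚSolver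
    scale₁ : ∀ a c p v → c ℚ.* p ℚ.- a ℚ.* (c ℚ.* v) ≡ c ℚ.* (p ℚ.- a ℚ.* v)
    scale₁ = solve 4 (λ a c p v → c :* p :- a :* (c :* v) := c :* (p :- a :* v)) ≡.refl where open ℚSolver

  record Endo : Set where
    field
      fun     : ℚᵐ → ℚᵐ
      congᵉ   : ∀ {v w} → v ≗ w → fun v ≗ fun w
      addᵉ    : ∀ v w → fun (λ i → v i ℚ.+ w i) ≗ λ i → fun v i ℚ.+ fun w i
      scaleᵉ  : ∀ c v → fun (λ i → c ℚ.* v i) ≗ λ i → c ℚ.* fun v i
      commute : ∀ v → fun (shift v) ≗ shift (fun v)

  open Endo

  infix 4 _≈ᵉ_
  _≈ᵉ_ : Endo → Endo → Set
  A ≈ᵉ B = ∀ v → fun A v ≗ fun B v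

  shift-add : ∀ v w → shift (λ i → v i ℚ.+ w i) ≗ λ i → shift v i ℚ.+ shift w i
  shift-add v w zero    = linear₀ (fromℤ (a zero)) (v (fromℕ m′)) (w (fromℕ m′))
  shift-add v w (suc i) = linear₁ (fromℤ (a (suc i))) (v (inject₁ i)) (w (inject₁ i)) (v (fromℕ m′)) (w (fromℕ m′))

  shift-scale : ∀ c v → shift (λ i → c ℚ.* v i) ≗ λ i → c ℚ.* shift v i
  shift-scale c v zero    = scale₀ (fromℤ (a zero)) c (v (fromℕ m′))
  shift-scale c v (suc i) = scale₁ (fromℤ (a (suc i))) c (v (inject₁ i)) (v (fromℕ m′))

  α : Endo
  α = record { fun = shift ; congᵉ = shift-cong ; addᵉ = shift-add ; scaleᵉ = shift-scale ; commute = λ _ _ → ≡.refl }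

  scalar : ℚ → Endo
  scalar c = record
    { fun     = λ v i → c ℚ.* v i
    ; congᵉ   = λ v≗w i → ≡.cong (c ℚ.*_) (v≗w i)
    ; addᵉ    = λ v w i → ℚ.*-distribˡ-+ c (v i) (w i)
    ; scaleᵉ  = λ d v i → ≡.trans (≡.sym (ℚ.*-assoc c d (v i))) (≡.trans (≡.cong (ℚ._* v i) (ℚ.*-comm c d)) (ℚ.*-assoc d c (v i)))
    ; commute = λ v i → ≡.sym (shift-scale c v i)
    }

  private
    interchange : ∀ a b c d → a ℚ.+ b ℚ.+ (c ℚ.+ d) ≡ a ℚ.+ c ℚ.+ (b ℚ.+ d)
    interchange = solve 4 (λ a b c d → a :+ b :+ (c :+ d) := a :+ c :+ (b :+ d)) ≡.refl where open ℚSolver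

  _+ᵉ_ _*ᵉ_ : Endo → Endo → Endo
  A +ᵉ B = record
    { fun     = λ v i → fun A v i ℚ.+ fun B v i
    ; congᵉ   = λ v≗w i → ≡.cong₂ ℚ._+_ (congᵉ A v≗w i) (congᵉ B v≗w i)
    ; addᵉ    = λ v w i → ≡.trans (≡.cong₂ ℚ._+_ (addᵉ A v w i) (addᵉ B v w i)) (interchange (fun A v i) (fun A w i) (fun B v i) (fun B w i))
    ; scaleᵉ  = λ c v i → ≡.trans (≡.cong₂ ℚ._+_ (scaleᵉ A c v i) (scaleᵉ B c v i)) (≡.sym (ℚ.*-distribˡ-+ c (fun A v i) (fun B v i)))
    ; commute = λ v i → ≡.trans (≡.cong₂ ℚ._+_ (commute A v i) (commute B v i)) (≡.sym (shift-add (fun A v) (fun B v) i))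
    }
  A *ᵉ B = record
    { fun     = λ v → fun A (fun B v)
    ; congᵉ   = congᵉ A ∘ congᵉ B
    ; addᵉ    = λ v w i → ≡.trans (congᵉ A (addᵉ B v w) i) (addᵉ A (fun B v) (fun B w) i)
    ; scaleᵉ  = λ c v i → ≡.trans (congᵉ A (scaleᵉ B c v) i) (scaleᵉ A c (fun B v) i)
    ; commute = λ v i → ≡.trans (congᵉ A (commute B v) i) (commute A (fun B v) i)
    }

  ring : Ring 0ℓ 0ℓ
  ring = record
    { Carrier = Endo ; _≈_ = _≈ᵉ_ ; _+_ = _+ᵉ_ ; _*_ = _*ᵉ_
    ; -_ = scalar (ℚ.- 1ℚ) *ᵉ_ ; 0# = scalar 0ℚ ; 1# = scalar 1ℚ
    ; isRing = record
      { +-isAbelianGroup = record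
        { isGroup = record
          { isMonoid = record
            { isSemigroup = record
              { isMagma = record
                { isEquivalence = record
                  { refl  = λ _ _ → ≡.refl
                  ; sym   = λ e v i → ≡.sym (e v i)
                  ; trans = λ e e′ v i → ≡.trans (e v i) (e′ v i) }
                ; ∙-cong = λ e e′ v i → ≡.cong₂ ℚ._+_ (e v i) (e′ v i) }
              ; assoc = λ A B C v i → ℚ.+-assoc (fun A v i) (fun B v i) (fun C v i) }
            ; identity = (λ A v i → ≡.trans (≡.cong (ℚ._+ fun A v i) (ℚ.*-zeroˡ (v i))) (ℚ.+-identityˡ (fun A v i)))
                       , (λ A v i → ≡.trans (≡.cong (fun A v i ℚ.+_) (ℚ.*-zeroˡ (v i))) (ℚ.+-identityʳ (fun A v i))) }
          ; inverse = (λ A v i → negˡ (fun A v i) (v i)) , (λ A v i → negʳ (fun A v i) (v i))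
          ; ⁻¹-cong = λ e v i → ≡.cong (ℚ.- 1ℚ ℚ.*_) (e v i) }
        ; comm = λ A B v i → ℚ.+-comm (fun A v i) (fun B v i) }
      ; *-cong = λ {A} {_} {_} {D} e e′ v i → ≡.trans (congᵉ A (e′ v) i) (e (fun D v) i)
      ; *-assoc = λ _ _ _ _ _ → ≡.refl
      ; *-identity = (λ A v i → ℚ.*-identityˡ (fun A v i)) , (λ A v i → congᵉ A (λ j → ℚ.*-identityˡ (v j)) i)
      ; distrib = (λ A B C v i → addᵉ A (fun B v) (fun C v) i) , (λ _ _ _ _ _ → ≡.refl)
      }
    }
    where
    negˡ : ∀ x v → (ℚ.- 1ℚ) ℚ.* x ℚ.+ x ≡ 0ℚ ℚ.* v
    negˡ = solve 2 (λ x v → con (ℚ.- 1ℚ) :* x :+ x := con 0ℚ :* v) ≡.refl where open ℚSolver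
    negʳ : ∀ x v → x ℚ.+ (ℚ.- 1ℚ) ℚ.* x ≡ 0ℚ ℚ.* v
    negʳ = solve 2 (λ x v → x :+ con (ℚ.- 1ℚ) :* x := con 0ℚ :* v) ≡.refl where open ℚSolver

  open Ring ring using (_+_; _*_; 0#; 1#; semiring; +-commutativeMonoid) renaming (Carrier to K)
  open Exp semiring using (_^_)
  open CommutativeMonoidSum +-commutativeMonoid using (sum)

  e : Fin m → ℚᵐ
  e i j = fromℤ (δ i j)

  private
    e₀ : ℚᵐ
    e₀ = e zero

  -- The inverse of evaluation at `e₀`: the polynomial in α with the given coefficients.
  act : ℚᵐ → Endo
  act x = sum (λ i → scalar (x i) * α ^ toℕ i)

  fun-sum : ∀ {n} (A : Fin n → Endo) v j → fun (sum A) v j ≡ sumℚ (λ i → fun (A i) v j)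
  fun-sum {zero}  A v j = ℚ.*-zeroˡ (v j)
  fun-sum {suc n} A v j = ≡.cong (fun (A zero) v j ℚ.+_) (fun-sum (A ∘ suc) v j)

  δ-inject₁ : ∀ {n} (i j : Fin n) → δ (inject₁ i) (inject₁ j) ≡ δ i j
  δ-inject₁ zero    zero    = ≡.refl
  δ-inject₁ zero    (suc j) = ≡.refl
  δ-inject₁ (suc i) zero    = ≡.refl
  δ-inject₁ (suc i) (suc j) = δ-inject₁ i j

  δ-inject₁-fromℕ : ∀ {n} (i : Fin n) → δ (inject₁ i) (fromℕ n) ≡ 0ℤ
  δ-inject₁-fromℕ zero    = ≡.refl
  δ-inject₁-fromℕ (suc i) = δ-inject₁-fromℕ i

  shift-e : ∀ i → shift (e (inject₁ i)) ≗ e (suc i)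
  shift-e i zero = ≡.cong ℚ.-_ (≡.trans (≡.cong (λ k → fromℤ (a zero) ℚ.* fromℤ k) (δ-inject₁-fromℕ i)) (ℚ.*-zeroʳ (fromℤ (a zero))))
  shift-e i (suc j) = ≡.trans (≡.cong₂ ℚ._-_ (≡.cong fromℤ (δ-inject₁ i j))
    (≡.trans (≡.cong (λ k → fromℤ (a (suc j)) ℚ.* fromℤ k) (δ-inject₁-fromℕ i)) (ℚ.*-zeroʳ (fromℤ (a (suc j)))))) (ℚ.+-identityʳ (fromℤ (δ i j)))

  α^i-e₀ : ∀ i → fun (α ^ toℕ i) e₀ ≗ e i
  α^i-e₀ = <-weakInduction (λ i → fun (α ^ toℕ i) e₀ ≗ e i) (λ j → ℚ.*-identityˡ (e₀ j))
    λ i ih j → ≡.trans (shift-cong (λ k → ≡.trans (≡.cong (λ n → fun (α ^ n) e₀ k) (≡.sym (Fin.toℕ-inject₁ i))) (ih k)) j) (shift-e i j)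

  sum-δ : ∀ {n} (x : Fin n → ℚ) j → sumℚ (λ i → x i ℚ.* fromℤ (δ i j)) ≡ x j
  sum-δ {suc n} x zero = ≡.trans (≡.cong₂ ℚ._+_ (ℚ.*-identityʳ (x zero))
    (≡.trans (ℚΣ.sum-cong-≗ (λ i → ℚ.*-zeroʳ (x (suc i)))) (ℚΣ.sum-replicate-zero n))) (ℚ.+-identityʳ (x zero))
  sum-δ {suc n} x (suc j) = ≡.trans (≡.cong₂ ℚ._+_ (ℚ.*-zeroʳ (x zero)) (sum-δ (x ∘ suc) j)) (ℚ.+-identityˡ (x (suc j)))

  act-e₀ : ∀ x → fun (act x) e₀ ≗ x
  act-e₀ x j = ≡.trans (fun-sum (λ i → scalar (x i) * α ^ toℕ i) e₀ j)
    (≡.trans (ℚΣ.sum-cong-≗ (λ i → ≡.cong (x i ℚ.*_) (α^i-e₀ i j))) (sum-δ x j))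

  power-commutes : ∀ A n v → fun A (fun (α ^ n) v) ≗ fun (α ^ n) (fun A v)
  power-commutes A zero    v i = scaleᵉ A 1ℚ v i
  power-commutes A (suc n) v i = ≡.trans (commute A (fun (α ^ n) v) i) (shift-cong (power-commutes A n v) i)

  sum-commutes : ∀ A {n} (x : Fin n → ℚ) (k : Fin n → ℕ) v →
    fun A (fun (sum (λ i → scalar (x i) * α ^ k i)) v) ≗ fun (sum (λ i → scalar (x i) * α ^ k i)) (fun A v)
  sum-commutes A {zero}  x k v i = scaleᵉ A 0ℚ v i
  sum-commutes A {suc n} x k v i = ≡.trans (addᵉ A _ _ i) (≡.cong₂ ℚ._+_
    (≡.trans (scaleᵉ A (x zero) (fun (α ^ k zero) v) i) (≡.cong (x zero ℚ.*_) (power-commutes A (k zero) v i)))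
    (sum-commutes A (x ∘ suc) (k ∘ suc) v i))

  act-commutes : ∀ A x v → fun A (fun (act x) v) ≗ fun (act x) (fun A v)
  act-commutes A x v = sum-commutes A x toℕ v

  -- Any v is p(α)e₀ for a polynomial p, and `A` commutes with α, so Av = p(α)Ae₀.
  determined : ∀ A B → fun A e₀ ≗ fun B e₀ → A ≈ᵉ B
  determined A B Ae₀≗Be₀ v i = begin
    fun A v i                   ≡⟨ congᵉ A (λ j → ≡.sym (act-e₀ v j)) i ⟩
    fun A (fun (act v) e₀) i    ≡⟨ act-commutes A v e₀ i ⟩
    fun (act v) (fun A e₀) i    ≡⟨ congᵉ (act v) Ae₀≗Be₀ i ⟩
    fun (act v) (fun B e₀) i    ≡⟨ ≡.sym (act-commutes B v e₀ i) ⟩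
    fun B (fun (act v) e₀) i    ≡⟨ congᵉ B (act-e₀ v) i ⟩
    fun B v i                   ∎
    where open ≡.≡-Reasoning

  ≈act : ∀ A → A ≈ᵉ act (fun A e₀)
  ≈act A = determined A (act (fun A e₀)) (λ j → ≡.sym (act-e₀ (fun A e₀) j))

  *ᵉ-comm : ∀ A B → (A *ᵉ B) ≈ᵉ (B *ᵉ A)
  *ᵉ-comm A B v i = ≡.trans (congᵉ A (≈act B v) i) (≡.trans (act-commutes A (fun B e₀) v i) (≡.sym (≈act B (fun A v) i)))

  commutativeRing : CommutativeRing 0ℓ 0ℓ
  commutativeRing = record { isCommutativeRing = record { isRing = Ring.isRing ring ; *-comm = *ᵉ-comm } }

  -- Every nonzero integral vector is a power of α times an integral vector whose
  -- zeroth coordinate is prime to 3, up to a scalar.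

  ⟦_⟧ : (Fin m → ℤ) → ℚᵐ
  ⟦ z ⟧ i = fromℤ (z i)

  shiftℤ : (Fin m → ℤ) → Fin m → ℤ
  shiftℤ z zero    = ℤ.- (a zero ℤ.* z (fromℕ m′))
  shiftℤ z (suc i) = z (inject₁ i) ℤ.- a (suc i) ℤ.* z (fromℕ m′)

  shift-⟦⟧ : ∀ z → shift ⟦ z ⟧ ≗ ⟦ shiftℤ z ⟧
  shift-⟦⟧ z zero    = ≡.trans (≡.cong ℚ.-_ (≡.sym (fromℤ-homo-* (a zero) (z (fromℕ m′))))) (≡.sym (fromℤ-homo-neg (a zero ℤ.* z (fromℕ m′))))
  shift-⟦⟧ z (suc i) = ≡.trans (≡.cong (fromℤ (z (inject₁ i)) ℚ.+_) (≡.trans (≡.cong ℚ.-_ (≡.sym (fromℤ-homo-* (a (suc i)) (z (fromℕ m′))))) (≡.sym (fromℤ-homo-neg (a (suc i) ℤ.* z (fromℕ m′))))))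
    (≡.sym (fromℤ-homo-+ (z (inject₁ i)) (ℤ.- (a (suc i) ℤ.* z (fromℕ m′)))))

  Unit₀ : (Fin m → ℤ) → Set
  Unit₀ u = ¬ (+ 3) ℤ∣.∣ u zero

  Factored : ℚᵐ → Set
  Factored v = ∃[ q ] q ≢ 0ℚ × ∃[ k ] Σ (Fin m → ℤ) λ u → Unit₀ u × (λ i → q ℚ.* v i) ≗ fun (α ^ k) ⟦ u ⟧

  b₀≢0 : fromℤ (b zero) ≢ 0ℚ
  b₀≢0 p = PrimeTo3⇒3∤ {b zero} b₀-prime (≡.subst ((+ 3) ℤ∣.∣_) (≡.sym (fromℤ-injective {b zero} {0ℤ} p)) (divides 0ℤ ≡.refl))

  -- Division by α moves the coordinate known to be prime to 3 one place towards the front. It is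
  -- possible over ℤ when 3 divides the zeroth coordinate, after multiplication by b₀, because a₀ =
  -- 3b₀; the coordinate stays prime to 3 as every aᵢ is a multiple of 3.
  factor : ∀ j (y : Fin m → ℤ) → ¬ (+ 3) ℤ∣.∣ y j → Factored ⟦ y ⟧
  factor = <-weakInduction (λ j → ∀ y → ¬ (+ 3) ℤ∣.∣ y j → Factored ⟦ y ⟧) base step
    where
    base : ∀ y → ¬ (+ 3) ℤ∣.∣ y zero → Factored ⟦ y ⟧
    base y 3∤y₀ = 1ℚ , (λ ()) , 0 , y , 3∤y₀ , λ _ → ≡.refl
    step : ∀ (i : Fin m′) → (∀ y → ¬ (+ 3) ℤ∣.∣ y (inject₁ i) → Factored ⟦ y ⟧) → ∀ y → ¬ (+ 3) ℤ∣.∣ y (suc i) → Factored ⟦ y ⟧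
    step i ih y 3∤yᵢ with (+ 3) ℤ∣.∣? y zero
    ... | no 3∤y₀ = base y 3∤y₀
    ... | yes (divides t y₀≡) = extend (ih y″ 3∤y″)
      where
      -- The solution of shift y″ = b₀ y
      y′ : Fin m′ → ℤ
      y′ j = b zero ℤ.* y (suc j) ℤ.- a (suc j) ℤ.* t
      y″ : Fin m → ℤ
      y″ = snoc y′ (ℤ.- t)
      3∤y″ : ¬ (+ 3) ℤ∣.∣ y″ (inject₁ i)
      3∤y″ 3∣ = PrimeTo3⇒3∤ {b zero ℤ.* y (suc i)} (PrimeTo3-* {b zero} b₀-prime (3∤⇒PrimeTo3 3∤yᵢ))
        (≡.subst ((+ 3) ℤ∣.∣_) (recover (b zero ℤ.* y (suc i)) (a (suc i) ℤ.* t))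
          (ℤ∣.∣m∣n⇒∣m+n (≡.subst ((+ 3) ℤ∣.∣_) (snoc-inject₁ y′ (ℤ.- t) i) 3∣)
            (≡.subst (λ k → (+ 3) ℤ∣.∣ k ℤ.* t) (≡.sym (a≡3b (suc i))) (ℤ∣.∣m⇒∣m*n t (ℤ∣.∣m⇒∣m*n (b (suc i)) ℤ∣.∣-refl)))))
        where
        recover : ∀ x y → x ℤ.- y ℤ.+ y ≡ x
        recover = solve 2 (λ x y → x :- y :+ y := x) ≡.refl where open ℤSolver
      shift-y″ : ∀ j → shiftℤ y″ j ≡ b zero ℤ.* y j
      shift-y″ zero = ≡.trans (≡.cong₂ (λ p q → ℤ.- (p ℤ.* q)) (a≡3b zero) (snoc-fromℕ y′ (ℤ.- t)))
        (≡.trans (rearrange (b zero) t) (≡.cong (b zero ℤ.*_) (≡.sym y₀≡)))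
        where
        rearrange : ∀ b t → ℤ.- ((+ 3) ℤ.* b ℤ.* (ℤ.- t)) ≡ b ℤ.* (t ℤ.* + 3)
        rearrange = solve 2 (λ b t → :- (con (+ 3) :* b :* (:- t)) := b :* (t :* con (+ 3))) ≡.refl where open ℤSolver
      shift-y″ (suc j) = ≡.trans (≡.cong₂ (λ p q → p ℤ.- a (suc j) ℤ.* q) (snoc-inject₁ y′ (ℤ.- t) j) (snoc-fromℕ y′ (ℤ.- t)))
        (rearrange (b zero ℤ.* y (suc j)) (a (suc j)) t)
        where
        rearrange : ∀ x a t → x ℤ.- a ℤ.* t ℤ.- a ℤ.* (ℤ.- t) ≡ x
        rearrange = solve 3 (λ x a t → x :- a :* t :- a :* (:- t) := x) ≡.refl where open ℤSolver
      extend : Factored ⟦ y″ ⟧ → Factored ⟦ y ⟧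
      extend (q , q≢0 , k , u , unit , e) = q ℚ.* fromℤ (b zero) , (λ p → b₀≢0 (p*q≡0⇒q≡0 q≢0 p)) , suc k , u , unit , λ j → begin
        q ℚ.* fromℤ (b zero) ℚ.* fromℤ (y j)     ≡⟨ ≡.trans (ℚ.*-assoc q _ _) (≡.cong (q ℚ.*_) (≡.sym (fromℤ-homo-* (b zero) (y j)))) ⟩
        q ℚ.* fromℤ (b zero ℤ.* y j)             ≡⟨ ≡.cong (λ k → q ℚ.* fromℤ k) (≡.sym (shift-y″ j)) ⟩
        q ℚ.* fromℤ (shiftℤ y″ j)                ≡⟨ ≡.cong (q ℚ.*_) (≡.sym (shift-⟦⟧ y″ j)) ⟩
        q ℚ.* shift ⟦ y″ ⟧ j                     ≡⟨ ≡.sym (shift-scale q ⟦ y″ ⟧ j) ⟩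
        shift (λ i → q ℚ.* ⟦ y″ ⟧ i) j           ≡⟨ shift-cong e j ⟩
        fun (α ^ suc k) ⟦ u ⟧ j                  ∎
        where open ≡.≡-Reasoning

  factor-nonzero : ∀ v i → v i ≢ 0ℚ → Factored v
  factor-nonzero v i vᵢ≢0 with common-denominator v
  ... | D , D≢0 , z , Dv≡z with strip-3 z i (λ p → vᵢ≢0 (p*q≡0⇒q≡0 (D≢0 ∘ fromℤ-injective) (≡.trans (Dv≡z i) (≡.cong fromℤ p))))
  ... | y , (k , z≡) , (j , 3∤yⱼ) with factor j y 3∤yⱼ
  ... | q , q≢0 , l , u , unit , e = q ℚ.* (s⁻¹ ℚ.* fromℤ D) , nonzero , l , u , unit , λ i → ≡.trans (scaled i) (e i)
    where
    s = fromℤ ((+ 3) ℤ.^ k)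
    s≢0 : s ≢ 0ℚ
    s≢0 p = vᵢ≢0 (p*q≡0⇒q≡0 (D≢0 ∘ fromℤ-injective) (≡.trans (Dv≡z i) (≡.trans (≡.cong fromℤ (z≡ i)) (≡.trans (fromℤ-homo-* ((+ 3) ℤ.^ k) (y i)) (≡.trans (≡.cong (ℚ._* fromℤ (y i)) p) (ℚ.*-zeroˡ (fromℤ (y i))))))))
    instance _ = ℚ.≢-nonZero s≢0
    s⁻¹ = ℚ.1/ s
    nonzero : q ℚ.* (s⁻¹ ℚ.* fromℤ D) ≢ 0ℚ
    nonzero p = D≢0 (fromℤ-injective (≡.trans (≡.sym (ℚ.*-identityˡ (fromℤ D))) (≡.trans (≡.cong (ℚ._* fromℤ D) (≡.sym (ℚ.*-inverseʳ s)))
      (≡.trans (ℚ.*-assoc s s⁻¹ (fromℤ D)) (≡.trans (≡.cong (s ℚ.*_) (p*q≡0⇒q≡0 q≢0 p)) (ℚ.*-zeroʳ s))))))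
    scaled : ∀ i → q ℚ.* (s⁻¹ ℚ.* fromℤ D) ℚ.* v i ≡ q ℚ.* fromℤ (y i)
    scaled i = begin
      q ℚ.* (s⁻¹ ℚ.* fromℤ D) ℚ.* v i        ≡⟨ reassociate q s⁻¹ (fromℤ D) (v i) ⟩
      q ℚ.* (s⁻¹ ℚ.* (fromℤ D ℚ.* v i))      ≡⟨ ≡.cong (λ w → q ℚ.* (s⁻¹ ℚ.* w)) (≡.trans (Dv≡z i) (≡.trans (≡.cong fromℤ (z≡ i)) (fromℤ-homo-* ((+ 3) ℤ.^ k) (y i)))) ⟩
      q ℚ.* (s⁻¹ ℚ.* (s ℚ.* fromℤ (y i)))    ≡⟨ ≡.cong (q ℚ.*_) (≡.trans (≡.sym (ℚ.*-assoc s⁻¹ s (fromℤ (y i)))) (≡.trans (≡.cong (ℚ._* fromℤ (y i)) (ℚ.*-inverseˡ s)) (ℚ.*-identityˡ (fromℤ (y i))))) ⟩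
      q ℚ.* fromℤ (y i)                      ∎
      where
      open ≡.≡-Reasoning
      reassociate : ∀ q r D v → q ℚ.* (r ℚ.* D) ℚ.* v ≡ q ℚ.* (r ℚ.* (D ℚ.* v))
      reassociate = solve 4 (λ q r D v → q :* (r :* D) :* v := q :* (r :* (D :* v))) ≡.refl where open ℚSolver

  Zero : ℚᵐ → Set
  Zero v = ∀ i → v i ≡ 0ℚ

  shift-injective : ∀ v → Zero (shift v) → Zero v
  shift-injective v sv≡0 = snoc-elim (λ i → v i ≡ 0ℚ) inner last
    where
    neg-neg : ∀ x → ℚ.- (ℚ.- x) ≡ x
    neg-neg = solve 1 (λ x → :- (:- x) := x) ≡.refl where open ℚSolver
    a₀≢0 : ℚ.- fromℤ (a zero) ≢ 0ℚ
    a₀≢0 p = b₀≢0 (p*q≡0⇒q≡0 {fromℤ (+ 3)} (λ ()) (≡.trans (≡.sym (fromℤ-homo-* (+ 3) (b zero))) (≡.trans (≡.cong fromℤ (≡.sym (a≡3b zero)))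
      (≡.trans (≡.sym (neg-neg (fromℤ (a zero)))) (≡.cong ℚ.-_ p)))))
    last : v (fromℕ m′) ≡ 0ℚ
    last = p*q≡0⇒q≡0 a₀≢0 (≡.trans (≡.sym (ℚ.neg-distribˡ-* (fromℤ (a zero)) (v (fromℕ m′)))) (sv≡0 zero))
    inner : ∀ i → v (inject₁ i) ≡ 0ℚ
    inner i = ≡.trans (≡.sym (ℚ.+-identityʳ (v (inject₁ i)))) (≡.trans (≡.cong (λ w → v (inject₁ i) ℚ.- w) (≡.sym (≡.trans (≡.cong (fromℤ (a (suc i)) ℚ.*_) last) (ℚ.*-zeroʳ (fromℤ (a (suc i))))))) (sv≡0 (suc i)))

  α^-injective : ∀ k v → Zero (fun (α ^ k) v) → Zero v
  α^-injective zero    v z i = ≡.trans (≡.sym (ℚ.*-identityˡ (v i))) (z i)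
  α^-injective (suc k) v z   = α^-injective k v (shift-injective (fun (α ^ k) v) z)

  act-comm : ∀ x y → fun (act x) y ≗ fun (act y) x
  act-comm x y j = ≡.trans (congᵉ (act x) (λ i → ≡.sym (act-e₀ y i)) j) (≡.trans (act-commutes (act x) y e₀ j) (congᵉ (act y) (act-e₀ x) j))

  integral-power : ∀ k z → Σ (Fin m → ℤ) λ w → fun (α ^ k) ⟦ z ⟧ ≗ ⟦ w ⟧
  integral-power zero    z = z , λ i → ℚ.*-identityˡ (fromℤ (z i))
  integral-power (suc k) z = let w , e = integral-power k z in shiftℤ w , λ i → ≡.trans (shift-cong e i) (shift-⟦⟧ w i)

  integral-power-zero : ∀ k z → ∃[ c ] fun (α ^ suc k) ⟦ z ⟧ zero ≡ fromℤ (c ℤ.* + 3)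
  integral-power-zero k z = let w , e = integral-power k z in ℤ.- (b zero ℤ.* w (fromℕ m′)) ,
    ≡.trans (shift-cong e zero) (≡.trans (shift-⟦⟧ w zero) (≡.cong fromℤ (≡.trans (≡.cong (λ k → ℤ.- (k ℤ.* w (fromℕ m′))) (a≡3b zero)) (rearrange (b zero) (w (fromℕ m′))))))
    where
    rearrange : ∀ b w → ℤ.- ((+ 3) ℤ.* b ℤ.* w) ≡ ℤ.- (b ℤ.* w) ℤ.* + 3
    rearrange = solve 2 (λ b w → :- (con (+ 3) :* b :* w) := :- (b :* w) :* con (+ 3)) ≡.refl where open ℤSolver

  sum-multiple-of-3 : ∀ {n} (q : Fin n → ℚ) → (∀ i → ∃[ c ] q i ≡ fromℤ (c ℤ.* + 3)) → ∃[ c ] sumℚ q ≡ fromℤ (c ℤ.* + 3)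
  sum-multiple-of-3 {zero}  q h = 0ℤ , ≡.refl
  sum-multiple-of-3 {suc n} q h = let c , e = h zero ; d , e′ = sum-multiple-of-3 (q ∘ suc) (h ∘ suc) in
    c ℤ.+ d , ≡.trans (≡.cong₂ ℚ._+_ e e′) (≡.trans (≡.sym (fromℤ-homo-+ (c ℤ.* + 3) (d ℤ.* + 3))) (≡.cong fromℤ (≡.sym (ℤ.*-distribʳ-+ (+ 3) c d))))

  -- The zeroth coordinate modulo 3 is the residue map at the prime α: by `integral-power-zero`
  -- positive powers of α contribute multiples of 3 there, so the product has zeroth coordinate u₀w₀
  -- modulo 3.
  unit-product : ∀ u w → Unit₀ u → Unit₀ w → ¬ Zero (fun (act ⟦ u ⟧) ⟦ w ⟧)
  unit-product u w 3∤u 3∤w z = PrimeTo3⇒3∤ {u zero ℤ.* w zero} (PrimeTo3-* {u zero} {w zero} (3∤⇒PrimeTo3 3∤u) (3∤⇒PrimeTo3 3∤w))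
    (divides (ℤ.- c) (fromℤ-injective (begin
      fromℤ (u zero ℤ.* w zero)       ≡⟨ ≡.trans (fromℤ-homo-* (u zero) (w zero)) (≡.cong (fromℤ (u zero) ℚ.*_) (≡.sym (ℚ.*-identityˡ (fromℤ (w zero))))) ⟩
      first                           ≡⟨ cancel first rest ⟩
      first ℚ.+ rest ℚ.- rest         ≡⟨ ≡.cong₂ ℚ._-_ (≡.trans (≡.sym (fun-sum (λ i → scalar (⟦ u ⟧ i) * α ^ toℕ i) ⟦ w ⟧ zero)) (z zero)) rest≡ ⟩
      0ℚ ℚ.- fromℤ (c ℤ.* + 3)        ≡⟨ ≡.trans (ℚ.+-identityˡ _) (≡.sym (fromℤ-homo-neg (c ℤ.* + 3))) ⟩
      fromℤ (ℤ.- (c ℤ.* + 3))         ≡⟨ ≡.cong fromℤ (ℤ.neg-distribˡ-* c (+ 3)) ⟩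
      fromℤ ((ℤ.- c) ℤ.* + 3)         ∎)))
    where
    open ≡.≡-Reasoning
    first = fromℤ (u zero) ℚ.* (1ℚ ℚ.* fromℤ (w zero))
    terms : Fin m′ → ℚ
    terms i = fromℤ (u (suc i)) ℚ.* fun (α ^ suc (toℕ i)) ⟦ w ⟧ zero
    rest = sumℚ terms
    multiple = sum-multiple-of-3 terms λ i → let d , e = integral-power-zero (toℕ i) w in
      u (suc i) ℤ.* d , ≡.trans (≡.cong (fromℤ (u (suc i)) ℚ.*_) e) (≡.trans (≡.sym (fromℤ-homo-* (u (suc i)) (d ℤ.* + 3))) (≡.cong fromℤ (≡.sym (ℤ.*-assoc (u (suc i)) d (+ 3)))))
    c = proj₁ multiple
    rest≡ : rest ≡ fromℤ (c ℤ.* + 3)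
    rest≡ = proj₂ multiple
    cancel : ∀ x y → x ≡ x ℚ.+ y ℚ.- y
    cancel = solve 2 (λ x y → x := x :+ y :- y) ≡.refl where open ℚSolver

  -- The absence of zero divisors, which replaces the irreducibility of the polynomial. Powers of α
  -- and scalars are stripped from both factors until residues can be multiplied.
  act-nonzero : ∀ x y → (∃[ i ] x i ≢ 0ℚ) → (∃[ i ] y i ≢ 0ℚ) → ¬ Zero (fun (act x) y)
  act-nonzero x y (i , xᵢ≢0) (j , yⱼ≢0) xy≡0 = go (factor-nonzero x i xᵢ≢0) (factor-nonzero y j yⱼ≢0)
    where
    peel : ∀ x y q k u → (λ i → q ℚ.* y i) ≗ fun (α ^ k) u → Zero (fun (act x) y) → Zero (fun (act x) u)
    peel x y q k u e z = α^-injective k (fun (act x) u) λ i → ≡.trans (≡.sym (power-commutes (act x) k u i))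
      (≡.trans (congᵉ (act x) (λ j → ≡.sym (e j)) i) (≡.trans (scaleᵉ (act x) q y i) (≡.trans (≡.cong (q ℚ.*_) (z i)) (ℚ.*-zeroʳ q))))
    go : Factored x → Factored y → ⊥
    go (q , _ , k , u , unit-u , qx≡) (r , _ , l , w , unit-w , ry≡) =
      unit-product w u unit-w unit-u (peel ⟦ w ⟧ x q k ⟦ u ⟧ qx≡ λ i → ≡.trans (act-comm ⟦ w ⟧ x i) (peel x y r l ⟦ w ⟧ ry≡ xy≡0 i))

  nonzero-coordinate : ∀ A → ¬ A ≈ᵉ 0# → ∃[ i ] fun A e₀ i ≢ 0ℚ
  nonzero-coordinate A A≉0 with Fin.any? (λ i → ¬? (fun A e₀ i ℚ.≟ 0ℚ))
  ... | yes p = p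
  ... | no ∄  = ⊥-elim (A≉0 (determined A 0# λ i → ≡.trans (decidable-stable (fun A e₀ i ℚ.≟ 0ℚ) λ p → ∄ (i , p)) (≡.sym (ℚ.*-zeroˡ (e₀ i)))))

  -- The m + 1 vectors e₀, Ae₀, ..., Aeₘ₋₁ of ℚᵐ are dependent. The coefficient of e₀ is nonzero
  -- since `A` is injective, so e₀ is in the image of `A`, and its preimage determines the inverse.
  inverse : ∀ A → ¬ A ≈ᵉ 0# → ∃[ B ] (A *ᵉ B) ≈ᵉ 1#
  inverse A A≉0 = solution (rational-kernel m rows)
    where
    rows : Fin (suc m) → Fin m → ℚ
    rows zero    = e₀
    rows (suc i) = fun A (e i)
    solution : Σ (Fin (suc m) → ℚ) (λ x → (∃[ i ] x i ≢ 0ℚ) × (∀ j → sumℚ (λ i → x i ℚ.* rows i j) ≡ 0ℚ)) → ∃[ B ] (A *ᵉ B) ≈ᵉ 1#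
    solution (x , (i , xᵢ≢0) , kernel) = act y , determined (A *ᵉ act y) 1# λ j → begin
      fun A (fun (act y) e₀) j                       ≡⟨ congᵉ A (act-e₀ y) j ⟩
      fun A y j                                      ≡⟨ scaleᵉ A (ℚ.- x₀⁻¹) x′ j ⟩
      ℚ.- x₀⁻¹ ℚ.* fun A x′ j                        ≡⟨ invert (x zero) x₀⁻¹ (fun A x′ j) (e₀ j) (ℚ.*-inverseʳ (x zero)) (relation j) ⟩
      1ℚ ℚ.* e₀ j                                    ∎
      where
      open ≡.≡-Reasoning
      x′ : ℚᵐ
      x′ = x ∘ suc
      Ax′≡ : ∀ j → fun A x′ j ≡ sumℚ (λ i → x′ i ℚ.* fun A (e i) j)
      Ax′≡ j = ≡.trans (congᵉ A (λ i → ≡.sym (act-e₀ x′ i)) j) (≡.trans (act-commutes A x′ e₀ j) (≡.trans (fun-sum (λ i → scalar (x′ i) * α ^ toℕ i) (fun A e₀) j)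
        (ℚΣ.sum-cong-≗ λ i → ≡.cong (x′ i ℚ.*_) (≡.trans (≡.sym (power-commutes A (toℕ i) e₀ j)) (congᵉ A (α^i-e₀ i) j)))))
      relation : ∀ j → x zero ℚ.* e₀ j ℚ.+ fun A x′ j ≡ 0ℚ
      relation j = ≡.trans (≡.cong (x zero ℚ.* e₀ j ℚ.+_) (Ax′≡ j)) (kernel j)
      x₀≢0 : x zero ≢ 0ℚ
      x₀≢0 x₀≡0 = act-nonzero (fun A e₀) x′ (nonzero-coordinate A A≉0) (locate i xᵢ≢0)
        λ j → ≡.trans (≡.sym (≈act A x′ j)) (≡.trans (≡.sym (≡.trans (≡.cong (ℚ._+ fun A x′ j) (≡.trans (≡.cong (ℚ._* e₀ j) x₀≡0) (ℚ.*-zeroˡ (e₀ j)))) (ℚ.+-identityˡ (fun A x′ j)))) (relation j))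
        where
        locate : ∀ i → x i ≢ 0ℚ → ∃[ j ] x′ j ≢ 0ℚ
        locate zero    p = ⊥-elim (p x₀≡0)
        locate (suc j) p = j , p
      instance _ = ℚ.≢-nonZero x₀≢0
      x₀⁻¹ = ℚ.1/ x zero
      y : ℚᵐ
      y i = ℚ.- x₀⁻¹ ℚ.* x′ i
      invert : ∀ x r s t → x ℚ.* r ≡ 1ℚ → x ℚ.* t ℚ.+ s ≡ 0ℚ → ℚ.- r ℚ.* s ≡ 1ℚ ℚ.* t
      invert x r s t xr≡1 rel = ≡.trans (expand x r s t) (≡.trans (≡.cong₂ (λ p q → ℚ.- r ℚ.* p ℚ.+ q ℚ.* t) rel xr≡1) (≡.trans (≡.cong (ℚ._+ 1ℚ ℚ.* t) (ℚ.*-zeroʳ (ℚ.- r))) (ℚ.+-identityˡ (1ℚ ℚ.* t))))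
        where
        expand : ∀ x r s t → ℚ.- r ℚ.* s ≡ ℚ.- r ℚ.* (x ℚ.* t ℚ.+ s) ℚ.+ x ℚ.* r ℚ.* t
        expand = solve 4 (λ x r s t → (:- r) :* s := (:- r) :* (x :* t :+ s) :+ x :* r :* t) ≡.refl where open ℚSolver

  field-extension : NumberField
  field-extension = record
    { commutativeRing = commutativeRing
    ; 0≉1 = λ e → case-0≡1 (e e₀ zero)
    ; inverse = inverse
    ; ι = scalar
    ; ι-isRingHomomorphism = record
      { isSemiringHomomorphism = record
        { isNearSemiringHomomorphism = record
          { +-isMonoidHomomorphism = record
            { isMagmaHomomorphism = record
              { isRelHomomorphism = record { cong = λ { ≡.refl v i → ≡.refl } }
              ; homo = λ p q v i → ℚ.*-distribʳ-+ (v i) p q }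
            ; ε-homo = λ v i → ≡.refl }
          ; *-homo = λ p q v i → ℚ.*-assoc p q (v i) }
        ; 1#-homo = λ v i → ≡.refl }
      ; -‿homo = λ p v i → negate p (v i) }
    ; degree = m
    ; basis = λ i → α ^ toℕ i
    ; spanning = λ A → fun A e₀ , ≈act A
    ; independent = λ c e i → ≡.trans (≡.sym (act-e₀ c i)) (≡.trans (e e₀ i) (ℚ.*-zeroˡ (e₀ i)))
    }
    where
    case-0≡1 : 0ℚ ℚ.* 1ℚ ≢ 1ℚ ℚ.* 1ℚ
    case-0≡1 ()
    negate : ∀ p v → (ℚ.- p) ℚ.* v ≡ (ℚ.- 1ℚ) ℚ.* (p ℚ.* v)
    negate = solve 2 (λ p v → (:- p) :* v := con (ℚ.- 1ℚ) :* (p :* v)) ≡.refl where open ℚSolver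

  α-root : (α ^ m + sum (λ i → scalar (fromℤ (a i)) * α ^ toℕ i)) ≈ᵉ 0#
  α-root = determined (α ^ m + sum (λ i → scalar (fromℤ (a i)) * α ^ toℕ i)) 0# λ j → ≡.trans (≡.cong₂ ℚ._+_ (αᵐ-e₀ j) (act-e₀ ⟦ a ⟧ j)) (≡.trans (ℚ.+-inverseˡ (fromℤ (a j))) (≡.sym (ℚ.*-zeroˡ (e₀ j))))
    where
    shift-last : ∀ j → shift (e (fromℕ m′)) j ≡ ℚ.- fromℤ (a j)
    shift-last zero = ≡.cong ℚ.-_ (≡.trans (≡.cong (λ k → fromℤ (a zero) ℚ.* fromℤ k) (δ-diagonal (fromℕ m′))) (ℚ.*-identityʳ (fromℤ (a zero))))
    shift-last (suc i) = ≡.trans (≡.cong₂ ℚ._-_ (≡.cong fromℤ (δ-off-diagonal {i = fromℕ m′} {inject₁ i} Fin.fromℕ≢inject₁))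
      (≡.trans (≡.cong (λ k → fromℤ (a (suc i)) ℚ.* fromℤ k) (δ-diagonal (fromℕ m′))) (ℚ.*-identityʳ (fromℤ (a (suc i)))))) (ℚ.+-identityˡ (ℚ.- fromℤ (a (suc i))))
    αᵐ-e₀ : ∀ j → fun (α ^ m) e₀ j ≡ ℚ.- fromℤ (a j)
    αᵐ-e₀ j = ≡.trans (shift-cong (λ i → ≡.trans (≡.cong (λ n → fun (α ^ n) e₀ i) (≡.sym (Fin.toℕ-fromℕ m′))) (α^i-e₀ (fromℕ m′) i)) j) (shift-last j)

-- Evaluation on the line at infinity, and subfields

module PointAtInfinity (L : NumberField) where
  open Field L
  open NumberField L using (sum)
  open SingleTerm L using (sum-single)
  open ProjectivePoint

  evaluate-Z≈0 : ∀ d F (P : ProjectivePoint L) → Z P ≈ 0# →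
    evaluate L d F P ≈ sum {suc d} (λ i → ιℤ (F (toℕ i , d ∸ toℕ i , 0)) * (X P ^ toℕ i * Y P ^ (d ∸ toℕ i)))
  evaluate-Z≈0 d F P Z≈0 = sum-cong λ i → trans (sum-single (fromℕ (d ∸ toℕ i)) (term i) (vanish i)) (final i)
    where
    term : (i : Fin (suc d)) → Fin (suc (d ∸ toℕ i)) → Carrier
    term i j = ιℤ (F (toℕ i , toℕ j , d ∸ toℕ i ∸ toℕ j)) * (X P ^ toℕ i * (Y P ^ toℕ j * Z P ^ (d ∸ toℕ i ∸ toℕ j)))
    Z^≈0 : ∀ k → k ≢ 0 → Z P ^ k ≈ 0#
    Z^≈0 zero    k≢0 = ⊥-elim (k≢0 ≡.refl)
    Z^≈0 (suc k) _   = trans (*-congʳ Z≈0) (zeroˡ (Z P ^ k))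
    vanish : ∀ i j → j ≢ fromℕ (d ∸ toℕ i) → term i j ≈ 0#
    vanish i j j≢ = trans (*-congˡ (trans (*-congˡ (trans (*-congˡ (Z^≈0 (d ∸ toℕ i ∸ toℕ j) positive)) (zeroʳ _))) (zeroʳ _))) (zeroʳ _)
      where
      positive : d ∸ toℕ i ∸ toℕ j ≢ 0
      positive e = j≢ (Fin.toℕ-injective (≡.trans (ℕ.≤-antisym (ℕ.≤-pred (Fin.toℕ<n j)) (ℕ.m∸n≡0⇒m≤n e)) (≡.sym (Fin.toℕ-fromℕ (d ∸ toℕ i)))))
    final : ∀ i → term i (fromℕ (d ∸ toℕ i)) ≈ ιℤ (F (toℕ i , d ∸ toℕ i , 0)) * (X P ^ toℕ i * Y P ^ (d ∸ toℕ i))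
    final i = go (d ∸ toℕ i) (toℕ (fromℕ (d ∸ toℕ i))) (Fin.toℕ-fromℕ (d ∸ toℕ i))
      where
      go : ∀ n j → j ≡ n → ιℤ (F (toℕ i , j , n ∸ j)) * (X P ^ toℕ i * (Y P ^ j * Z P ^ (n ∸ j))) ≈ ιℤ (F (toℕ i , n , 0)) * (X P ^ toℕ i * Y P ^ n)
      go n n ≡.refl = go′ (n ∸ n) (ℕ.n∸n≡0 n)
        where
        go′ : ∀ k → k ≡ 0 → ιℤ (F (toℕ i , n , k)) * (X P ^ toℕ i * (Y P ^ n * Z P ^ k)) ≈ ιℤ (F (toℕ i , n , 0)) * (X P ^ toℕ i * Y P ^ n)
        go′ _ ≡.refl = *-congˡ (*-congˡ (*-identityʳ (Y P ^ n)))

  module _ (S : Subfield L) where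
    open Subfield S

    ιℕ∈ : ∀ k → member (ιℤ (+ k))
    ιℕ∈ zero    = resp-≈ (sym ι-0) 0-closed
    ιℕ∈ (suc k) = resp-≈ (sym (trans (ιℤ-+ 1ℤ (+ k)) (+-congʳ ι-1))) (+-closed 1-closed (ιℕ∈ k))

    ιℤ∈ : ∀ k → member (ιℤ k)
    ιℤ∈ (+ k)    = ιℕ∈ k
    ιℤ∈ -[1+ k ] = resp-≈ (sym (ιℤ-neg (+ suc k))) (neg-closed (ιℕ∈ (suc k)))

    ι∈ : ∀ q → member (ι q)
    ι∈ q = let D = ιℤ (↧ q) ; D⁻¹ , e = inverse D (ιℤ≉0 (↧≢0 q)) in
      resp-≈ (cancelˡ (ιℤ≉0 (↧≢0 q)) (begin
        D * (ιℤ (↥ q) * D⁻¹)   ≈⟨ solve 3 (λ d x i → d :* (x :* i) := x :* (d :* i)) refl D (ιℤ (↥ q)) D⁻¹ ⟩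
        ιℤ (↥ q) * (D * D⁻¹)   ≈⟨ trans (*-congˡ e) (*-identityʳ _) ⟩
        ιℤ (↥ q)               ≈⟨ sym (trans (sym (ι-* (fromℤ (↧ q)) q)) (ι-cong (↧*p≡↥p q))) ⟩
        D * ι q                ∎)) (*-closed (ιℤ∈ (↥ q)) (inv-closed (ιℤ∈ (↧ q)) e))
      where open ≈R

    ^∈ : ∀ {x} → member x → ∀ n → member (x ^ n)
    ^∈ x∈ zero    = 1-closed
    ^∈ x∈ (suc n) = *-closed x∈ (^∈ x∈ n)

    sum∈ : ∀ {n} (t : Fin n → Carrier) → (∀ i → member (t i)) → member (sum t)
    sum∈ {zero}  t _ = 0-closed
    sum∈ {suc n} t h = +-closed (h zero) (sum∈ (t ∘ suc) (h ∘ suc))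

    generated-improper : (∀ i → member (basis i)) → ¬ IsProper
    generated-improper basis∈ (x , x∉) = x∉ (resp-≈ (sym (proj₂ (spanning x))) (sum∈ _ λ i → *-closed (ι∈ (proj₁ (spanning x) i)) (basis∈ i)))

  ιℤ-^ : ∀ k n → ιℤ (k ℤ.^ n) ≈ ιℤ k ^ n
  ιℤ-^ k zero    = ι-1
  ιℤ-^ k (suc n) = trans (ιℤ-* k (k ℤ.^ n)) (*-congˡ (ιℤ-^ k n))

-- The leading form and the new point of degree `m`

PrimeTo3-1+3 : ∀ s → PrimeTo3 (1ℤ ℤ.+ s ℤ.* + 3)
PrimeTo3-1+3 s = s ℤ.* + 2 ℤ.+ s ℤ.* s ℤ.* + 3 , square s
  where
  square : ∀ s → (1ℤ ℤ.+ s ℤ.* + 3) ℤ.* (1ℤ ℤ.+ s ℤ.* + 3) ≡ 1ℤ ℤ.+ (s ℤ.* + 2 ℤ.+ s ℤ.* s ℤ.* + 3) ℤ.* + 3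
  square = solve 1 (λ s → (con 1ℤ :+ s :* con (+ 3)) :* (con 1ℤ :+ s :* con (+ 3)) := con 1ℤ :+ (s :* con (+ 2) :+ s :* s :* con (+ 3)) :* con (+ 3)) ≡.refl
    where open ℤSolver

PrimeTo3-^ : ∀ {r} → PrimeTo3 r → ∀ n → PrimeTo3 (r ℤ.^ n)
PrimeTo3-^ p zero    = PrimeTo3-1
PrimeTo3-^ {r} p (suc n) = PrimeTo3-* {r} {r ℤ.^ n} p (PrimeTo3-^ {r} p n)

PrimeTo3⇒≢0 : ∀ {r} → PrimeTo3 r → r ≢ 0ℤ
PrimeTo3⇒≢0 {r} p r≡0 = PrimeTo3⇒3∤ {r} p (≡.subst ((+ 3) ℤ∣.∣_) (≡.sym r≡0) (divides 0ℤ ≡.refl))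

module Coefficients (m′ : ℕ) (f : ℤ[x,y]) (f≡ : CongruentToTarget (suc m′) f) where

  private m = suc m′

  leading : ℕ → ℤ
  leading i = coeff f i (m ∸ i)

  γ : ℤ
  γ = coeff f m 0

  γ-prime : PrimeTo3 γ
  γ-prime = let q , e = f≡ m 0 (ℕ.≤-reflexive (ℕ.+-identityʳ m)) in
    ≡.subst PrimeTo3 (≡.sym (≡.trans e (≡.trans (≡.cong (ℤ._+ q ℤ.* + 27) (target-x m′)) (≡.cong (λ w → 1ℤ ℤ.+ w) (≡.sym (ℤ.*-assoc q (+ 9) (+ 3))))))) (PrimeTo3-1+3 (q ℤ.* + 9))

  third : ∀ (i : Fin m) → ∃[ d ] leading (toℕ i) ≡ + 3 ℤ.* d
  third zero = let q , e = f≡ 0 m ℕ.≤-refl in 1ℤ ℤ.+ q ℤ.* + 9 ,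
    ≡.trans e (≡.trans (≡.cong (ℤ._+ q ℤ.* + 27) (target-y m′)) (rearrange q))
    where
    rearrange : ∀ q → + 3 ℤ.+ q ℤ.* + 27 ≡ + 3 ℤ.* (1ℤ ℤ.+ q ℤ.* + 9)
    rearrange = solve 1 (λ q → con (+ 3) :+ q :* con (+ 27) := con (+ 3) :* (con 1ℤ :+ q :* con (+ 9))) ≡.refl where open ℤSolver
  third (suc i) = let q , e = f≡ (suc (toℕ i)) (m′ ∸ toℕ i) (ℕ.≤-reflexive (≡.cong suc (ℕ.m+[n∸m]≡n (ℕ.<⇒≤ (Fin.toℕ<n i))))) in q ℤ.* + 9 ,
    ≡.trans e (≡.trans (≡.cong (ℤ._+ q ℤ.* + 27) (target-0 m (suc (toℕ i)) (m′ ∸ toℕ i) (inj₁ λ ()) (inj₁ λ e → ℕ.<-irrefl (ℕ.suc-injective e) (Fin.toℕ<n i)) (inj₁ λ ())))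
      (rearrange q))
    where
    rearrange : ∀ q → 0ℤ ℤ.+ q ℤ.* + 27 ≡ + 3 ℤ.* (q ℤ.* + 9)
    rearrange = solve 1 (λ q → con 0ℤ :+ q :* con (+ 27) := con (+ 3) :* (q :* con (+ 9))) ≡.refl where open ℤSolver

  -- The coefficients of the monic polynomial γᵐ⁻¹ fₘ(x/γ, 1), for fₘ the leading form of f.
  aᵢ : ℕ → ℤ
  aᵢ i = leading i ℤ.* γ ℤ.^ (m′ ∸ i)

  a b : Fin m → ℤ
  a i = aᵢ (toℕ i)
  b i = proj₁ (third i) ℤ.* γ ℤ.^ (m′ ∸ toℕ i)

  a≡3b : ∀ i → a i ≡ + 3 ℤ.* b i
  a≡3b i = ≡.trans (≡.cong (ℤ._* γ ℤ.^ (m′ ∸ toℕ i)) (proj₂ (third i))) (ℤ.*-assoc (+ 3) (proj₁ (third i)) (γ ℤ.^ (m′ ∸ toℕ i)))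

  -- The coefficient of yᵐ is 3(1 + 9q), divisible by 3 exactly once; this is the Eisenstein
  -- condition on the constant term.
  b₀-prime : PrimeTo3 (b zero)
  b₀-prime = PrimeTo3-* {proj₁ (third zero)} {γ ℤ.^ m′}
    (≡.subst PrimeTo3 (≡.cong (λ w → 1ℤ ℤ.+ w) (ℤ.*-assoc q (+ 3) (+ 3))) (PrimeTo3-1+3 (q ℤ.* + 3))) (PrimeTo3-^ {γ} γ-prime m′)
    where q = proj₁ (f≡ 0 m ℕ.≤-refl)

-- The line at infinity meets the curve in the roots of an Eisenstein polynomial.
module NewPoint (m′ : ℕ) (f : ℤ[x,y]) (f≡ : CongruentToTarget (suc m′) f) (L : NumberField) where

  private m = suc m′

  open Coefficients m′ f f≡ using (leading; γ; γ-prime; aᵢ)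
  open Field L
  open NumberField L using (sum)
  open PointAtInfinity L

  module _ (degree≡m : degree ≡ m) (α : Carrier) (basis≈ : ∀ i → basis i ≈ α ^ toℕ i)
    (root : α ^ m + sum {m} (λ i → ιℤ (aᵢ (toℕ i)) * α ^ toℕ i) ≈ 0#) where

    F : Form
    F = homogenize m f

    g : Carrier
    g = ιℤ γ

    g≉0 : ¬ g ≈ 0#
    g≉0 = ιℤ≉0 (PrimeTo3⇒≢0 {γ} γ-prime)

    -- Up to scaling (α/γ : 1 : 0), where α/γ is a root of the dehomogenised leading form.
    P : ProjectivePoint L
    P = record { X = α ; Y = g ; Z = 0# ; nonzero = λ { (_ , g≈0 , _) → g≉0 g≈0 } }

    F-leading : ∀ i → i ℕ.≤ m → F (i , m ∸ i , 0) ≡ leading i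
    F-leading i i≤m = homogenize-coeff m f i (m ∸ i) 0 (≡.trans (ℕ.+-identityʳ _) (ℕ.m+[n∸m]≡n i≤m))

    -- By homogeneity the value is γ times the monic polynomial at α: the power γᵐ⁻ⁱ splits as γ ·
    -- γᵐ⁻¹⁻ⁱ for i < m, and the top term is γαᵐ.
    on-curve : OnCurve L m F P
    on-curve = begin
      evaluate L m F P                                              ≈⟨ evaluate-Z≈0 m F P refl ⟩
      sum t                                                         ≈⟨ Σ′.sum-init-last t ⟩
      sum (t ∘ inject₁) + t (fromℕ m)                               ≈⟨ +-cong (trans (sum-cong {m} lower) (sym (*-sum {m} g (λ i → ιℤ (aᵢ (toℕ i)) * α ^ toℕ i)))) top ⟩
      g * sum {m} (λ i → ιℤ (aᵢ (toℕ i)) * α ^ toℕ i) + g * α ^ m          ≈⟨ trans (+-comm _ _) (sym (distribˡ g (α ^ m) _)) ⟩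
      g * (α ^ m + sum {m} (λ i → ιℤ (aᵢ (toℕ i)) * α ^ toℕ i))            ≈⟨ trans (*-congˡ root) (zeroʳ g) ⟩
      0#                                                            ∎
      where
      open ≈R
      t : Fin (suc m) → Carrier
      t i = ιℤ (F (toℕ i , m ∸ toℕ i , 0)) * (α ^ toℕ i * g ^ (m ∸ toℕ i))
      lower : ∀ i → t (inject₁ i) ≈ g * (ιℤ (aᵢ (toℕ i)) * α ^ toℕ i)
      lower i = go (toℕ (inject₁ i)) (Fin.toℕ-inject₁ i)
        where
        i≤m′ = ℕ.≤-pred (Fin.toℕ<n i)
        go : ∀ k → k ≡ toℕ i → ιℤ (F (k , m ∸ k , 0)) * (α ^ k * g ^ (m ∸ k)) ≈ g * (ιℤ (aᵢ (toℕ i)) * α ^ toℕ i)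
        go _ ≡.refl = begin
          ιℤ (F (toℕ i , m ∸ toℕ i , 0)) * (α ^ toℕ i * g ^ (m ∸ toℕ i))    ≈⟨ *-cong (ιℤ-cong (F-leading (toℕ i) (ℕ.m≤n⇒m≤1+n i≤m′))) (*-congˡ (reflexive (≡.cong (g ^_) (ℕ.+-∸-assoc 1 i≤m′)))) ⟩
          ιℤ (leading (toℕ i)) * (α ^ toℕ i * (g * g ^ (m′ ∸ toℕ i)))       ≈⟨ solve 4 (λ c x g h → c :* (x :* (g :* h)) := g :* (c :* h :* x)) refl (ιℤ (leading (toℕ i))) (α ^ toℕ i) g (g ^ (m′ ∸ toℕ i)) ⟩
          g * (ιℤ (leading (toℕ i)) * g ^ (m′ ∸ toℕ i) * α ^ toℕ i)         ≈⟨ *-congˡ (*-congʳ (sym (trans (ιℤ-* (leading (toℕ i)) (γ ℤ.^ (m′ ∸ toℕ i))) (*-congˡ (ιℤ-^ γ (m′ ∸ toℕ i)))))) ⟩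
          g * (ιℤ (aᵢ (toℕ i)) * α ^ toℕ i)                                        ∎
      top : t (fromℕ m) ≈ g * α ^ m
      top = go (toℕ (fromℕ m)) (Fin.toℕ-fromℕ m) (m ∸ toℕ (fromℕ m)) (≡.trans (≡.cong (m ∸_) (Fin.toℕ-fromℕ m)) (ℕ.n∸n≡0 m))
        where
        go : ∀ k → k ≡ m → ∀ l → l ≡ 0 → ιℤ (F (k , l , 0)) * (α ^ k * g ^ l) ≈ g * α ^ m
        go _ ≡.refl _ ≡.refl = *-cong (ιℤ-cong (homogenize-coeff m f m 0 0 (≡.trans (ℕ.+-identityʳ _) (ℕ.+-identityʳ m)))) (*-identityʳ (α ^ m))

    sum-reindex : ∀ {n n′} → n ≡ n′ → (h : ℕ → Carrier) → sum {n} (λ i → h (toℕ i)) ≈ sum {n′} (λ i → h (toℕ i))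
    sum-reindex ≡.refl h = refl

    -- The x-derivative at the point is a polynomial in α of degree m - 1 with top coefficient mγ.
    -- It cannot vanish because the powers of α below the `m`-th are independent.
    nonsingular : ¬ IsSingular L m F P
    nonsingular (∂x≈0 , _) = nonzero (fromℤ-injective (≡.trans (≡.cong (fromℤ ∘ d) (≡.sym (Fin.toℕ-fromℕ< m′<n))) (independent (λ i → fromℤ (d (toℕ i))) sum≈0 (Fin.fromℕ< m′<n))))
      where
      open ≈R
      m′<n : m′ ℕ.< degree
      m′<n = ≡.subst (m′ ℕ.<_) (≡.sym degree≡m) ℕ.≤-refl
      d : ℕ → ℤ
      d i = + suc i ℤ.* F (suc i , m′ ∸ i , 0) ℤ.* γ ℤ.^ (m′ ∸ i)
      sum≈0 : sum (λ i → ι (fromℤ (d (toℕ i))) * basis i) ≈ 0#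
      sum≈0 = begin
        sum (λ i → ιℤ (d (toℕ i)) * basis i)               ≈⟨ sum-cong (λ i → *-congˡ {ιℤ (d (toℕ i))} (basis≈ i)) ⟩
        sum {degree} (λ i → ιℤ (d (toℕ i)) * α ^ toℕ i)    ≈⟨ sum-reindex degree≡m (λ i → ιℤ (d i) * α ^ i) ⟩
        sum {m} (λ i → ιℤ (d (toℕ i)) * α ^ toℕ i)         ≈⟨ sum-cong {m} (λ i → sym (term (toℕ i))) ⟩
        sum {m} (λ i → ιℤ (∂x F (toℕ i , m′ ∸ toℕ i , 0)) * (α ^ toℕ i * g ^ (m′ ∸ toℕ i)))   ≈⟨ sym (evaluate-Z≈0 m′ (∂x F) P refl) ⟩
        evaluate L m′ (∂x F) P                             ≈⟨ ∂x≈0 ⟩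
        0#                                                 ∎
        where
        term : ∀ i → ιℤ (∂x F (i , m′ ∸ i , 0)) * (α ^ i * g ^ (m′ ∸ i)) ≈ ιℤ (d i) * α ^ i
        term i = begin
          ιℤ c * (α ^ i * g ^ n)       ≈⟨ solve 3 (λ c x h → c :* (x :* h) := c :* h :* x) refl (ιℤ c) (α ^ i) (g ^ n) ⟩
          ιℤ c * g ^ n * α ^ i         ≈⟨ *-congʳ (sym (trans (ιℤ-* c (γ ℤ.^ n)) (*-congˡ (ιℤ-^ γ n)))) ⟩
          ιℤ (c ℤ.* γ ℤ.^ n) * α ^ i   ∎
          where
          n = m′ ∸ i
          c = ∂x F (i , n , 0)
      nonzero : d m′ ≢ 0ℤ
      nonzero = go (m′ ∸ m′) (ℕ.n∸n≡0 m′)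
        where
        γ≢0 : F (suc m′ , 0 , 0) ≢ 0ℤ
        γ≢0 p = PrimeTo3⇒≢0 {γ} γ-prime (≡.trans (≡.sym (homogenize-coeff m f m 0 0 (≡.trans (ℕ.+-identityʳ _) (ℕ.+-identityʳ m)))) p)
        go : ∀ l → l ≡ 0 → + suc m′ ℤ.* F (suc m′ , l , 0) ℤ.* γ ℤ.^ l ≢ 0ℤ
        go _ ≡.refl e = γ≢0 (ℤ.*-cancelˡ-≡ (+ suc m′) (F (suc m′ , 0 , 0)) 0ℤ
            (≡.trans (≡.sym (ℤ.*-identityʳ (+ suc m′ ℤ.* F (suc m′ , 0 , 0)))) (≡.trans e (≡.sym (ℤ.*-zeroʳ (+ suc m′))))))

    -- The subfield contains cα/(cγ) and γ, hence α, whose powers form a basis of `L`.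
    not-over-subfield : ¬ (Σ (Subfield L) λ K → Subfield.IsProper K × DefinedOver L K P)
    not-over-subfield (K , proper , c , c≉0 , cα∈ , cg∈ , _) = generated-improper K (λ i → Subfield.resp-≈ K (sym (basis≈ i)) (^∈ K α∈ (toℕ i))) proper
      where
      open Subfield K
      open ≈R
      cg≉0 : ¬ c * g ≈ 0#
      cg≉0 e = g≉0 (xy≈0⇒y≈0 c≉0 e)
      w = proj₁ (inverse (c * g) cg≉0)
      α∈ : member α
      α∈ = resp-≈ (begin
        c * α * w * g     ≈⟨ solve 4 (λ c x w g → c :* x :* w :* g := c :* g :* w :* x) refl c α w g ⟩
        c * g * w * α     ≈⟨ trans (*-congʳ (proj₂ (inverse (c * g) cg≉0))) (*-identityˡ α) ⟩
        α                 ∎) (*-closed (*-closed cα∈ (inv-closed cg∈ (proj₂ (inverse (c * g) cg≉0)))) (ιℤ∈ K γ))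

    m∈D : D m f m
    m∈D = L , degree≡m , P , on-curve , nonsingular , not-over-subfield

-- Since `m` is itself a degree of a new point and divides all the others, the gcd is attained.
index : ∀ m → 1 ℕ.≤ m → ∀ f → CongruentToTarget m f → IsIndex m f m
index m@(suc m′) 1≤m f f≡ = ∣D m 1≤m f f≡ , λ c c∣D → c∣D m (NewPoint.m∈D m′ f f≡ E.field-extension ≡.refl E.α (λ _ _ _ → ≡.refl) E.α-root)
  where
  open Coefficients m′ f f≡
  module E = Eisenstein m′ a b a≡3b b₀-prime

-- The Newton polytope

open import Relation.Unary using (_⊆_; _∩_)

*-nonneg : ∀ {p q} → 0ℚ ℚ.≤ p → 0ℚ ℚ.≤ q → 0ℚ ℚ.≤ p ℚ.* q
*-nonneg {p} {q} 0≤p 0≤q = ℚ.≤-trans (ℚ.≤-reflexive (≡.sym (ℚ.*-zeroʳ p))) (ℚ.*-monoˡ-≤-nonNeg p {{ℚ.nonNegative 0≤p}} 0≤q)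

+-nonneg : ∀ {p q} → 0ℚ ℚ.≤ p → 0ℚ ℚ.≤ q → 0ℚ ℚ.≤ p ℚ.+ q
+-nonneg 0≤p 0≤q = ℚ.+-mono-≤ 0≤p 0≤q

sum-nonneg : ∀ {n} (p : Fin n → ℚ) → (∀ i → 0ℚ ℚ.≤ p i) → 0ℚ ℚ.≤ sumℚ p
sum-nonneg {zero}  p _ = ℚ.≤-refl
sum-nonneg {suc n} p h = +-nonneg (h zero) (sum-nonneg (p ∘ suc) (h ∘ suc))

-‿nonneg : ∀ {p q} → p ℚ.≤ q → 0ℚ ℚ.≤ q ℚ.- p
-‿nonneg {p} {q} p≤q = ℚ.≤-trans (ℚ.≤-reflexive (≡.sym (ℚ.+-inverseʳ p))) (ℚ.+-monoˡ-≤ (ℚ.- p) p≤q)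

nonneg-sum≡0 : ∀ {p q} → 0ℚ ℚ.≤ p → 0ℚ ℚ.≤ q → p ℚ.+ q ≡ 0ℚ → p ≡ 0ℚ
nonneg-sum≡0 {p} {q} 0≤p 0≤q e = ℚ.≤-antisym (ℚ.≤-trans (ℚ.≤-reflexive (≡.sym (ℚ.+-identityʳ p))) (ℚ.≤-trans (ℚ.+-monoʳ-≤ p 0≤q) (ℚ.≤-reflexive e))) 0≤p

toℚ-nonneg : ∀ n → 0ℚ ℚ.≤ toℚ n
toℚ-nonneg zero    = ℚ.≤-refl
toℚ-nonneg (suc n) = ℚ.≤-trans (+-nonneg {1ℚ} (ℚ.nonNegative⁻¹ 1ℚ) (toℚ-nonneg n)) (ℚ.≤-reflexive (≡.sym (fromℤ-homo-+ 1ℤ (+ n))))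

convex-zero : ∀ {t x y} → 0ℚ ℚ.< t → t ℚ.< 1ℚ → 0ℚ ℚ.≤ x → 0ℚ ℚ.≤ y → 0ℚ ≡ t ℚ.* x ℚ.+ (1ℚ ℚ.- t) ℚ.* y → x ≡ 0ℚ × y ≡ 0ℚ
convex-zero {t} {x} {y} 0<t t<1 0≤x 0≤y e =
  p*q≡0⇒q≡0 (ℚ.<⇒≢ 0<t ∘ ≡.sym) (nonneg-sum≡0 tx≥0 sy≥0 (≡.sym e)) ,
  p*q≡0⇒q≡0 s≢0 (nonneg-sum≡0 sy≥0 tx≥0 (≡.trans (ℚ.+-comm ((1ℚ ℚ.- t) ℚ.* y) (t ℚ.* x)) (≡.sym e)))
  where
  tx≥0 = *-nonneg (ℚ.<⇒≤ 0<t) 0≤x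
  sy≥0 = *-nonneg (-‿nonneg (ℚ.<⇒≤ t<1)) 0≤y
  s≢0 : 1ℚ ℚ.- t ≢ 0ℚ
  s≢0 p = ℚ.<⇒≢ t<1 (≡.trans (≡.sym (≡.trans (≡.cong (ℚ._+ t) p) (ℚ.+-identityˡ t))) (restore t))
    where
    restore : ∀ t → 1ℚ ℚ.- t ℚ.+ t ≡ 1ℚ
    restore = solve 1 (λ t → con 1ℚ :- t :+ t := con 1ℚ) ≡.refl where open ℚSolver

module _ (m : ℕ) (1≤m : 1 ℕ.≤ m) where

  private
    M = toℚ m

  M≢0 : M ≢ 0ℚ
  M≢0 p = ℕ.<-irrefl (≡.sym (fromℤ-0 (fromℤ-injective {+ m} {0ℤ} p))) 1≤m
    where
    fromℤ-0 : + m ≡ 0ℤ → m ≡ 0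
    fromℤ-0 ≡.refl = ≡.refl

  private
    swap : ∀ x y z → x ℚ.+ z ℚ.+ y ≡ x ℚ.+ y ℚ.+ z
    swap = solve 3 (λ x y z → x :+ z :+ y := x :+ y :+ z) ≡.refl where open ℚSolver
    rotate : ∀ x y z → x ℚ.+ y ℚ.+ z ≡ z ℚ.+ x ℚ.+ y
    rotate = solve 3 (λ x y z → x :+ y :+ z := z :+ x :+ y) ≡.refl where open ℚSolver

  private
    p-sum₁ : ∀ x y z → x ℚ.+ x ℚ.+ (y ℚ.- x) ℚ.+ z ≡ x ℚ.+ y ℚ.+ z
    p-sum₁ = solve 3 (λ x y z → x :+ x :+ (y :- x) :+ z := x :+ y :+ z) ≡.refl where open ℚSolver
    q-sum₁ : ∀ x y z → 0ℚ ℚ.+ (x ℚ.+ y) ℚ.+ z ≡ x ℚ.+ y ℚ.+ z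
    q-sum₁ = solve 3 (λ x y z → con 0ℚ :+ (x :+ y) :+ z := x :+ y :+ z) ≡.refl where open ℚSolver
    mid-x₁ : ∀ x → x ≡ ½ ℚ.* (x ℚ.+ x) ℚ.+ (1ℚ ℚ.- ½) ℚ.* 0ℚ
    mid-x₁ = solve 1 (λ x → x := con ½ :* (x :+ x) :+ con (1ℚ ℚ.- ½) :* con 0ℚ) ≡.refl where open ℚSolver
    mid-y₁ : ∀ x y → y ≡ ½ ℚ.* (y ℚ.- x) ℚ.+ (1ℚ ℚ.- ½) ℚ.* (x ℚ.+ y)
    mid-y₁ = solve 2 (λ x y → y := con ½ :* (y :- x) :+ con (1ℚ ℚ.- ½) :* (x :+ y)) ≡.refl where open ℚSolver
    mid-z : ∀ z → z ≡ ½ ℚ.* z ℚ.+ (1ℚ ℚ.- ½) ℚ.* z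
    mid-z = solve 1 (λ z → z := con ½ :* z :+ con (1ℚ ℚ.- ½) :* z) ≡.refl where open ℚSolver
    p-sum₂ : ∀ x y z → x ℚ.+ y ℚ.+ 0ℚ ℚ.+ z ≡ x ℚ.+ y ℚ.+ z
    p-sum₂ = solve 3 (λ x y z → x :+ y :+ con 0ℚ :+ z := x :+ y :+ z) ≡.refl where open ℚSolver
    q-sum₂ : ∀ x y z → x ℚ.- y ℚ.+ (y ℚ.+ y) ℚ.+ z ≡ x ℚ.+ y ℚ.+ z
    q-sum₂ = solve 3 (λ x y z → x :- y :+ (y :+ y) :+ z := x :+ y :+ z) ≡.refl where open ℚSolver
    mid-x₂ : ∀ x y → x ≡ ½ ℚ.* (x ℚ.+ y) ℚ.+ (1ℚ ℚ.- ½) ℚ.* (x ℚ.- y)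
    mid-x₂ = solve 2 (λ x y → x := con ½ :* (x :+ y) :+ con (1ℚ ℚ.- ½) :* (x :- y)) ≡.refl where open ℚSolver
    mid-y₂ : ∀ y → y ≡ ½ ℚ.* 0ℚ ℚ.+ (1ℚ ℚ.- ½) ℚ.* (y ℚ.+ y)
    mid-y₂ = solve 1 (λ y → y := con ½ :* con 0ℚ :+ con (1ℚ ℚ.- ½) :* (y :+ y)) ≡.refl where open ℚSolver
    ½<1 : ½ ℚ.< 1ℚ
    ½<1 = ℚ.*<* (ℤ.+<+ (s≤s (s≤s z≤n)))

  Simplex : ℚ³ → Set
  Simplex (x , y , z) = 0ℚ ℚ.≤ x × 0ℚ ℚ.≤ y × 0ℚ ℚ.≤ z × x ℚ.+ y ℚ.+ z ≡ M

  module _ (S : Pred Exponent 0ℓ) (S-x : S (m , 0 , 0)) (S-y : S (0 , m , 0)) (S-z : S (0 , 0 , m)) (S⊆ : S ⊆ 𝓜₃ m) where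

    hull⇒simplex : ∀ {v} → ConvexHull S v → Simplex v
    hull⇒simplex (n , w , s , 0≤w , s∈S , Σw≡1 , ≡.refl) =
      sum-nonneg (λ i → w i ℚ.* toℚ (x i)) (λ i → *-nonneg (0≤w i) (toℚ-nonneg (x i))) , 
      sum-nonneg (λ i → w i ℚ.* toℚ (y i)) (λ i → *-nonneg (0≤w i) (toℚ-nonneg (y i))) , 
      sum-nonneg (λ i → w i ℚ.* toℚ (z i)) (λ i → *-nonneg (0≤w i) (toℚ-nonneg (z i))) , (begin
      sumℚ (λ i → w i ℚ.* toℚ (x i)) ℚ.+ sumℚ (λ i → w i ℚ.* toℚ (y i)) ℚ.+ sumℚ (λ i → w i ℚ.* toℚ (z i))
        ≡⟨ ≡.sym (≡.trans (ℚΣ.∑-distrib-+ (λ i → w i ℚ.* toℚ (x i) ℚ.+ w i ℚ.* toℚ (y i)) (λ i → w i ℚ.* toℚ (z i)))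
             (≡.cong (ℚ._+ sumℚ (λ i → w i ℚ.* toℚ (z i))) (ℚΣ.∑-distrib-+ (λ i → w i ℚ.* toℚ (x i)) (λ i → w i ℚ.* toℚ (y i))))) ⟩
      sumℚ (λ i → w i ℚ.* toℚ (x i) ℚ.+ w i ℚ.* toℚ (y i) ℚ.+ w i ℚ.* toℚ (z i))
        ≡⟨ ℚΣ.sum-cong-≗ (λ i → ≡.trans (distribute (w i) (toℚ (x i)) (toℚ (y i)) (toℚ (z i))) (≡.cong (w i ℚ.*_) (exponent-sum i))) ⟩
      sumℚ (λ i → w i ℚ.* M)
        ≡⟨ ≡.sym (ℚΣ.*-distribʳ-sum M w) ⟩
      sumℚ w ℚ.* M
        ≡⟨ ≡.trans (≡.cong (ℚ._* M) Σw≡1) (ℚ.*-identityˡ M) ⟩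
      M ∎)
      where
      open ≡.≡-Reasoning
      x y z : Fin n → ℕ
      x i = proj₁ (s i)
      y i = proj₁ (proj₂ (s i))
      z i = proj₂ (proj₂ (s i))
      distribute : ∀ w a b c → w ℚ.* a ℚ.+ w ℚ.* b ℚ.+ w ℚ.* c ≡ w ℚ.* (a ℚ.+ b ℚ.+ c)
      distribute = solve 4 (λ w a b c → w :* a :+ w :* b :+ w :* c := w :* (a :+ b :+ c)) ≡.refl where open ℚSolver
      exponent-sum : ∀ i → toℚ (x i) ℚ.+ toℚ (y i) ℚ.+ toℚ (z i) ≡ M
      exponent-sum i = ≡.trans (≡.cong (ℚ._+ toℚ (z i)) (≡.sym (fromℤ-homo-+ (+ x i) (+ y i)))) (≡.trans (≡.sym (fromℤ-homo-+ (+ x i ℤ.+ + y i) (+ z i))) (≡.cong toℚ (S⊆ (s∈S i))))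

    -- The barycentric coordinates x/m, y/m, z/m serve as weights at the three corners.
    simplex⇒hull : ∀ {v} → Simplex v → ConvexHull S v
    simplex⇒hull {x , y , z} (0≤x , 0≤y , 0≤z , Σ≡M) = 3 , w , s , 0≤w , s∈S , Σw≡1 , ≡.cong₂ _,_ eq-x (≡.cong₂ _,_ eq-y eq-z)
      where
      M-positive : ℚ.Positive M
      M-positive = ℚ.positive (ℚ.≰⇒> λ M≤0 → M≢0 (ℚ.≤-antisym M≤0 (toℚ-nonneg m)))
      instance _ = ℚ.pos⇒nonZero M {{M-positive}}
      r = ℚ.1/ M
      0≤r : 0ℚ ℚ.≤ r
      0≤r = ℚ.<⇒≤ (ℚ.positive⁻¹ r {{ℚ.1/pos⇒pos M {{M-positive}}}})
      w : Fin 3 → ℚ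
      w zero             = x ℚ.* r
      w (suc zero)       = y ℚ.* r
      w (suc (suc zero)) = z ℚ.* r
      s : Fin 3 → Exponent
      s zero             = m , 0 , 0
      s (suc zero)       = 0 , m , 0
      s (suc (suc zero)) = 0 , 0 , m
      0≤w : ∀ i → 0ℚ ℚ.≤ w i
      0≤w zero             = *-nonneg 0≤x 0≤r
      0≤w (suc zero)       = *-nonneg 0≤y 0≤r
      0≤w (suc (suc zero)) = *-nonneg 0≤z 0≤r
      s∈S : ∀ i → S (s i)
      s∈S zero             = S-x
      s∈S (suc zero)       = S-y
      s∈S (suc (suc zero)) = S-z
      Σw≡1 : sumℚ w ≡ 1ℚ
      Σw≡1 = ≡.trans (factor x y z r) (≡.trans (≡.cong (ℚ._* r) Σ≡M) (ℚ.*-inverseʳ M))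
        where
        factor : ∀ x y z r → x ℚ.* r ℚ.+ (y ℚ.* r ℚ.+ (z ℚ.* r ℚ.+ 0ℚ)) ≡ (x ℚ.+ y ℚ.+ z) ℚ.* r
        factor = solve 4 (λ x y z r → x :* r :+ (y :* r :+ (z :* r :+ con 0ℚ)) := (x :+ y :+ z) :* r) ≡.refl where open ℚSolver
      unscale : ∀ x → x ℚ.* (r ℚ.* M) ≡ x
      unscale x = ≡.trans (≡.cong (x ℚ.*_) (ℚ.*-inverseˡ M)) (ℚ.*-identityʳ x)
      eq-x : x ≡ x ℚ.* r ℚ.* M ℚ.+ (y ℚ.* r ℚ.* 0ℚ ℚ.+ (z ℚ.* r ℚ.* 0ℚ ℚ.+ 0ℚ))
      eq-x = ≡.sym (≡.trans (drop x y z r M) (unscale x))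
        where
        drop : ∀ x y z r M → x ℚ.* r ℚ.* M ℚ.+ (y ℚ.* r ℚ.* 0ℚ ℚ.+ (z ℚ.* r ℚ.* 0ℚ ℚ.+ 0ℚ)) ≡ x ℚ.* (r ℚ.* M)
        drop = solve 5 (λ x y z r M → x :* r :* M :+ (y :* r :* con 0ℚ :+ (z :* r :* con 0ℚ :+ con 0ℚ)) := x :* (r :* M)) ≡.refl where open ℚSolver
      eq-y : y ≡ x ℚ.* r ℚ.* 0ℚ ℚ.+ (y ℚ.* r ℚ.* M ℚ.+ (z ℚ.* r ℚ.* 0ℚ ℚ.+ 0ℚ))
      eq-y = ≡.sym (≡.trans (drop x y z r M) (unscale y))
        where
        drop : ∀ x y z r M → x ℚ.* r ℚ.* 0ℚ ℚ.+ (y ℚ.* r ℚ.* M ℚ.+ (z ℚ.* r ℚ.* 0ℚ ℚ.+ 0ℚ)) ≡ y ℚ.* (r ℚ.* M)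
        drop = solve 5 (λ x y z r M → x :* r :* con 0ℚ :+ (y :* r :* M :+ (z :* r :* con 0ℚ :+ con 0ℚ)) := y :* (r :* M)) ≡.refl where open ℚSolver
      eq-z : z ≡ x ℚ.* r ℚ.* 0ℚ ℚ.+ (y ℚ.* r ℚ.* 0ℚ ℚ.+ (z ℚ.* r ℚ.* M ℚ.+ 0ℚ))
      eq-z = ≡.sym (≡.trans (drop x y z r M) (unscale z))
        where
        drop : ∀ x y z r M → x ℚ.* r ℚ.* 0ℚ ℚ.+ (y ℚ.* r ℚ.* 0ℚ ℚ.+ (z ℚ.* r ℚ.* M ℚ.+ 0ℚ)) ≡ z ℚ.* (r ℚ.* M)
        drop = solve 5 (λ x y z r M → x :* r :* con 0ℚ :+ (y :* r :* con 0ℚ :+ (z :* r :* M :+ con 0ℚ)) := z :* (r :* M)) ≡.refl where open ℚSolver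

    -- E permutes the coordinates; a point with two positive coordinates is the midpoint
    -- of a segment inside the simplex.
    two-coordinates : (E : ℚ → ℚ → ℚ → ℚ³) → (∀ {x y z} → 0ℚ ℚ.≤ x → 0ℚ ℚ.≤ y → 0ℚ ℚ.≤ z → x ℚ.+ y ℚ.+ z ≡ M → Simplex (E x y z)) →
      (∀ {x y z x′ y′ z′} → E x y z ≡ E x′ y′ z′ → x ≡ x′ × y ≡ y′) →
      (∀ {x y z x₁ y₁ z₁ x₂ y₂ z₂} → x ≡ ½ ℚ.* x₁ ℚ.+ (1ℚ ℚ.- ½) ℚ.* x₂ → y ≡ ½ ℚ.* y₁ ℚ.+ (1ℚ ℚ.- ½) ℚ.* y₂ → z ≡ ½ ℚ.* z₁ ℚ.+ (1ℚ ℚ.- ½) ℚ.* z₂ →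
        E x y z ≡ (½ ·³ E x₁ y₁ z₁) +³ ((1ℚ ℚ.- ½) ·³ E x₂ y₂ z₂)) →
      ∀ {x y z} → 0ℚ ℚ.≤ x → 0ℚ ℚ.≤ y → 0ℚ ℚ.≤ z → x ℚ.+ y ℚ.+ z ≡ M → IsExtremePoint (ConvexHull S) (E x y z) → x ≢ 0ℚ → y ≡ 0ℚ
    two-coordinates E simplex injective midpoint {x} {y} {z} 0≤x 0≤y 0≤z Σ≡M (_ , extreme) x≢0 = by (ℚ.≤-total x y)
      where
      by : x ℚ.≤ y ⊎ y ℚ.≤ x → y ≡ 0ℚ
      -- The segment runs in the direction (1, -1, 0), by the smaller of x and y to either side of
      -- the point. Equality of its ends makes twice that coordinate zero.
      by (inj₁ x≤y) = ⊥-elim (x≢0 (nonneg-sum≡0 0≤x 0≤x (proj₁ (injective (extreme (E (x ℚ.+ x) (y ℚ.- x) z) (E 0ℚ (x ℚ.+ y) z) ½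
          (simplex⇒hull (simplex (+-nonneg 0≤x 0≤x) (-‿nonneg x≤y) 0≤z (≡.trans (p-sum₁ x y z) Σ≡M)))
          (simplex⇒hull (simplex ℚ.≤-refl (+-nonneg 0≤x 0≤y) 0≤z (≡.trans (q-sum₁ x y z) Σ≡M)))
          (ℚ.positive⁻¹ ½) ½<1 (midpoint (mid-x₁ x) (mid-y₁ x y) (mid-z z)))))))
      by (inj₂ y≤x) = nonneg-sum≡0 0≤y 0≤y (≡.sym (proj₂ (injective (extreme (E (x ℚ.+ y) 0ℚ z) (E (x ℚ.- y) (y ℚ.+ y) z) ½
          (simplex⇒hull (simplex (+-nonneg 0≤x 0≤y) ℚ.≤-refl 0≤z (≡.trans (p-sum₂ x y z) Σ≡M)))
          (simplex⇒hull (simplex (-‿nonneg y≤x) (+-nonneg 0≤y 0≤y) 0≤z (≡.trans (q-sum₂ x y z) Σ≡M)))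
          (ℚ.positive⁻¹ ½) ½<1 (midpoint (mid-x₂ x y) (mid-y₂ y) (mid-z z))))))

    extreme⇒vertex : ∀ v → IsExtremePoint (ConvexHull S) v → ∃[ e ] e ∈ᴸ H m × v ≡ toℚ³ e
    extreme⇒vertex (x , y , z) ext = by (hull⇒simplex (proj₁ ext)) (x ℚ.≟ 0ℚ) (y ℚ.≟ 0ℚ)
      where
      only-x : y ≡ 0ℚ → z ≡ 0ℚ → x ℚ.+ y ℚ.+ z ≡ M → x ≡ M
      only-x y≡0 z≡0 Σ≡M = ≡.trans (≡.sym (≡.trans (≡.cong₂ (λ p q → x ℚ.+ p ℚ.+ q) y≡0 z≡0) (≡.trans (ℚ.+-identityʳ (x ℚ.+ 0ℚ)) (ℚ.+-identityʳ x)))) Σ≡M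
      only-y : x ≡ 0ℚ → z ≡ 0ℚ → x ℚ.+ y ℚ.+ z ≡ M → y ≡ M
      only-y x≡0 z≡0 Σ≡M = ≡.trans (≡.sym (≡.trans (≡.cong₂ (λ p q → p ℚ.+ y ℚ.+ q) x≡0 z≡0) (≡.trans (ℚ.+-identityʳ (0ℚ ℚ.+ y)) (ℚ.+-identityˡ y)))) Σ≡M
      only-z : x ≡ 0ℚ → y ≡ 0ℚ → x ℚ.+ y ℚ.+ z ≡ M → z ≡ M
      only-z x≡0 y≡0 Σ≡M = ≡.trans (≡.sym (≡.trans (≡.cong₂ (λ p q → p ℚ.+ q ℚ.+ z) x≡0 y≡0) (ℚ.+-identityˡ z))) Σ≡M
      x≢0⇒y≡0 : Simplex (x , y , z) → x ≢ 0ℚ → y ≡ 0ℚ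
      x≢0⇒y≡0 (0≤x , 0≤y , 0≤z , Σ≡M) = two-coordinates (λ x y z → x , y , z) (λ p q r e → p , q , r , e) (λ { ≡.refl → ≡.refl , ≡.refl })
        (λ { ≡.refl ≡.refl ≡.refl → ≡.refl }) {x} {y} {z} 0≤x 0≤y 0≤z Σ≡M ext
      x≢0⇒z≡0 : Simplex (x , y , z) → x ≢ 0ℚ → z ≡ 0ℚ
      x≢0⇒z≡0 (0≤x , 0≤y , 0≤z , Σ≡M) = two-coordinates (λ x z y → x , y , z) (λ {a} {b} {c} p q r e → p , r , q , ≡.trans (swap a b c) e) (λ { ≡.refl → ≡.refl , ≡.refl })
        (λ { ≡.refl ≡.refl ≡.refl → ≡.refl }) {x} {z} {y} 0≤x 0≤z 0≤y (≡.trans (swap x y z) Σ≡M) ext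
      y≢0⇒z≡0 : Simplex (x , y , z) → y ≢ 0ℚ → z ≡ 0ℚ
      y≢0⇒z≡0 (0≤x , 0≤y , 0≤z , Σ≡M) = two-coordinates (λ y z x → x , y , z) (λ {a} {b} {c} p q r e → r , p , q , ≡.trans (≡.sym (rotate a b c)) e) (λ { ≡.refl → ≡.refl , ≡.refl })
        (λ { ≡.refl ≡.refl ≡.refl → ≡.refl }) {y} {z} {x} 0≤y 0≤z 0≤x (≡.trans (rotate y z x) Σ≡M) ext
      by : Simplex (x , y , z) → Dec (x ≡ 0ℚ) → Dec (y ≡ 0ℚ) → ∃[ e ] e ∈ᴸ H m × (x , y , z) ≡ toℚ³ e
      by s@(_ , _ , _ , Σ≡M) (no x≢0) _ = (m , 0 , 0) , there (there (here ≡.refl)) ,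
        ≡.cong₂ _,_ (only-x (x≢0⇒y≡0 s x≢0) (x≢0⇒z≡0 s x≢0) Σ≡M) (≡.cong₂ _,_ (x≢0⇒y≡0 s x≢0) (x≢0⇒z≡0 s x≢0))
      by s@(_ , _ , _ , Σ≡M) (yes x≡0) (no y≢0) = (0 , m , 0) , there (here ≡.refl) ,
        ≡.cong₂ _,_ x≡0 (≡.cong₂ _,_ (only-y x≡0 (y≢0⇒z≡0 s y≢0) Σ≡M) (y≢0⇒z≡0 s y≢0))
      by (_ , _ , _ , Σ≡M) (yes x≡0) (yes y≡0) = (0 , 0 , m) , here ≡.refl , ≡.cong₂ _,_ x≡0 (≡.cong₂ _,_ y≡0 (only-z x≡0 y≡0 Σ≡M))

    -- Two coordinates of a corner vanish. On a segment through it they vanish at both ends, being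
    -- nonnegative, and the remaining coordinate is forced by the sum.
    vertex⇒extreme : ∀ e → e ∈ᴸ H m → IsExtremePoint (ConvexHull S) (toℚ³ e)
    vertex⇒extreme e (here ≡.refl) = simplex⇒hull (ℚ.≤-refl , ℚ.≤-refl , toℚ-nonneg m , ℚ.+-identityˡ M) , λ p q t p∈ q∈ 0<t t<1 eq →
      let 0≤p₁ , 0≤p₂ , _ , Σp = hull⇒simplex p∈ ; 0≤q₁ , 0≤q₂ , _ , Σq = hull⇒simplex q∈
          p₁≡0 , q₁≡0 = convex-zero 0<t t<1 0≤p₁ 0≤q₁ (≡.cong proj₁ eq)
          p₂≡0 , q₂≡0 = convex-zero 0<t t<1 0≤p₂ 0≤q₂ (≡.cong (proj₁ ∘ proj₂) eq)
      in ≡.cong₂ _,_ (≡.trans p₁≡0 (≡.sym q₁≡0)) (≡.cong₂ _,_ (≡.trans p₂≡0 (≡.sym q₂≡0))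
           (≡.trans (third p₁≡0 p₂≡0 Σp) (≡.sym (third q₁≡0 q₂≡0 Σq))))
      where
      third : ∀ {x y z} → x ≡ 0ℚ → y ≡ 0ℚ → x ℚ.+ y ℚ.+ z ≡ M → z ≡ M
      third {z = z} ≡.refl ≡.refl e = ≡.trans (≡.sym (ℚ.+-identityˡ z)) e
    vertex⇒extreme e (there (here ≡.refl)) = simplex⇒hull (ℚ.≤-refl , toℚ-nonneg m , ℚ.≤-refl , ≡.trans (ℚ.+-identityʳ (0ℚ ℚ.+ M)) (ℚ.+-identityˡ M)) , λ p q t p∈ q∈ 0<t t<1 eq →
      let 0≤p₁ , _ , 0≤p₃ , Σp = hull⇒simplex p∈ ; 0≤q₁ , _ , 0≤q₃ , Σq = hull⇒simplex q∈
          p₁≡0 , q₁≡0 = convex-zero 0<t t<1 0≤p₁ 0≤q₁ (≡.cong proj₁ eq)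
          p₃≡0 , q₃≡0 = convex-zero 0<t t<1 0≤p₃ 0≤q₃ (≡.cong (proj₂ ∘ proj₂) eq)
      in ≡.cong₂ _,_ (≡.trans p₁≡0 (≡.sym q₁≡0)) (≡.cong₂ _,_
           (≡.trans (second p₁≡0 p₃≡0 Σp) (≡.sym (second q₁≡0 q₃≡0 Σq))) (≡.trans p₃≡0 (≡.sym q₃≡0)))
      where
      second : ∀ {x y z} → x ≡ 0ℚ → z ≡ 0ℚ → x ℚ.+ y ℚ.+ z ≡ M → y ≡ M
      second {y = y} ≡.refl ≡.refl e = ≡.trans (≡.sym (≡.trans (ℚ.+-identityʳ (0ℚ ℚ.+ y)) (ℚ.+-identityˡ y))) e
    vertex⇒extreme e (there (there (here ≡.refl))) = simplex⇒hull (toℚ-nonneg m , ℚ.≤-refl , ℚ.≤-refl , ≡.trans (ℚ.+-identityʳ (M ℚ.+ 0ℚ)) (ℚ.+-identityʳ M)) , λ p q t p∈ q∈ 0<t t<1 eq →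
      let _ , 0≤p₂ , 0≤p₃ , Σp = hull⇒simplex p∈ ; _ , 0≤q₂ , 0≤q₃ , Σq = hull⇒simplex q∈
          p₂≡0 , q₂≡0 = convex-zero 0<t t<1 0≤p₂ 0≤q₂ (≡.cong (proj₁ ∘ proj₂) eq)
          p₃≡0 , q₃≡0 = convex-zero 0<t t<1 0≤p₃ 0≤q₃ (≡.cong (proj₂ ∘ proj₂) eq)
      in ≡.cong₂ _,_ (≡.trans (first p₂≡0 p₃≡0 Σp) (≡.sym (first q₂≡0 q₃≡0 Σq)))
           (≡.cong₂ _,_ (≡.trans p₂≡0 (≡.sym q₂≡0)) (≡.trans p₃≡0 (≡.sym q₃≡0)))
      where
      first : ∀ {x y z} → y ≡ 0ℚ → z ≡ 0ℚ → x ℚ.+ y ℚ.+ z ≡ M → x ≡ M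
      first {x = x} ≡.refl ≡.refl e = ≡.trans (≡.sym (≡.trans (ℚ.+-identityʳ (x ℚ.+ 0ℚ)) (ℚ.+-identityʳ x))) e

newton-polytope : ∀ m → 1 ℕ.≤ m → (I : Pred Exponent 0ℓ) → (∀ i j → i ℕ.+ j ≡ m → I (i , j , 0)) → I (0 , 0 , m) → I ⊆ 𝓜₃ m →
  ∀ f → Family m I f → IsNewtonPolytope (homogenize m f) (H m)
newton-polytope m 1≤m I edge vertex I⊆ f (_ , support) v = mk⇔ (extreme⇒vertex m 1≤m S S-x S-y S-z S⊆ v)
  λ { (e , e∈ , ≡.refl) → vertex⇒extreme m 1≤m S S-x S-y S-z S⊆ e e∈ }
  where
  S = Support (homogenize m f)
  S-x = Equivalence.from (support (m , 0 , 0)) (edge m 0 (ℕ.+-identityʳ m))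
  S-y = Equivalence.from (support (0 , m , 0)) (edge 0 m ≡.refl)
  S-z = Equivalence.from (support (0 , 0 , m)) vertex
  S⊆ : S ⊆ 𝓜₃ m
  S⊆ {e} Fe≢0 = I⊆ (Equivalence.to (support e) Fe≢0)

-- Counting polynomials

vectors : ∀ {A : Set} {n} → (Fin n → List A) → List (Vec A n)
vectors {n = zero}  vs = [] ∷ []
vectors {n = suc n} vs = cartesianProductWith _∷_ (vs zero) (vectors (vs ∘ suc))

vectors-unique : ∀ {A : Set} {n} (vs : Fin n → List A) → (∀ i → Unique (vs i)) → Unique (vectors vs)
vectors-unique {n = zero}  vs _ = [] ∷ []
vectors-unique {n = suc n} vs u = Unique.cartesianProductWith⁺ _∷_ Vec.∷-injective (u zero) (vectors-unique (vs ∘ suc) (u ∘ suc))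

∈-vectors⁺ : ∀ {A : Set} {n} (vs : Fin n → List A) (v : Vec A n) → (∀ i → lookup v i ∈ᴸ vs i) → v ∈ᴸ vectors vs
∈-vectors⁺ vs []      _ = here ≡.refl
∈-vectors⁺ vs (x ∷ v) h = ∈-cartesianProductWith⁺ _∷_ (h zero) (∈-vectors⁺ (vs ∘ suc) v (h ∘ suc))

∈-vectors⁻ : ∀ {A : Set} {n} (vs : Fin n → List A) (v : Vec A n) → v ∈ᴸ vectors vs → ∀ i → lookup v i ∈ᴸ vs i
∈-vectors⁻ {n = suc n} vs v v∈ i with ∈-cartesianProductWith⁻ _∷_ (vs zero) (vectors (vs ∘ suc)) v∈
∈-vectors⁻ {n = suc n} vs v v∈ zero    | x , w , x∈ , w∈ , ≡.refl = x∈
∈-vectors⁻ {n = suc n} vs v v∈ (suc i) | x , w , x∈ , w∈ , ≡.refl = ∈-vectors⁻ (vs ∘ suc) w w∈ i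

length-cartesianProductWith : ∀ {A B C : Set} (f : A → B → C) xs ys → length (cartesianProductWith f xs ys) ≡ length xs ℕ.* length ys
length-cartesianProductWith f []       ys = ≡.refl
length-cartesianProductWith f (x ∷ xs) ys = ≡.trans (List.length-++ (List.map (f x) ys))
  (≡.cong₂ ℕ._+_ (List.length-map (f x) ys) (length-cartesianProductWith f xs ys))

length-vectors-≤ : ∀ {A : Set} C {n} (us vs : Fin n → List A) → (∀ i → length (us i) ℕ.≤ C ℕ.* length (vs i)) →
  length (vectors us) ℕ.≤ C ℕ.^ n ℕ.* length (vectors vs)
length-vectors-≤ C {zero}  us vs _ = ℕ.≤-refl
length-vectors-≤ C {suc n} us vs h = begin
  length (vectors us)                                               ≡⟨ length-cartesianProductWith _∷_ (us zero) (vectors (us ∘ suc)) ⟩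
  length (us zero) ℕ.* length (vectors (us ∘ suc))                  ≤⟨ ℕ.*-mono-≤ (h zero) (length-vectors-≤ C (us ∘ suc) (vs ∘ suc) (h ∘ suc)) ⟩
  C ℕ.* a ℕ.* (C ℕ.^ n ℕ.* b)                                       ≡⟨ solve 4 (λ C a D b → C :* a :* (D :* b) := C :* D :* (a :* b)) ≡.refl C a (C ℕ.^ n) b ⟩
  C ℕ.* C ℕ.^ n ℕ.* (a ℕ.* b)                                       ≡⟨ ≡.cong (C ℕ.* C ℕ.^ n ℕ.*_) (≡.sym (length-cartesianProductWith _∷_ (vs zero) (vectors (vs ∘ suc)))) ⟩
  C ℕ.^ suc n ℕ.* length (vectors vs)                               ∎
  where
  open ℕ.≤-Reasoning
  open ℕSolver
  a = length (vs zero)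
  b = length (vectors (vs ∘ suc))

length-vectors-positive : ∀ {A : Set} {n} (vs : Fin n → List A) → (∀ i → 0 ℕ.< length (vs i)) → 0 ℕ.< length (vectors vs)
length-vectors-positive {n = zero}  vs _ = s≤s z≤n
length-vectors-positive {n = suc n} vs h = ≡.subst (0 ℕ.<_) (≡.sym (length-cartesianProductWith _∷_ (vs zero) (vectors (vs ∘ suc))))
  (ℕ.*-mono-≤ (h zero) (length-vectors-positive (vs ∘ suc) (h ∘ suc)))

lookup-injective : ∀ {A : Set} {n} (v w : Vec A n) → (∀ i → lookup v i ≡ lookup w i) → v ≡ w
lookup-injective v w e = ≡.trans (≡.sym (Vec.tabulate∘lookup v)) (≡.trans (Vec.tabulate-cong e) (Vec.tabulate∘lookup w))

nonzero-integers : ℕ → List ℤ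
nonzero-integers B = List.map (λ t → + suc t) (upTo B) ++ List.map -[1+_] (upTo B)

∈-nonzero-integers⁺ : ∀ B k → k ≢ 0ℤ → ∣ k ∣ ℕ.≤ B → k ∈ᴸ nonzero-integers B
∈-nonzero-integers⁺ B (+ zero)  k≢0 _ = ⊥-elim (k≢0 ≡.refl)
∈-nonzero-integers⁺ B (+ suc t) _ t< = ∈-++⁺ˡ (∈-map⁺ (λ t → + suc t) (∈-upTo⁺ t<))
∈-nonzero-integers⁺ B -[1+ t ]  _ t< = ∈-++⁺ʳ (List.map (λ t → + suc t) (upTo B)) (∈-map⁺ -[1+_] (∈-upTo⁺ t<))

∈-nonzero-integers⁻ : ∀ B k → k ∈ᴸ nonzero-integers B → k ≢ 0ℤ × ∣ k ∣ ℕ.≤ B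
∈-nonzero-integers⁻ B k k∈ with ∈-++⁻ (List.map (λ t → + suc t) (upTo B)) k∈
... | inj₁ p with ∈-map⁻ (λ t → + suc t) p
...   | t , t∈ , ≡.refl = (λ ()) , ∈-upTo⁻ t∈
∈-nonzero-integers⁻ B k k∈ | inj₂ p with ∈-map⁻ -[1+_] p
...   | t , t∈ , ≡.refl = (λ ()) , ∈-upTo⁻ t∈

nonzero-integers-unique : ∀ B → Unique (nonzero-integers B)
nonzero-integers-unique B = Unique.++⁺ (Unique.map⁺ (λ { ≡.refl → ≡.refl }) (Unique.upTo⁺ B)) (Unique.map⁺ (λ { ≡.refl → ≡.refl }) (Unique.upTo⁺ B)) disjoint
  where
  disjoint : ∀ {k} → ¬ (k ∈ᴸ List.map (λ t → + suc t) (upTo B) × k ∈ᴸ List.map -[1+_] (upTo B))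
  disjoint (p , q) with ∈-map⁻ (λ t → + suc t) p | ∈-map⁻ -[1+_] q
  ... | _ , _ , ≡.refl | _ , _ , ()

length-nonzero-integers : ∀ B → length (nonzero-integers B) ≡ B ℕ.+ B
length-nonzero-integers B = ≡.trans (List.length-++ (List.map (λ t → + suc t) (upTo B)))
  (≡.cong₂ ℕ._+_ (≡.trans (List.length-map (λ t → + suc t) (upTo B)) (List.length-upTo B)) (≡.trans (List.length-map -[1+_] (upTo B)) (List.length-upTo B)))

-- The multiples of 27 start at 27 so that the values are nonzero even for residue 0. With residues
-- between 0 and 9 they stay below 27(q + 1). Restricting to positive values costs only a constant
-- factor in the density.
congruent-integers : ℤ → ℕ → List ℤ
congruent-integers r q = List.map (λ t → r ℤ.+ + suc t ℤ.* + 27) (upTo q)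

congruent-integers-unique : ∀ r q → Unique (congruent-integers r q)
congruent-integers-unique r q = Unique.map⁺ (λ {t} {u} e → ℕ.suc-injective (ℤ.+-injective (ℤ.*-cancelʳ-≡ (+ suc t) (+ suc u) (+ 27) (AbelianGroupProperties.∙-cancelˡ ℤ.+-0-abelianGroup r (+ suc t ℤ.* + 27) (+ suc u ℤ.* + 27) e)))) (Unique.upTo⁺ q)

target-small : ∀ m i j → ∃[ τ ] τ ℕ.≤ 9 × target m i j ≡ + τ
target-small m zero    zero    = 9 , ℕ.≤-refl , ≡.refl
target-small m zero    (suc j) with suc j ℕ.≡ᵇ m
... | true  = 3 , s≤s (s≤s (s≤s z≤n)) , ≡.refl
... | false = 0 , z≤n , ≡.refl
target-small m (suc i) zero    with suc i ℕ.≡ᵇ m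
... | true  = 1 , s≤s z≤n , ≡.refl
... | false = 0 , z≤n , ≡.refl
target-small m (suc i) (suc j) = 0 , z≤n , ≡.refl

∈-congruent-integers⁻ : ∀ m i j q k → k ∈ᴸ congruent-integers (target m i j) q →
  k ≢ 0ℤ × ∣ k ∣ ℕ.≤ suc q ℕ.* 27 × (∃[ c ] k ≡ target m i j ℤ.+ c ℤ.* + 27)
∈-congruent-integers⁻ m i j q k k∈ = go (∈-map⁻ (λ t → target m i j ℤ.+ + suc t ℤ.* + 27) k∈) (target-small m i j)
  where
  go : ∃[ t ] t ∈ᴸ upTo q × k ≡ target m i j ℤ.+ + suc t ℤ.* + 27 → ∃[ τ ] τ ℕ.≤ 9 × target m i j ≡ + τ →
    k ≢ 0ℤ × ∣ k ∣ ℕ.≤ suc q ℕ.* 27 × (∃[ c ] k ≡ target m i j ℤ.+ c ℤ.* + 27)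
  go (t , t∈ , k≡) (τ , τ≤9 , target≡) = (λ k≡0 → positive (≡.trans (≡.sym k≡′) k≡0)) ,
    ≡.subst (λ k → ∣ k ∣ ℕ.≤ suc q ℕ.* 27) (≡.sym k≡′) (small τ t τ≤9 (∈-upTo⁻ t∈)) , + suc t , k≡
    where
    small : ∀ τ t → τ ℕ.≤ 9 → t ℕ.< q → τ ℕ.+ suc t ℕ.* 27 ℕ.≤ suc q ℕ.* 27
    small τ t τ≤9 t<q = ℕ.+-mono-≤ {τ} {27} {suc t ℕ.* 27} {q ℕ.* 27} (ℕ.≤-trans τ≤9 (ℕ.m≤m+n 9 18)) (ℕ.*-monoˡ-≤ 27 t<q)
    k≡′ : k ≡ + (τ ℕ.+ suc t ℕ.* 27)
    k≡′ = ≡.trans k≡ (≡.cong₂ ℤ._+_ target≡ (≡.sym (ℤ.pos-* (suc t) 27)))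
    positive : + (τ ℕ.+ suc t ℕ.* 27) ≢ 0ℤ
    positive e = ℕ.m+1+n≢0 τ (ℤ.+-injective e)

-- Polynomials with coefficients from prescribed lists

module Box (m : ℕ) where

  -- The square 0 ≤ i, j ≤ m contains the triangle i + j ≤ m of possible exponents; a square makes
  -- the count a plain product. Vectors give a propositional equality of matrices.
  Matrix : Set
  Matrix = Vec (Vec ℤ (suc m)) (suc m)

  entry : Matrix → ∀ {i j} → Dec (i ℕ.< suc m) → Dec (j ℕ.< suc m) → ℤ
  entry M (yes i<) (yes j<) = lookup (lookup M (fromℕ< i<)) (fromℕ< j<)
  entry M (yes i<) (no _)   = 0ℤ
  entry M (no _)   _        = 0ℤ

  outside : ∀ i j → m ℕ.+ m ℕ.< i ℕ.+ j → ¬ (i ℕ.< suc m × j ℕ.< suc m)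
  outside i j m+m< (i< , j<) = ℕ.<-irrefl ≡.refl (ℕ.<-≤-trans m+m< (ℕ.+-mono-≤ (ℕ.≤-pred i<) (ℕ.≤-pred j<)))

  entry-outside : ∀ M {i j} (p : Dec (i ℕ.< suc m)) (q : Dec (j ℕ.< suc m)) → ¬ (i ℕ.< suc m × j ℕ.< suc m) → entry M p q ≡ 0ℤ
  entry-outside M (yes i<) (yes j<) out = ⊥-elim (out (i< , j<))
  entry-outside M (yes i<) (no _)   out = ≡.refl
  entry-outside M (no _)   _        out = ≡.refl

  polynomial : Matrix → ℤ[x,y]
  polynomial M = record
    { coeff     = λ i j → entry M (i ℕ.<? suc m) (j ℕ.<? suc m)
    -- The largest value of i + j in the square.
    ; bound     = m ℕ.+ m
    ; vanishing = λ i j m+m< → entry-outside M (i ℕ.<? suc m) (j ℕ.<? suc m) (outside i j m+m<)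
    }

  entry-inside : ∀ M (a b : Fin (suc m)) (p : Dec (toℕ a ℕ.< suc m)) (q : Dec (toℕ b ℕ.< suc m)) → entry M p q ≡ lookup (lookup M a) b
  entry-inside M a b (yes p) (yes q) = ≡.cong₂ (λ a b → lookup (lookup M a) b) (Fin.fromℕ<-toℕ a p) (Fin.fromℕ<-toℕ b q)
  entry-inside M a b (yes p) (no ¬q) = ⊥-elim (¬q (Fin.toℕ<n b))
  entry-inside M a b (no ¬p) _       = ⊥-elim (¬p (Fin.toℕ<n a))

  coeff-polynomial : ∀ M a b → coeff (polynomial M) (toℕ a) (toℕ b) ≡ lookup (lookup M a) b
  coeff-polynomial M a b = entry-inside M a b (toℕ a ℕ.<? suc m) (toℕ b ℕ.<? suc m)

  polynomial-injective : ∀ {M N} → (∀ i j → coeff (polynomial M) i j ≡ coeff (polynomial N) i j) → M ≡ N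
  polynomial-injective {M} {N} e = lookup-injective M N λ a → lookup-injective (lookup M a) (lookup N a) λ b →
    ≡.trans (≡.sym (coeff-polynomial M a b)) (≡.trans (e (toℕ a) (toℕ b)) (coeff-polynomial N a b))

  row : (ℕ → ℕ → List ℤ) → Fin (suc m) → Fin (suc m) → List ℤ
  row V a b = V (toℕ a) (toℕ b)

  rows : (ℕ → ℕ → List ℤ) → Fin (suc m) → List (Vec ℤ (suc m))
  rows V a = vectors (row V a)

  matrices : (ℕ → ℕ → List ℤ) → List Matrix
  matrices V = vectors (rows V)

  polynomials : (ℕ → ℕ → List ℤ) → List ℤ[x,y]
  polynomials V = List.map polynomial (matrices V)

  polynomials-unique : ∀ V → (∀ i j → Unique (V i j)) → Uniqueᴾ (polynomials V)
  polynomials-unique V u = SetoidUnique.map⁺ (≡.setoid Matrix) ℤ[x,y]-setoid polynomial-injective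
    (vectors-unique (rows V) λ a → vectors-unique (row V a) λ b → u (toℕ a) (toℕ b))

  polynomials-all : ∀ {p} {Q : Pred ℤ[x,y] p} V → (∀ M → (∀ i j → i ℕ.< suc m → j ℕ.< suc m → coeff (polynomial M) i j ∈ᴸ V i j) → Q (polynomial M)) → All Q (polynomials V)
  polynomials-all V h = All.map⁺ (All.tabulate λ {M} M∈ → h M λ i j i< j< →
    ≡.subst₂ (λ i j → coeff (polynomial M) i j ∈ᴸ V i j) (Fin.toℕ-fromℕ< i<) (Fin.toℕ-fromℕ< j<)
      (≡.subst (_∈ᴸ row V (fromℕ< i<) (fromℕ< j<)) (≡.sym (coeff-polynomial M (fromℕ< i<) (fromℕ< j<)))
        (∈-vectors⁻ (row V (fromℕ< i<)) (lookup M (fromℕ< i<)) (∈-vectors⁻ (rows V) M M∈ (fromℕ< i<)) (fromℕ< j<))))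

  ∈-polynomials : ∀ V f → (∀ i j → i ℕ.< suc m → j ℕ.< suc m → coeff f i j ∈ᴸ V i j) →
    (∀ i j → ¬ (i ℕ.< suc m × j ℕ.< suc m) → coeff f i j ≡ 0ℤ) → f ∈ᴾ polynomials V
  ∈-polynomials V f inside out = Any.map⁺ (Any.map (λ { ≡.refl → f≈ }) M∈)
    where
    M : Matrix
    M = tabulate λ a → tabulate λ b → coeff f (toℕ a) (toℕ b)
    lookup-M : ∀ a b → lookup (lookup M a) b ≡ coeff f (toℕ a) (toℕ b)
    lookup-M a b = ≡.trans (≡.cong (λ v → lookup v b) (Vec.lookup∘tabulate (λ a → tabulate λ b → coeff f (toℕ a) (toℕ b)) a)) (Vec.lookup∘tabulate (λ b → coeff f (toℕ a) (toℕ b)) b)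
    M∈ : M ∈ᴸ matrices V
    M∈ = ∈-vectors⁺ (rows V) M λ a → ∈-vectors⁺ (row V a) (lookup M a) λ b →
      ≡.subst (_∈ᴸ V (toℕ a) (toℕ b)) (≡.sym (lookup-M a b)) (inside (toℕ a) (toℕ b) (Fin.toℕ<n a) (Fin.toℕ<n b))
    f≈ : ∀ i j → coeff f i j ≡ coeff (polynomial M) i j
    f≈ i j = go (i ℕ.<? suc m) (j ℕ.<? suc m)
      where
      go : (p : Dec (i ℕ.< suc m)) (q : Dec (j ℕ.< suc m)) → coeff f i j ≡ entry M p q
      go (yes i<) (yes j<) = ≡.sym (≡.trans (lookup-M (fromℕ< i<) (fromℕ< j<)) (≡.cong₂ (coeff f) (Fin.toℕ-fromℕ< i<) (Fin.toℕ-fromℕ< j<)))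
      go (yes i<) (no j≮)  = out i j (j≮ ∘ proj₂)
      go (no i≮)  _        = out i j (i≮ ∘ proj₁)

  length-polynomials-≤ : ∀ C U V → (∀ i j → length (U i j) ℕ.≤ C ℕ.* length (V i j)) →
    length (polynomials U) ℕ.≤ (C ℕ.^ suc m) ℕ.^ suc m ℕ.* length (polynomials V)
  length-polynomials-≤ C U V h = ≡.subst₂ (λ a b → a ℕ.≤ (C ℕ.^ suc m) ℕ.^ suc m ℕ.* b)
    (≡.sym (List.length-map polynomial (matrices U))) (≡.sym (List.length-map polynomial (matrices V)))
    (length-vectors-≤ (C ℕ.^ suc m) (rows U) (rows V) λ a → length-vectors-≤ C (row U a) (row V a) λ b → h (toℕ a) (toℕ b))

  length-polynomials-positive : ∀ V → (∀ i j → 0 ℕ.< length (V i j)) → 0 ℕ.< length (polynomials V)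
  length-polynomials-positive V h = ≡.subst (0 ℕ.<_) (≡.sym (List.length-map polynomial (matrices V)))
    (length-vectors-positive (rows V) λ a → length-vectors-positive (row V a) λ b → h (toℕ a) (toℕ b))

-- Fractions, and the gcd of the vertex coordinates

fraction-≤ : ∀ D n k {{_ : NonZero D}} {{_ : NonZero n}} → n ℕ.≤ D ℕ.* k → + 1 ℚ./ D ℚ.≤ + k ℚ./ n
fraction-≤ (suc D) (suc n) k n≤Dk = ℚ.toℚᵘ-cancel-≤ (ℚᵘ.≤-respˡ-≃ (ℚᵘ.≃-sym (ℚ.toℚᵘ-fromℚᵘ (ℚᵘ.mkℚᵘ (+ 1) D)))
  (ℚᵘ.≤-respʳ-≃ (ℚᵘ.≃-sym (ℚ.toℚᵘ-fromℚᵘ (ℚᵘ.mkℚᵘ (+ k) n))) (ℚᵘ.*≤* (≡.subst₂ ℤ._≤_ (≡.sym (ℤ.*-identityˡ (+ suc n)))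
    (≡.trans (≡.cong +_ (ℕ.*-comm (suc D) k)) (ℤ.pos-* k (suc D))) (ℤ.+≤+ n≤Dk)))))

fraction-positive : ∀ D {{_ : NonZero D}} → 0ℚ ℚ.< + 1 ℚ./ D
fraction-positive D = ℚ.positive⁻¹ (+ 1 ℚ./ D) {{ℚ.normalize-pos 1 D}}

gcd-diagonal : ∀ n → gcd n n ≡ n
gcd-diagonal n = ℕ∣.∣-antisym (gcd[m,n]∣m n n) (gcd-greatest ℕ∣.∣-refl ℕ∣.∣-refl)

G-∷ : ∀ i j k es g → G es ≡ g → G ((i , j , k) ∷ es) ≡ gcd i (gcd j (gcd k g))
G-∷ i j k es g ≡.refl = ≡.refl

G-H : ∀ m → m ≡ G (H m)
G-H m = ≡.sym (≡.trans (≡.cong G {x = H m} {y = (0 , 0 , m) ∷ (0 , m , 0) ∷ (m , 0 , 0) ∷ []} ≡.refl)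
  (≡.trans (G-∷ 0 0 m ((0 , m , 0) ∷ (m , 0 , 0) ∷ []) m
    (≡.trans (G-∷ 0 m 0 ((m , 0 , 0) ∷ []) m (≡.trans (G-∷ m 0 0 [] 0 ≡.refl) (gcd-x m))) (gcd-y m))) (gcd-z m)))
  where
  gcd-x : ∀ m → gcd m (gcd 0 (gcd 0 0)) ≡ m
  gcd-x m = gcd-identityʳ m
  gcd-y : ∀ m → gcd 0 (gcd m (gcd 0 m)) ≡ m
  gcd-y m = ≡.trans (gcd-identityˡ (gcd m (gcd 0 m))) (≡.trans (≡.cong (gcd m) (gcd-identityˡ m)) (gcd-diagonal m))
  gcd-z : ∀ m → gcd 0 (gcd 0 (gcd m m)) ≡ m
  gcd-z m = ≡.trans (gcd-identityˡ (gcd 0 (gcd m m))) (≡.trans (gcd-identityˡ (gcd m m)) (gcd-diagonal m))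

-- The positive proportion

module Density (m : ℕ) (1≤m : 1 ℕ.≤ m) (I : Pred Exponent 0ℓ) (I? : Decidable I)
  (edge : ∀ i j → i ℕ.+ j ≡ m → I (i , j , 0)) (vertex : I (0 , 0 , m)) (I⊆ : I ⊆ 𝓜₃ m) where
  open Box m

  Allowed : ℕ → ℕ → Set
  Allowed i j = i ℕ.+ j ℕ.≤ m × I (i , j , m ∸ (i ℕ.+ j))

  allowed? : ∀ i j → Dec (Allowed i j)
  allowed? i j = (i ℕ.+ j ℕ.≤? m) ×-dec I? (i , j , m ∸ (i ℕ.+ j))

  edge-allowed : ∀ i j → i ℕ.+ j ≡ m → Allowed i j
  edge-allowed i j e = ℕ.≤-reflexive e , ≡.subst (λ k → I (i , j , k)) (≡.sym (≡.trans (≡.cong (m ∸_) e) (ℕ.n∸n≡0 m))) (edge i j e)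

  outside-box : ∀ i j → ¬ (i ℕ.< suc m × j ℕ.< suc m) → ¬ Allowed i j
  outside-box i j out (i+j≤m , _) = out (s≤s (ℕ.≤-trans (ℕ.m≤m+n i j) i+j≤m) , s≤s (ℕ.≤-trans (ℕ.m≤n+m j i) i+j≤m))

  -- An excluded position still contributes a factor 1, so that the two counts are products over the
  -- same positions and can be compared factor by factor.
  choose : ∀ {i j} → List ℤ → Dec (Allowed i j) → List ℤ
  choose vs (yes _) = vs
  choose vs (no _)  = 0ℤ ∷ []

  values : (ℕ → ℕ → List ℤ) → ℕ → ℕ → List ℤ
  values V i j = choose (V i j) (allowed? i j)

  values-unique : ∀ V → (∀ i j → Unique (V i j)) → ∀ i j → Unique (values V i j)
  values-unique V u i j with allowed? i j
  ... | yes _ = u i j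
  ... | no _  = [] ∷ []

  length-values-≤ : ∀ C U V → 1 ℕ.≤ C → (∀ i j → length (U i j) ℕ.≤ C ℕ.* length (V i j)) → ∀ i j → length (values U i j) ℕ.≤ C ℕ.* length (values V i j)
  length-values-≤ C U V 1≤C h i j with allowed? i j
  ... | yes _ = h i j
  ... | no _  = ≡.subst (1 ℕ.≤_) (≡.sym (ℕ.*-identityʳ C)) 1≤C

  length-values-positive : ∀ V → (∀ i j → 0 ℕ.< length (V i j)) → ∀ i j → 0 ℕ.< length (values V i j)
  length-values-positive V h i j with allowed? i j
  ... | yes _ = h i j
  ... | no _  = s≤s z≤n

  -- Membership in the family, the height bound and the congruence are all conditions on single
  -- coefficients at the allowed positions; one record parametrised by `Q` covers them.
  record Supported (Q : ℕ → ℕ → ℤ → Set) (f : ℤ[x,y]) : Set where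
    field
      allowed  : ∀ i j → Allowed i j → Q i j (coeff f i j)
      excluded : ∀ i j → ¬ Allowed i j → coeff f i j ≡ 0ℤ

  supported : ∀ {Q V} → (∀ i j k → k ∈ᴸ V i j → Q i j k) → ∀ M →
    (∀ i j → i ℕ.< suc m → j ℕ.< suc m → coeff (polynomial M) i j ∈ᴸ values V i j) → Supported Q (polynomial M)
  supported {Q} {V} V⇒Q M h = record { allowed = allowed ; excluded = excluded }
    where
    in-box : ∀ i j → Allowed i j → i ℕ.< suc m × j ℕ.< suc m
    in-box i j (i+j≤m , _) = s≤s (ℕ.≤-trans (ℕ.m≤m+n i j) i+j≤m) , s≤s (ℕ.≤-trans (ℕ.m≤n+m j i) i+j≤m)
    allowed : ∀ i j → Allowed i j → Q i j (coeff (polynomial M) i j)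
    allowed i j ok = by (allowed? i j) (h i j (proj₁ (in-box i j ok)) (proj₂ (in-box i j ok)))
      where
      by : (d : Dec (Allowed i j)) → coeff (polynomial M) i j ∈ᴸ choose (V i j) d → Q i j (coeff (polynomial M) i j)
      by (yes _)  k∈ = V⇒Q i j _ k∈
      by (no ¬ok) _  = ⊥-elim (¬ok ok)
    excluded : ∀ i j → ¬ Allowed i j → coeff (polynomial M) i j ≡ 0ℤ
    excluded i j ¬ok = by (i ℕ.<? suc m) (j ℕ.<? suc m)
      where
      by′ : (d : Dec (Allowed i j)) → coeff (polynomial M) i j ∈ᴸ choose (V i j) d → coeff (polynomial M) i j ≡ 0ℤ
      by′ (yes ok) _ = ⊥-elim (¬ok ok)
      by′ (no _) (here e) = e
      by : Dec (i ℕ.< suc m) → Dec (j ℕ.< suc m) → coeff (polynomial M) i j ≡ 0ℤ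
      by (yes i<) (yes j<) = by′ (allowed? i j) (h i j i< j<)
      by (yes i<) (no j≮)  = entry-outside M (i ℕ.<? suc m) (j ℕ.<? suc m) (j≮ ∘ proj₂)
      by (no i≮)  _        = entry-outside M (i ℕ.<? suc m) (j ℕ.<? suc m) (i≮ ∘ proj₁)

  homogenize-off : ∀ f i j k → i ℕ.+ j ℕ.+ k ≢ m → homogenize m f (i , j , k) ≡ 0ℤ
  homogenize-off f i j k ≢m = ≡.cong (if_then coeff f i j else 0ℤ) (≢⇒≡ᵇfalse (i ℕ.+ j ℕ.+ k) m ≢m)

  supported⇒family : ∀ f → Supported (λ _ _ k → k ≢ 0ℤ) f → Family m I f
  supported⇒family f s = ((λ i j m<i+j → excluded i j λ { (i+j≤m , _) → ℕ.<-irrefl ≡.refl (ℕ.<-≤-trans m<i+j i+j≤m) }) ,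
      m , 0 , ℕ.+-identityʳ m , allowed m 0 (edge-allowed m 0 (ℕ.+-identityʳ m))) ,
    λ { (i , j , k) → mk⇔ (to i j k) (from i j k) }
    where
    open Supported s
    k≡ : ∀ i j k → i ℕ.+ j ℕ.+ k ≡ m → m ∸ (i ℕ.+ j) ≡ k
    k≡ i j k e = ≡.trans (≡.cong (_∸ (i ℕ.+ j)) (≡.sym e)) (ℕ.m+n∸m≡n (i ℕ.+ j) k)
    to : ∀ i j k → Support (homogenize m f) (i , j , k) → I (i , j , k)
    to i j k F≢0 with i ℕ.+ j ℕ.+ k ℕ.≟ m
    ... | no ≢m = ⊥-elim (F≢0 (homogenize-off f i j k ≢m))
    ... | yes e with allowed? i j
    ...   | yes (_ , ok) = ≡.subst (λ k → I (i , j , k)) (k≡ i j k e) ok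
    ...   | no ¬ok = ⊥-elim (F≢0 (≡.trans (homogenize-coeff m f i j k e) (excluded i j ¬ok)))
    from : ∀ i j k → I (i , j , k) → Support (homogenize m f) (i , j , k)
    from i j k ok F≡0 = allowed i j (≡.subst (i ℕ.+ j ℕ.≤_) e (ℕ.m≤m+n (i ℕ.+ j) k) , ≡.subst (λ k → I (i , j , k)) (≡.sym (k≡ i j k e)) ok)
      (≡.trans (≡.sym (homogenize-coeff m f i j k e)) F≡0)
      where
      e : i ℕ.+ j ℕ.+ k ≡ m
      e = I⊆ ok

  supported⇒height : ∀ f B → Supported (λ _ _ k → ∣ k ∣ ℕ.≤ B) f → Height≤ B f
  supported⇒height f B s i j with allowed? i j
  ... | yes ok = Supported.allowed s i j ok
  ... | no ¬ok = ≡.subst (λ k → ∣ k ∣ ℕ.≤ B) (≡.sym (Supported.excluded s i j ¬ok)) z≤n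

  -- At an excluded position the coefficient is 0, and so is the target: its three nonzero positions
  -- correspond to the corners, which `I` contains.
  supported⇒congruent : ∀ f → Supported (λ i j k → ∃[ c ] k ≡ target m i j ℤ.+ c ℤ.* + 27) f → CongruentToTarget m f
  supported⇒congruent f s i j i+j≤m with allowed? i j
  ... | yes ok = Supported.allowed s i j ok
  ... | no ¬ok = 0ℤ , ≡.trans (Supported.excluded s i j ¬ok) (≡.sym (≡.trans (ℤ.+-identityʳ (target m i j)) (target-0 m i j corner-0 corner-x corner-y)))
    where
    corner-0 : i ≢ 0 ⊎ j ≢ 0
    corner-0 with i ℕ.≟ 0 | j ℕ.≟ 0
    ... | no p | _ = inj₁ p
    ... | yes _ | no p = inj₂ p
    ... | yes ≡.refl | yes ≡.refl = ⊥-elim (¬ok (z≤n , vertex))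
    corner-x : i ≢ m ⊎ j ≢ 0
    corner-x with i ℕ.≟ m | j ℕ.≟ 0
    ... | no p | _ = inj₁ p
    ... | yes _ | no p = inj₂ p
    ... | yes i≡m | yes ≡.refl = ⊥-elim (¬ok (edge-allowed i 0 (≡.trans (ℕ.+-identityʳ i) i≡m)))
    corner-y : i ≢ 0 ⊎ j ≢ m
    corner-y with i ℕ.≟ 0 | j ℕ.≟ m
    ... | no p | _ = inj₁ p
    ... | yes _ | no p = inj₂ p
    ... | yes ≡.refl | yes j≡m = ⊥-elim (¬ok (edge-allowed 0 j j≡m))

  Supported-map : ∀ {Q Q′ f} → (∀ i j k → Q i j k → Q′ i j k) → Supported Q f → Supported Q′ f
  Supported-map h s = record { allowed = λ i j ok → h i j _ (Supported.allowed s i j ok) ; excluded = Supported.excluded s }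

  family⇒supported : ∀ f → Family m I f → Supported (λ _ _ k → k ≢ 0ℤ) f
  family⇒supported f ((vanish , _) , support) = record { allowed = allowed ; excluded = excluded }
    where
    allowed : ∀ i j → Allowed i j → coeff f i j ≢ 0ℤ
    allowed i j (i+j≤m , ok) c≡0 = Equivalence.from (support (i , j , m ∸ (i ℕ.+ j))) ok
      (≡.trans (homogenize-coeff m f i j (m ∸ (i ℕ.+ j)) (ℕ.m+[n∸m]≡n i+j≤m)) c≡0)
    excluded : ∀ i j → ¬ Allowed i j → coeff f i j ≡ 0ℤ
    excluded i j ¬ok with i ℕ.+ j ℕ.≤? m
    ... | no ≰m = vanish i j (ℕ.≰⇒> ≰m)
    ... | yes ≤m = decidable-stable (coeff f i j ℤ.≟ 0ℤ) λ c≢0 → ¬ok (≤m , Equivalence.to (support (i , j , m ∸ (i ℕ.+ j)))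
      λ F≡0 → c≢0 (≡.trans (≡.sym (homogenize-coeff m f i j (m ∸ (i ℕ.+ j)) (ℕ.m+[n∸m]≡n ≤m))) F≡0))

  all-values : ℕ → ℕ → ℕ → List ℤ
  all-values B i j = nonzero-integers B

  good-values : ℕ → ℕ → ℕ → List ℤ
  good-values q i j = congruent-integers (target m i j) q

  cardinality : ∀ B → HasCardinality (Family m I ∩ Height≤ B) (length (polynomials (values (all-values B))))
  cardinality B = polynomials (values (all-values B)) ,
    polynomials-unique (values (all-values B)) (values-unique (all-values B) λ _ _ → nonzero-integers-unique B) ,
    polynomials-all (values (all-values B)) (λ M h → let s = supported {λ _ _ k → k ≢ 0ℤ × ∣ k ∣ ℕ.≤ B} {all-values B} (λ _ _ → ∈-nonzero-integers⁻ B) M h in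
      supported⇒family (polynomial M) (Supported-map (λ _ _ _ → proj₁) s) , supported⇒height (polynomial M) B (Supported-map (λ _ _ _ → proj₂) s)) ,
    complete , ≡.refl
    where
    complete : ∀ f → (Family m I ∩ Height≤ B) f → f ∈ᴾ polynomials (values (all-values B))
    complete f (family , height) = ∈-polynomials (values (all-values B)) f (λ i j _ _ → inside i j (allowed? i j)) λ i j out → excluded i j (outside-box i j out)
      where
      open Supported (family⇒supported f family)
      inside : ∀ i j (d : Dec (Allowed i j)) → coeff f i j ∈ᴸ choose (all-values B i j) d
      inside i j (yes ok) = ∈-nonzero-integers⁺ B (coeff f i j) (allowed i j ok) (height i j)
      inside i j (no ¬ok) = here (excluded i j ¬ok)

  at-least : ∀ B q → suc q ℕ.* 27 ℕ.≤ B → HasAtLeast (Family m I ∩ Height≤ B ∩ (λ f → IsIndex m f m × m ≡ G (H m))) (length (polynomials (values (good-values q))))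
  at-least B q 27q≤B = polynomials (values (good-values q)) ,
    polynomials-unique (values (good-values q)) (values-unique (good-values q) λ i j → congruent-integers-unique (target m i j) q) ,
    polynomials-all (values (good-values q)) (λ M h → let s = supported {λ i j k → k ≢ 0ℤ × ∣ k ∣ ℕ.≤ suc q ℕ.* 27 × (∃[ c ] k ≡ target m i j ℤ.+ c ℤ.* + 27)} {good-values q} (λ i j → ∈-congruent-integers⁻ m i j q) M h in
      supported⇒family (polynomial M) (Supported-map (λ _ _ _ → proj₁) s) ,
      supported⇒height (polynomial M) B (Supported-map (λ _ _ _ p → ℕ.≤-trans (proj₁ (proj₂ p)) 27q≤B) s) ,
      index m 1≤m (polynomial M) (supported⇒congruent (polynomial M) (Supported-map (λ _ _ _ p → proj₂ (proj₂ p)) s)) , G-H m) ,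
    ≡.refl

  -- One factor 162 for each of the (m + 1)² positions of the square.
  D₀ : ℕ
  D₀ = (162 ℕ.^ suc m) ℕ.^ suc m

  instance
    D₀-nonZero : NonZero D₀
    D₀-nonZero = ℕ.m^n≢0 (162 ℕ.^ suc m) (suc m) {{ℕ.m^n≢0 162 (suc m)}}

  -- There are 2B nonzero integers of absolute value at most `B`, against `q` good ones. As q ≥ 1, B
  -- < 27(q + 2) ≤ 81q, whence the constant 162.
  ratio-bound : ∀ B q → B ℕ.< suc (suc q) ℕ.* 27 → 1 ℕ.≤ q → B ℕ.+ B ℕ.≤ 162 ℕ.* q
  ratio-bound B (suc q) B< _ = begin
    B ℕ.+ B                                            ≤⟨ ℕ.+-mono-≤ (ℕ.<⇒≤ B<) (ℕ.<⇒≤ B<) ⟩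
    suc (suc (suc q)) ℕ.* 27 ℕ.+ suc (suc (suc q)) ℕ.* 27   ≤⟨ ℕ.m≤m+n _ (108 ℕ.* q) ⟩
    suc (suc (suc q)) ℕ.* 27 ℕ.+ suc (suc (suc q)) ℕ.* 27 ℕ.+ 108 ℕ.* q   ≡⟨ solve 1 (λ q → (con 3 :+ q) :* con 27 :+ (con 3 :+ q) :* con 27 :+ con 108 :* q := con 162 :* (con 1 :+ q)) ≡.refl q ⟩
    162 ℕ.* suc q                                      ∎
    where
    open ℕ.≤-Reasoning
    open ℕSolver

  -- The number `q` is one less than the quotient of `B` by 27, because the good values reach up to
  -- 27(q + 1). The threshold 54 ensures q ≥ 1.
  quotient-27 : ∀ B → 54 ℕ.≤ B → ∃[ q ] 1 ℕ.≤ q × suc q ℕ.* 27 ℕ.≤ B × B ℕ.< suc (suc q) ℕ.* 27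
  quotient-27 B 54≤B = go (B ℕ./ 27) (/-monoˡ-≤ 27 54≤B) (m/n*n≤m B 27)
    (≡.subst (ℕ._< suc (B ℕ./ 27) ℕ.* 27) (≡.sym (m≡m%n+[m/n]*n B 27)) (ℕ.+-monoˡ-< (B ℕ./ 27 ℕ.* 27) (m%n<n B 27)))
    where
    go : ∀ Q → 2 ℕ.≤ Q → Q ℕ.* 27 ℕ.≤ B → B ℕ.< suc Q ℕ.* 27 → ∃[ q ] 1 ℕ.≤ q × suc q ℕ.* 27 ℕ.≤ B × B ℕ.< suc (suc q) ℕ.* 27
    go (suc q) (s≤s 1≤q) lower upper = q , 1≤q , lower , upper

  positive-proportion : PositiveProportion (Family m I) (λ f → IsIndex m f m × m ≡ G (H m))
  positive-proportion = + 1 ℚ./ D₀ , fraction-positive D₀ , 54 , λ B 54≤B → let q , 1≤q , lower , upper = quotient-27 B 54≤B in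
    length (polynomials (values (all-values B))) , length (polynomials (values (good-values q))) ,
    nonZero B (ℕ.≤-trans (s≤s z≤n) 54≤B) , cardinality B , at-least B q lower ,
    fraction-≤ D₀ _ _ {{D₀-nonZero}} {{nonZero B (ℕ.≤-trans (s≤s z≤n) 54≤B)}} (length-polynomials-≤ 162 (values (all-values B)) (values (good-values q))
      (length-values-≤ 162 (all-values B) (good-values q) (s≤s z≤n) λ i j →
        ≡.subst₂ (λ a b → a ℕ.≤ 162 ℕ.* b) (≡.sym (length-nonzero-integers B)) (≡.sym (≡.trans (List.length-map _ (upTo q)) (List.length-upTo q))) (ratio-bound B q upper 1≤q)))
    where
    nonZero : ∀ B → 1 ℕ.≤ B → NonZero (length (polynomials (values (all-values B))))
    nonZero B 1≤B = ℕ.>-nonZero (length-polynomials-positive (values (all-values B)) (length-values-positive (all-values B) λ _ _ →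
      ≡.subst (0 ℕ.<_) (≡.sym (length-nonzero-integers B)) (ℕ.≤-trans 1≤B (ℕ.m≤m+n B B))))

open import Data.Nat.Base using (_+_; _≤_)

theorem1p7 : ∀ (m : ℕ) → 1 ≤ m →
    (I : Pred Exponent 0ℓ) → Decidable I →
    (∀ i j → i + j ≡ m → I (i , j , 0)) → I (0 , 0 , m) → I ⊆ 𝓜₃ m →
    PositiveProportion (Family m I) (λ f → IsIndex m f m × m ≡ G (H m)) ×
    (∀ f → Family m I f → IsNewtonPolytope (homogenize m f) (H m))
theorem1p7 m 1≤m I I? edge vertex I⊆ =
  Density.positive-proportion m 1≤m I I? edge vertex I⊆ , newton-polytope m 1≤m I edge vertex I⊆
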